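{- There is an absolute constant $C>0$ such that the following holds. Let $\mathcal{P}=\{x\in\mathbb{R}^d\mid Ax\le c\}$ be a polytope with $A\in\mathbb{Z}^{m\times d}$, $c\in\mathbb{Z}^m_{\ge0}$, and let $V_I\subseteq\mathcal{P}\cap\mathbb{Z}^d$ be the set of vertices of the integer polytope $\mathcal{P}_I=\mathrm{Conv}(\mathcal{P}\cap\mathbb{Z}^d)$ (so $\mathrm{Conv}(V_I)\cap\mathbb{Z}^d=\mathcal{P}\cap\mathbb{Z}^d$). Then for every vector $b\in\mathrm{int.cone}(\mathcal{P}\cap\mathbb{Z}^d)$ there exists an integral vector $\lambda\in\mathbb{Z}_{\ge0}^{\mathcal{P}\cap\mathbb{Z}^d}$ with $b=\sum_{p\in\mathcal{P}\cap\mathbb{Z}^d}\lambda_p p$ such that (1) $\lambda_p\le 2^{2^{Cd}}$ for all $p\in(\mathcal{P}\cap\mathbb{Z}^d)\setminus V_I$, (2) $|\mathrm{supp}(\lambda)\cap V_I|\le d\cdot 2^d$, (3) $|\mathrm{supp}(\lambda)\setminus V_I|\le 2^{2d}$.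
   Context: $\mathrm{int.cone}(\mathcal{P}\cap\mathbb{Z}^d)=\{\sum_{p\in\mathcal{P}\cap\mathbb{Z}^d}\lambda_p p \mid \lambda\in\mathbb{Z}_{\ge0}^{\mathcal{P}\cap\mathbb{Z}^d}\}$. $\mathrm{Conv}(X)$ is the convex hull of $X$. For a vector $\lambda$ indexed by a set $M$, $\mathrm{supp}(\lambda)=\{s\in M\mid\lambda_s\ne0\}$. -}

module Defs where

open import Data.Nat as ℕ using (ℕ)
open import Data.Integer as ℤ using (ℤ; +_)
open import Data.Rational as ℚ using (ℚ; 0ℚ; 1ℚ)
open import Data.Fin using (Fin)
open import Data.Vec using (Vec; []; _∷_; lookup; zipWith; replicate; map)
open import Data.List using (List; []; _∷_; _++_)
import Data.List as L
open import Data.List.Relation.Unary.All using (All)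
open import Data.List.Relation.Unary.Unique.Propositional using (Unique)
open import Data.Product using (Σ; _×_; _,_; proj₁; proj₂; ∃)
open import Relation.Binary.PropositionalEquality using (_≡_; _≢_)
open import Relation.Nullary using (¬_)

ℤVec : ℕ → Set
ℤVec d = Vec ℤ d

ℤMat : ℕ → ℕ → Set
ℤMat m d = Vec (Vec ℤ d) m

dotℤ : ∀ {n} → Vec ℤ n → Vec ℤ n → ℤ
dotℤ [] [] = + 0
dotℤ (a ∷ as) (x ∷ xs) = a ℤ.* x ℤ.+ dotℤ as xs

dotℚ : ∀ {n} → Vec ℚ n → Vec ℚ n → ℚ
dotℚ [] [] = 0ℚ
dotℚ (a ∷ as) (x ∷ xs) = a ℚ.* x ℚ.+ dotℚ as xs

toℚ : ℤ → ℚ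
toℚ z = z ℚ./ 1

toℚVec : ∀ {n} → Vec ℤ n → Vec ℚ n
toℚVec = map toℚ

InPℤ : ∀ {m d} → ℤMat m d → Vec ℕ m → Vec ℤ d → Set
InPℤ A c x = ∀ i → dotℤ (lookup A i) x ℤ.≤ + lookup c i

InPℚ : ∀ {m d} → ℤMat m d → Vec ℕ m → Vec ℚ d → Set
InPℚ A c x = ∀ i → dotℚ (toℚVec (lookup A i)) x ℚ.≤ toℚ (+ lookup c i)

-- P is a polytope (bounded).  Since A, c are rational, boundedness of the
-- real polyhedron is equivalent to boundedness of its rational points.
IsPolytope : ∀ {m d} → ℤMat m d → Vec ℕ m → Set
IsPolytope {m} {d} A c =
  Σ ℕ λ B → ∀ (x : Vec ℚ d) → InPℚ A c x → ∀ (i : Fin d) → ℚ.∣ lookup x i ∣ ℚ.≤ toℚ (+ B)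

_+ℤv_ : ∀ {n} → Vec ℤ n → Vec ℤ n → Vec ℤ n
_+ℤv_ = zipWith ℤ._+_

_·ℤv_ : ∀ {n} → ℕ → Vec ℤ n → Vec ℤ n
k ·ℤv v = map (λ z → + k ℤ.* z) v

_+ℚv_ : ∀ {n} → Vec ℚ n → Vec ℚ n → Vec ℚ n
_+ℚv_ = zipWith ℚ._+_

_·ℚv_ : ∀ {n} → ℚ → Vec ℚ n → Vec ℚ n
q ·ℚv v = map (q ℚ.*_) v

combℤ : ∀ {d} → List (Vec ℤ d × ℕ) → Vec ℤ d
combℤ {d} [] = replicate d (+ 0)
combℤ ((p , k) ∷ rest) = (k ·ℤv p) +ℤv combℤ rest

combℚ : ∀ {d} → List (Vec ℤ d × ℚ) → Vec ℚ d
combℚ {d} [] = replicate d 0ℚ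
combℚ ((p , q) ∷ rest) = (q ·ℚv toℚVec p) +ℚv combℚ rest

sumℚ : ∀ {A : Set} → List (A × ℚ) → ℚ
sumℚ [] = 0ℚ
sumℚ ((_ , q) ∷ rest) = q ℚ.+ sumℚ rest

InIntCone : ∀ {m d} → ℤMat m d → Vec ℕ m → Vec ℤ d → Set
InIntCone {m} {d} A c b =
  Σ (List (Vec ℤ d × ℕ)) λ L → All (λ e → InPℤ A c (proj₁ e)) L × combℤ L ≡ b

InConvOthers : ∀ {m d} → ℤMat m d → Vec ℕ m → Vec ℤ d → Vec ℚ d → Set
InConvOthers {m} {d} A c v y =
  Σ (List (Vec ℤ d × ℚ)) λ L →
      All (λ e → InPℤ A c (proj₁ e) × proj₁ e ≢ v × 0ℚ ℚ.≤ proj₂ e) L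
    × sumℚ L ≡ 1ℚ
    × combℚ L ≡ y

IsVertexI : ∀ {m d} → ℤMat m d → Vec ℕ m → Vec ℤ d → Set
IsVertexI A c v = InPℤ A c v × ¬ InConvOthers A c v (toℚVec v)

{-# OPTIONS --safe #-}
module Submission where

-- Let p be a nonzero lattice point of P.  As 0 ∈ P, Carathéodory's theorem puts p in a simplex
-- spanned by 0 and at most d vertices v of P_I, say p = ∑ x_v v with ∑ x_v ≤ 1.  Dirichlet
-- approximation of x yields 2 ≤ k ≤ 2^2^O(d) and k x = g + f with g integral, f ≥ 0 and
-- ∑ f ≤ 1, so k copies of p can be traded for ∑ g_v v plus the single lattice point ∑ f_v v
-- of the simplex; this lowers the total multiplicity of the non-vertices.  Two points of equal
-- parity can be traded for two copies of their midpoint (Eisenbrand–Shmonin), which lowers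
-- ∑ λ_p |p|².  Parity moves first bring the support down to 2^d points.  For each of them, both
-- moves are then run inside its simplex until neither applies to a non-vertex: what remains are
-- at most d vertices and at most 2^d non-vertices of bounded multiplicity.
--
-- The vertices are obtained by discarding points that lie in the hull of the others, membership
-- in a hull being decidable by Farkas' lemma over ℤ.

open import Defs
open import Algebra.Bundles using (CommutativeSemiring)
import Algebra.Properties.Semiring.Sum
open import Data.Empty using (⊥; ⊥-elim)
open import Data.Fin using (Fin; zero; suc; toℕ; fromℕ<)
import Data.Fin as Fin
import Data.Fin.Properties as Finₚ
open import Data.Integer as ℤ using (ℤ; +_; -[1+_])
import Data.Integer.DivMod as ℤ
import Data.Integer.Properties as ℤₚ
import Data.Integer.Tactic.RingSolver as ℤ-Ring
open import Data.List using (List; []; _∷_; _++_; length; map)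
open import Data.List.Relation.Unary.All using (All; []; _∷_)
import Data.List.Relation.Unary.All.Properties as Allₚ
import Data.List as List
open import Data.List.Membership.Propositional using (_∈_)
import Data.List.Membership.Propositional.Properties as ∈ₚ
import Data.List.Properties as Listₚ
import Data.List.Relation.Unary.All as All
open import Data.List.Relation.Unary.AllPairs using ([]; _∷_)
import Data.List.Relation.Unary.Any as Any
import Data.List.Relation.Unary.Any.Properties as Anyₚ
open import Data.List.Relation.Unary.Unique.Propositional using (Unique)
import Data.List.Relation.Unary.Unique.Propositional.Properties as Uniqueₚ
import Data.List.Relation.Unary.Unique.DecPropositional.Properties as DecUniqueₚ
open import Data.Nat using (ℕ; zero; suc; _≤_; _<_; _*_; _+_; _^_; _∸_; _/_; _%_; z≤n; s≤s; s≤s⁻¹; NonZero; >-nonZero; >-nonZero⁻¹)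
import Data.Nat.DivMod as ℕ
import Data.Nat.Properties as ℕₚ
open import Data.Nat.Properties using (module ≤-Reasoning)
import Data.Nat.Tactic.RingSolver as ℕ-Ring
open import Data.Product using (Σ; _×_; _,_; proj₁; proj₂; ∃)
open import Data.Rational as ℚ using (ℚ; 0ℚ; 1ℚ)
import Data.Rational.Properties as ℚₚ
import Data.Rational.Solver as ℚ-Solver
open import Data.Rational.Unnormalised as ℚᵘ using (mkℚᵘ; *≡*; *≤*)
import Data.Rational.Unnormalised.Properties as ℚᵘₚ
open import Data.Sum using (_⊎_; inj₁; inj₂)
open import Data.Unit using (⊤; tt)
open import Data.Vec using (Vec; []; _∷_; lookup; replicate; tabulate)
import Data.Vec.Properties as Vecₚ
open import Function using (_∘_; id)
open import Level using (0ℓ)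
open import Relation.Binary.PropositionalEquality using (_≡_; _≢_; refl; sym; trans; cong; cong₂; subst; subst₂; module ≡-Reasoning)
open import Relation.Nullary using (¬_; Dec; yes; no; ¬?; _×-dec_)

-- Multiplicity functions and integer combinations

-- The obstacle is that the bound on `k` may depend on `d` alone, while the coordinates x_v can be
-- arbitrarily small and have arbitrarily large denominators. So `k` cannot be a common denominator,
-- and approximation with a fixed absolute error may make some f_v negative, which pushes the
-- remainder out of the simplex. The error must be small relative to x_v. The number of cells this
-- takes stays bounded because only coordinates that are large compared with the number of colours
-- used so far are coloured; up to `d + 1` refinements, each squaring that number up to a factor,
-- are the source of the double exponential. The origin has a role of its own. It adds nothing to
-- `b`, so it is never listed, but in every hull it absorbs the weight missing from 1. A nonzero
-- lattice point is then a vertex of P_I exactly when it is outside the hull of 0 and the other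
-- lattice points. Inside a simplex only its own corners escape the bound on multiplicities. This
-- suffices because a vertex of P_I lying in the simplex is one of its corners. Hulls are kept over
-- ℕ and ℤ with common denominators; rationals appear only in the comparison with `InConvOthers`.

δ : ∀ {n} → Fin n → Fin n → ℕ
δ zero    zero    = 1
δ zero    (suc _) = 0
δ (suc _) zero    = 0
δ (suc i) (suc j) = δ i j

δ-refl : ∀ {n} (i : Fin n) → δ i i ≡ 1
δ-refl zero    = refl
δ-refl (suc i) = δ-refl i

δ-≢ : ∀ {n} {i j : Fin n} → i ≢ j → δ i j ≡ 0
δ-≢ {i = zero}  {zero}  i≢j = ⊥-elim (i≢j refl)
δ-≢ {i = zero}  {suc j} i≢j = refl
δ-≢ {i = suc i} {zero}  i≢j = refl
δ-≢ {i = suc i} {suc j} i≢j = δ-≢ (i≢j ∘ cong suc)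

module ∑ℕ = Algebra.Properties.Semiring.Sum (CommutativeSemiring.semiring ℕₚ.+-*-commutativeSemiring)
module ∑ℤ = Algebra.Properties.Semiring.Sum (CommutativeSemiring.semiring ℤₚ.+-*-commutativeSemiring)

∑ℕ : ∀ {n} → (Fin n → ℕ) → ℕ
∑ℕ = ∑ℕ.sum

∑ℤ : ∀ {n} → (Fin n → ℤ) → ℤ
∑ℤ = ∑ℤ.sum

-- Instantiated at ℕ (weights of a multiplicity function) and at ℤ (coordinates of
-- an integer combination).
module Pairing (R : CommutativeSemiring 0ℓ 0ℓ)
  (ι : ℕ → CommutativeSemiring.Carrier R)
  (ι-0 : CommutativeSemiring._≈_ R (ι 0) (CommutativeSemiring.0# R))
  (ι-1 : CommutativeSemiring._≈_ R (ι 1) (CommutativeSemiring.1# R))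
  (ι-+ : ∀ a b → CommutativeSemiring._≈_ R (ι (a + b)) (CommutativeSemiring._+_ R (ι a) (ι b)))
  (ι-* : ∀ a b → CommutativeSemiring._≈_ R (ι (a * b)) (CommutativeSemiring._*_ R (ι a) (ι b)))
  where

  open CommutativeSemiring R using (Carrier; _≈_; 0#; 1#; semiring; reflexive; setoid;
    *-congʳ; *-congˡ; *-cong; +-cong; +-congʳ; +-congˡ; zeroˡ; *-assoc; distribʳ; +-identityˡ; +-identityʳ; *-identityˡ)
    renaming (_+_ to _⊕_; _*_ to _⊛_; refl to ≈-refl; sym to ≈-sym; trans to ≈-trans)
  open Algebra.Properties.Semiring.Sum semiring using (sum; sum-cong-≋; ∑-distrib-+; *-distribˡ-sum)

  ⟪_,_⟫ : ∀ {n} → (Fin n → ℕ) → (Fin n → Carrier) → Carrier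
  ⟪ a , y ⟫ = sum (λ i → ι (a i) ⊛ y i)

  pair-congˡ : ∀ {n} {a b : Fin n → ℕ} {y : Fin n → Carrier} → (∀ i → a i ≡ b i) → ⟪ a , y ⟫ ≈ ⟪ b , y ⟫
  pair-congˡ eq = sum-cong-≋ (λ i → *-congʳ (reflexive (cong ι (eq i))))

  pair-+ : ∀ {n} (a b : Fin n → ℕ) (y : Fin n → Carrier) →
    ⟪ (λ i → a i + b i) , y ⟫ ≈ ⟪ a , y ⟫ ⊕ ⟪ b , y ⟫
  pair-+ a b y = ≈-trans
    (sum-cong-≋ (λ i → ≈-trans (*-congʳ (ι-+ (a i) (b i))) (distribʳ (y i) (ι (a i)) (ι (b i)))))
    (∑-distrib-+ (λ i → ι (a i) ⊛ y i) (λ i → ι (b i) ⊛ y i))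

  pair-* : ∀ {n} m (a : Fin n → ℕ) (y : Fin n → Carrier) →
    ⟪ (λ i → m * a i) , y ⟫ ≈ ι m ⊛ ⟪ a , y ⟫
  pair-* m a y = ≈-trans
    (sum-cong-≋ (λ i → ≈-trans (*-congʳ (ι-* m (a i))) (*-assoc (ι m) (ι (a i)) (y i))))
    (≈-sym (*-distribˡ-sum (ι m) (λ i → ι (a i) ⊛ y i)))

  pair-0 : ∀ {n} (y : Fin n → Carrier) → ⟪ (λ _ → 0) , y ⟫ ≈ 0#
  pair-0 {zero}  y = ≈-refl
  pair-0 {suc n} y = ≈-trans
    (+-cong (≈-trans (*-congʳ ι-0) (zeroˡ (y zero))) (pair-0 (y ∘ suc))) (+-identityˡ 0#)

  pair-δ : ∀ {n} (i : Fin n) (y : Fin n → Carrier) → ⟪ δ i , y ⟫ ≈ y i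
  pair-δ zero y = ≈-trans
    (+-cong (≈-trans (*-congʳ ι-1) (*-identityˡ (y zero))) (pair-0 (y ∘ suc))) (+-identityʳ (y zero))
  pair-δ (suc i) y = ≈-trans
    (+-cong (≈-trans (*-congʳ ι-0) (zeroˡ (y zero))) (pair-δ i (y ∘ suc))) (+-identityˡ (y (suc i)))

  pair-∑ : ∀ {n m} (A : Fin m → Fin n → ℕ) (y : Fin n → Carrier) →
    sum (λ j → ⟪ A j , y ⟫) ≈ ⟪ (λ i → ∑ℕ (λ j → A j i)) , y ⟫
  pair-∑ {m = zero}  A y = ≈-sym (pair-0 y)
  pair-∑ {m = suc m} A y = ≈-trans (+-congˡ (pair-∑ (A ∘ suc) y)) (≈-sym (pair-+ (A zero) _ y))

  pair-∘ : ∀ {n m} (a : Fin m → ℕ) (A : Fin m → Fin n → ℕ) (y : Fin n → Carrier) →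
    ⟪ a , (λ j → ⟪ A j , y ⟫) ⟫ ≈ ⟪ (λ i → ∑ℕ (λ j → a j * A j i)) , y ⟫
  pair-∘ a A y = ≈-trans
    (sum-cong-≋ (λ j → ≈-sym (pair-* (a j) (A j) y))) (pair-∑ (λ j i → a j * A j i) y)

  pair-exchange : ∀ {n} (a b c e : Fin n → ℕ) (y : Fin n → Carrier) → (∀ i → a i + b i ≡ c i + e i) →
    ⟪ a , y ⟫ ⊕ ⟪ b , y ⟫ ≈ ⟪ c , y ⟫ ⊕ ⟪ e , y ⟫
  pair-exchange a b c e y eq = ≈-trans (≈-sym (pair-+ a b y)) (≈-trans (pair-congˡ eq) (pair-+ c e y))

module Wt = Pairing ℕₚ.+-*-commutativeSemiring id refl refl (λ _ _ → refl) (λ _ _ → refl)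
module Cb = Pairing ℤₚ.+-*-commutativeSemiring +_ refl refl (λ _ _ → refl) ℤₚ.pos-*
open Wt using () renaming (⟪_,_⟫ to ⟨_,_⟩)
open Cb using (⟪_,_⟫)

∑ℕ-mono : ∀ {n} {a b : Fin n → ℕ} → (∀ i → a i ≤ b i) → ∑ℕ a ≤ ∑ℕ b
∑ℕ-mono {zero}  le = z≤n
∑ℕ-mono {suc n} le = ℕₚ.+-mono-≤ (le zero) (∑ℕ-mono (le ∘ suc))

∑ℕ-const : ∀ {n} (m : ℕ) (a : Fin n → ℕ) → ∑ℕ (λ i → m * a i) ≡ m * ∑ℕ a
∑ℕ-const m a = sym (∑ℕ.*-distribˡ-sum m a)

∑ℕ-+ : ∀ {n} (a b : Fin n → ℕ) → ∑ℕ (λ i → a i + b i) ≡ ∑ℕ a + ∑ℕ b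
∑ℕ-+ = ∑ℕ.∑-distrib-+

term≤∑ℕ : ∀ {n} (a : Fin n → ℕ) i → a i ≤ ∑ℕ a
term≤∑ℕ a zero    = ℕₚ.m≤m+n _ _
term≤∑ℕ a (suc i) = ℕₚ.≤-trans (term≤∑ℕ (a ∘ suc) i) (ℕₚ.m≤n+m _ _)

wt-1 : ∀ {n} (a : Fin n → ℕ) → ⟨ a , (λ _ → 1) ⟩ ≡ ∑ℕ a
wt-1 a = ∑ℕ.sum-cong-≗ (λ i → ℕₚ.*-identityʳ (a i))

∑ℕ-δ : ∀ {n} (i : Fin n) → ∑ℕ (δ i) ≡ 1
∑ℕ-δ i = trans (sym (wt-1 (δ i))) (Wt.pair-δ i (λ _ → 1))

∑ℤ-zero : ∀ {n} {y : Fin n → ℤ} → (∀ i → y i ≡ + 0) → ∑ℤ y ≡ + 0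
∑ℤ-zero {zero}  eq = refl
∑ℤ-zero {suc n} eq = cong₂ ℤ._+_ (eq zero) (∑ℤ-zero (eq ∘ suc))

∑ℤ-mono : ∀ {n} {y z : Fin n → ℤ} → (∀ i → y i ℤ.≤ z i) → ∑ℤ y ℤ.≤ ∑ℤ z
∑ℤ-mono {zero}  le = ℤₚ.≤-refl
∑ℤ-mono {suc n} le = ℤₚ.+-mono-≤ (le zero) (∑ℤ-mono (le ∘ suc))

∑ℤ-+ : ∀ {n} (y z : Fin n → ℤ) → ∑ℤ (λ i → y i ℤ.+ z i) ≡ ∑ℤ y ℤ.+ ∑ℤ z
∑ℤ-+ = ∑ℤ.∑-distrib-+

∑ℤ-* : ∀ {n} s (y : Fin n → ℤ) → ∑ℤ (λ i → s ℤ.* y i) ≡ s ℤ.* ∑ℤ y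
∑ℤ-* s y = sym (∑ℤ.*-distribˡ-sum s y)

∑ℤ-pos : ∀ {n} (a : Fin n → ℕ) → ∑ℤ (λ i → + a i) ≡ + ∑ℕ a
∑ℤ-pos {zero}  a = refl
∑ℤ-pos {suc n} a = cong (λ z → + a zero ℤ.+ z) (∑ℤ-pos (a ∘ suc))

-- Supports and their sizes

sgn : ℕ → ℕ
sgn zero    = 0
sgn (suc _) = 1

sgn-+ : ∀ a b → sgn (a + b) ≤ sgn a + sgn b
sgn-+ zero    b = ℕₚ.≤-refl
sgn-+ (suc a) b = s≤s z≤n

sgn≤ : ∀ {a b} → (a ≢ 0 → b ≢ 0) → sgn a ≤ sgn b
sgn≤ {zero}          imp = z≤n
sgn≤ {suc a} {zero}  imp = ⊥-elim (imp (λ ()) refl)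
sgn≤ {suc a} {suc b} imp = ℕₚ.≤-refl

count : ∀ {n} → (Fin n → ℕ) → ℕ
count f = ∑ℕ (λ i → sgn (f i))

count≤ : ∀ {n} {f g : Fin n → ℕ} → (∀ i → f i ≢ 0 → g i ≢ 0) → count f ≤ count g
count≤ {f = f} {g} imp = ∑ℕ-mono (λ i → sgn≤ {f i} {g i} (imp i))

count-0 : ∀ n → count {n} (λ _ → 0) ≡ 0
count-0 zero    = refl
count-0 (suc n) = count-0 n

count-+ : ∀ {n} (f g : Fin n → ℕ) → count (λ i → f i + g i) ≤ count f + count g
count-+ f g = ℕₚ.≤-trans (∑ℕ-mono (λ i → sgn-+ (f i) (g i)))
  (ℕₚ.≤-reflexive (∑ℕ-+ (sgn ∘ f) (sgn ∘ g)))

count-∑ : ∀ {n m} (A : Fin m → Fin n → ℕ) → count (λ i → ∑ℕ (λ j → A j i)) ≤ ∑ℕ (λ j → count (A j))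
count-∑ {n} {zero}  A = ℕₚ.≤-reflexive (count-0 n)
count-∑ {n} {suc m} A = ℕₚ.≤-trans (count-+ (A zero) _) (ℕₚ.+-monoʳ-≤ _ (count-∑ (A ∘ suc)))

count-pos : ∀ {n} (f : Fin n → ℕ) → 0 < count f → ∃ λ i → f i ≢ 0
count-pos {suc n} f lt with f zero in eq
... | suc _ = zero , λ e → ℕₚ.1+n≢0 (trans (sym eq) e)
... | zero  with count-pos (f ∘ suc) lt
...   | i , ne = suc i , ne

count-two : ∀ {n} (f : Fin n → ℕ) → 1 < count f → ∃ λ i → ∃ λ j → i ≢ j × f i ≢ 0 × f j ≢ 0
count-two {suc n} f lt with f zero in eq
... | zero with count-two (f ∘ suc) lt
...   | i , j , ne , fi , fj = suc i , suc j , ne ∘ Finₚ.suc-injective , fi , fj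
count-two {suc n} f lt | suc _ with count-pos (f ∘ suc) (s≤s⁻¹ lt)
...   | j , fj = zero , suc j , (λ ()) , (λ e → ℕₚ.1+n≢0 (trans (sym eq) e)) , fj

infixl 8 _∖_
_∖_ : ∀ {n} → (Fin n → ℕ) → Fin n → Fin n → ℕ
(f ∖ zero)  zero    = 0
(f ∖ zero)  (suc j) = f (suc j)
(f ∖ suc i) zero    = f zero
(f ∖ suc i) (suc j) = ((f ∘ suc) ∖ i) j

∖-refl : ∀ {n} (f : Fin n → ℕ) i → (f ∖ i) i ≡ 0
∖-refl f zero    = refl
∖-refl f (suc i) = ∖-refl (f ∘ suc) i

∖-≢ : ∀ {n} (f : Fin n → ℕ) {i j} → i ≢ j → (f ∖ i) j ≡ f j
∖-≢ f {zero}  {zero}  ne = ⊥-elim (ne refl)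
∖-≢ f {zero}  {suc j} ne = refl
∖-≢ f {suc i} {zero}  ne = refl
∖-≢ f {suc i} {suc j} ne = ∖-≢ (f ∘ suc) (ne ∘ cong suc)

∖-δ : ∀ {n} (f : Fin n → ℕ) i j → f j ≡ (f ∖ i) j + f i * δ i j
∖-δ f zero    zero    = sym (ℕₚ.*-identityʳ (f zero))
∖-δ f zero    (suc j) = sym (trans (cong (_+_ (f (suc j))) (ℕₚ.*-zeroʳ (f zero))) (ℕₚ.+-identityʳ _))
∖-δ f (suc i) zero    = sym (trans (cong (_+_ (f zero)) (ℕₚ.*-zeroʳ (f (suc i)))) (ℕₚ.+-identityʳ _))
∖-δ f (suc i) (suc j) = ∖-δ (f ∘ suc) i j

∖-∑ : ∀ {n} (f : Fin n → ℕ) i → ∑ℕ f ≡ ∑ℕ (f ∖ i) + f i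
∖-∑ f zero    = ℕₚ.+-comm (f zero) _
∖-∑ f (suc i) = trans (cong (_+_ (f zero)) (∖-∑ (f ∘ suc) i)) (sym (ℕₚ.+-assoc (f zero) _ _))

∖-count : ∀ {n} (f : Fin n → ℕ) i → count f ≡ count (f ∖ i) + sgn (f i)
∖-count f zero    = ℕₚ.+-comm (sgn (f zero)) _
∖-count f (suc i) = trans (cong (_+_ (sgn (f zero))) (∖-count (f ∘ suc) i)) (sym (ℕₚ.+-assoc (sgn (f zero)) _ _))

∖-count-suc : ∀ {n} (f : Fin n → ℕ) i → f i ≢ 0 → count f ≡ suc (count (f ∖ i))
∖-count-suc f i ne with f i | ∖-count f i
... | zero  | _  = ⊥-elim (ne refl)
... | suc _ | eq = trans eq (ℕₚ.+-comm _ 1)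

∖-supp : ∀ {n} (f : Fin n → ℕ) {i j} → (f ∖ i) j ≢ 0 → f j ≢ 0 × i ≢ j
∖-supp f {i} {j} ne with i Fin.≟ j
... | yes refl = ⊥-elim (ne (∖-refl f i))
... | no  i≢j  = (λ e → ne (trans (∖-≢ f i≢j) e)) , i≢j

∖-pairℤ : ∀ {n} (f : Fin n → ℕ) i (y : Fin n → ℤ) → ⟪ f , y ⟫ ≡ ⟪ f ∖ i , y ⟫ ℤ.+ + f i ℤ.* y i
∖-pairℤ f i y = begin
  ⟪ f , y ⟫                                             ≡⟨ Cb.pair-congˡ (∖-δ f i) ⟩
  ⟪ (λ j → (f ∖ i) j + f i * δ i j) , y ⟫               ≡⟨ Cb.pair-+ (f ∖ i) _ y ⟩
  ⟪ f ∖ i , y ⟫ ℤ.+ ⟪ (λ j → f i * δ i j) , y ⟫         ≡⟨ cong (λ z → ⟪ f ∖ i , y ⟫ ℤ.+ z) (Cb.pair-* (f i) (δ i) y) ⟩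
  ⟪ f ∖ i , y ⟫ ℤ.+ + f i ℤ.* ⟪ δ i , y ⟫               ≡⟨ cong (λ z → ⟪ f ∖ i , y ⟫ ℤ.+ + f i ℤ.* z) (Cb.pair-δ i y) ⟩
  ⟪ f ∖ i , y ⟫ ℤ.+ + f i ℤ.* y i                       ∎
  where open ≡-Reasoning

-- Subsets are encoded by the support of a function into ℕ, so that a coefficient vector doubles as
-- the set of points it uses. The first argument is such a marker, the second a multiplicity to keep
-- or drop.
sel unsel : ℕ → ℕ → ℕ
sel zero    x = 0
sel (suc _) x = x
unsel zero    x = x
unsel (suc _) x = 0

sel+unsel : ∀ m x → sel m x + unsel m x ≡ x
sel+unsel zero    x = refl
sel+unsel (suc m) x = ℕₚ.+-identityʳ x

sel-supp : ∀ m {x} → sel m x ≢ 0 → m ≢ 0 × x ≢ 0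
sel-supp zero    ne = ⊥-elim (ne refl)
sel-supp (suc m) ne = (λ ()) , ne

unsel-supp : ∀ m {x} → unsel m x ≢ 0 → m ≡ 0 × x ≢ 0
unsel-supp zero    ne = refl , ne
unsel-supp (suc m) ne = ⊥-elim (ne refl)

unsel-≤ : ∀ m x → unsel m x ≤ x
unsel-≤ zero    x = ℕₚ.≤-refl
unsel-≤ (suc m) x = z≤n

unsel-antitone : ∀ {m m′} x → (m ≡ 0 → m′ ≡ 0) → unsel m x ≤ unsel m′ x
unsel-antitone {zero}  {m′} x imp rewrite imp refl = ℕₚ.≤-refl
unsel-antitone {suc m}      x imp = z≤n

*-swapℤ : ∀ x y z → x ℤ.* (y ℤ.* z) ≡ y ℤ.* (x ℤ.* z)
*-swapℤ = ℤ-Ring.solve-∀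

ℤ-+-cancelʳ : ∀ x {i j} → i ℤ.+ x ≡ j ℤ.+ x → i ≡ j
ℤ-+-cancelʳ x {i} {j} e = trans (sym (drop i x)) (trans (cong (ℤ._- x) e) (drop j x))
  where
  drop : ∀ i x → i ℤ.+ x ℤ.- x ≡ i
  drop = ℤ-Ring.solve-∀

-- Farkas' lemma

sq-nonneg : ∀ z → z ℤ.* z ≡ + (ℤ.∣ z ∣ * ℤ.∣ z ∣)
sq-nonneg (+ a)     = sym (ℤₚ.pos-* a a)
sq-nonneg -[1+ a ]  = refl

infix 7 _∙_
_∙_ : ∀ {d} → (Fin d → ℤ) → (Fin d → ℤ) → ℤ
y ∙ u = ∑ℤ (λ k → y k ℤ.* u k)

∙-comm : ∀ {d} (y u : Fin d → ℤ) → y ∙ u ≡ u ∙ y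
∙-comm y u = ∑ℤ.sum-cong-≗ (λ k → ℤₚ.*-comm (y k) (u k))

∙-linear : ∀ {d} (y u w : Fin d → ℤ) s t →
  y ∙ (λ k → s ℤ.* u k ℤ.+ t ℤ.* w k) ≡ s ℤ.* (y ∙ u) ℤ.+ t ℤ.* (y ∙ w)
∙-linear y u w s t = begin
  y ∙ (λ k → s ℤ.* u k ℤ.+ t ℤ.* w k)
    ≡⟨ ∑ℤ.sum-cong-≗ (λ k → expand (y k) s (u k) t (w k)) ⟩
  ∑ℤ (λ k → s ℤ.* (y k ℤ.* u k) ℤ.+ t ℤ.* (y k ℤ.* w k))
    ≡⟨ ∑ℤ-+ (λ k → s ℤ.* (y k ℤ.* u k)) (λ k → t ℤ.* (y k ℤ.* w k)) ⟩
  ∑ℤ (λ k → s ℤ.* (y k ℤ.* u k)) ℤ.+ ∑ℤ (λ k → t ℤ.* (y k ℤ.* w k))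
    ≡⟨ cong₂ ℤ._+_ (∑ℤ-* s (λ k → y k ℤ.* u k)) (∑ℤ-* t (λ k → y k ℤ.* w k)) ⟩
  s ℤ.* (y ∙ u) ℤ.+ t ℤ.* (y ∙ w) ∎
  where
  open ≡-Reasoning
  expand : ∀ y s u t w → y ℤ.* (s ℤ.* u ℤ.+ t ℤ.* w) ≡ s ℤ.* (y ℤ.* u) ℤ.+ t ℤ.* (y ℤ.* w)
  expand = ℤ-Ring.solve-∀

∙-linearˡ : ∀ {d} (u w y : Fin d → ℤ) s t →
  (λ k → s ℤ.* u k ℤ.+ t ℤ.* w k) ∙ y ≡ s ℤ.* (u ∙ y) ℤ.+ t ℤ.* (w ∙ y)
∙-linearˡ u w y s t = trans (∙-comm _ y) (trans (∙-linear y u w s t)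
  (cong₂ (λ p q → s ℤ.* p ℤ.+ t ℤ.* q) (∙-comm y u) (∙-comm y w)))

∙-self-pos : ∀ {d} (v : Fin d → ℤ) k → v k ≢ + 0 → + 0 ℤ.< v ∙ v
∙-self-pos v k ne = subst (+ 0 ℤ.<_) (sym (trans (∑ℤ.sum-cong-≗ (λ k → sq-nonneg (v k))) (∑ℤ-pos (λ k → ℤ.∣ v k ∣ * ℤ.∣ v k ∣))))
  (ℤ.+<+ (ℕₚ.<-≤-trans (ℕₚ.*-mono-< pos pos) (term≤∑ℕ (λ k → ℤ.∣ v k ∣ * ℤ.∣ v k ∣) k)))
  where
  pos : 0 < ℤ.∣ v k ∣
  pos = ℕₚ.n≢0⇒n>0 (ne ∘ ℤₚ.∣i∣≡0⇒i≡0)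

pair-linear : ∀ {n} (a : Fin n → ℕ) (y z : Fin n → ℤ) s t →
  ⟪ a , (λ i → s ℤ.* y i ℤ.+ z i ℤ.* t) ⟫ ≡ s ℤ.* ⟪ a , y ⟫ ℤ.+ ⟪ a , z ⟫ ℤ.* t
pair-linear a y z s t = trans (∑ℤ.sum-cong-≗ (λ i → cong (ℤ._*_ (+ a i)) (cong (ℤ._+_ (s ℤ.* y i)) (ℤₚ.*-comm (z i) t))))
  (trans (∙-linear (+_ ∘ a) y z s t) (cong (ℤ._+_ (s ℤ.* ⟪ a , y ⟫)) (ℤₚ.*-comm t ⟪ a , z ⟫)))

pair-nonpos : ∀ {n} (a : Fin n → ℕ) (y : Fin n → ℤ) → (∀ i → y i ℤ.≤ + 0) → ⟪ a , y ⟫ ℤ.≤ + 0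
pair-nonpos {n} a y le = ℤₚ.≤-trans
  (∑ℤ-mono (λ i → subst (+ a i ℤ.* y i ℤ.≤_) (ℤₚ.*-zeroʳ (+ a i)) (ℤₚ.*-monoˡ-≤-nonNeg (+ a i) (le i))))
  (ℤₚ.≤-reflexive (∑ℤ-zero {n} {λ _ → + 0} (λ _ → refl)))

∙-pair : ∀ {n d} (a : Fin n → ℕ) (U : Fin n → Fin d → ℤ) (y : Fin d → ℤ) →
  y ∙ (λ k → ⟪ a , (λ i → U i k) ⟫) ≡ ⟪ a , (λ i → y ∙ U i) ⟫
∙-pair a U y = begin
  y ∙ (λ k → ⟪ a , (λ i → U i k) ⟫)
    ≡⟨ ∑ℤ.sum-cong-≗ (λ k → sym (∑ℤ-* (y k) (λ i → + a i ℤ.* U i k))) ⟩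
  ∑ℤ (λ k → ∑ℤ (λ i → y k ℤ.* (+ a i ℤ.* U i k)))
    ≡⟨ ∑ℤ.∑-comm (λ k i → y k ℤ.* (+ a i ℤ.* U i k)) ⟩
  ∑ℤ (λ i → ∑ℤ (λ k → y k ℤ.* (+ a i ℤ.* U i k)))
    ≡⟨ ∑ℤ.sum-cong-≗ (λ i → trans (∑ℤ.sum-cong-≗ (λ k → *-swapℤ (y k) (+ a i) (U i k))) (∑ℤ-* (+ a i) (λ k → y k ℤ.* U i k))) ⟩
  ⟪ a , (λ i → y ∙ U i) ⟫ ∎
  where
  open ≡-Reasoning

-- Membership in the rational cone: the factor `N` clears the denominators of the coefficients.
Cone : ∀ {n d} → (Fin n → Fin d → ℤ) → (Fin d → ℤ) → Set
Cone {n} U v = Σ ℕ λ N → 0 < N × Σ (Fin n → ℕ) λ a → ∀ k → + N ℤ.* v k ≡ ⟪ a , (λ i → U i k) ⟫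

Separated : ∀ {n d} → (Fin n → Fin d → ℤ) → (Fin d → ℤ) → Set
Separated {d = d} U v = Σ (Fin d → ℤ) λ y → (∀ i → y ∙ U i ℤ.≤ + 0) × + 0 ℤ.< y ∙ v

separated⇒¬cone : ∀ {n d} (U : Fin n → Fin d → ℤ) v → Separated U v → ¬ Cone U v
separated⇒¬cone U v (y , yU , yv) (N , pos , a , eq) =
  ℤₚ.<⇒≱ Nyv-pos (subst (ℤ._≤ + 0) (sym Nyv) (pair-nonpos a (λ i → y ∙ U i) yU))
  where
  Nyv : + N ℤ.* (y ∙ v) ≡ ⟪ a , (λ i → y ∙ U i) ⟫
  Nyv = begin
    + N ℤ.* (y ∙ v)                        ≡⟨ ∑ℤ-* (+ N) (λ k → y k ℤ.* v k) ⟨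
    ∑ℤ (λ k → + N ℤ.* (y k ℤ.* v k))       ≡⟨ ∑ℤ.sum-cong-≗ (λ k → trans (*-swapℤ (+ N) (y k) (v k)) (cong (ℤ._*_ (y k)) (eq k))) ⟩
    y ∙ (λ k → ⟪ a , (λ i → U i k) ⟫)      ≡⟨ ∙-pair a U y ⟩
    ⟪ a , (λ i → y ∙ U i) ⟫                ∎
    where
    open ≡-Reasoning
  Nyv-pos : + 0 ℤ.< + N ℤ.* (y ∙ v)
  Nyv-pos = subst (ℤ._< + N ℤ.* (y ∙ v)) (ℤₚ.*-zeroʳ (+ N))
    (ℤₚ.*-monoˡ-<-pos (+ N) {{ℤ.positive (ℤ.+<+ pos)}} yv)

infixr 5 _▹_
_▹_ : ∀ {a} {A : Set a} {n} → A → (Fin n → A) → Fin (suc n) → A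
(x ▹ f) zero    = x
(x ▹ f) (suc i) = f i

-- Induction on the number of generators.  When y separates v from all generators but
-- u = U zero and y ∙ u > 0, everything is projected along u onto the kernel of y.
farkas : ∀ {n d} (U : Fin n → Fin d → ℤ) v → Cone U v ⊎ Separated U v
-- The empty cone is {0}, and a nonzero `v` separates itself from it.
farkas {zero} U v with Finₚ.any? (λ k → ¬? (v k ℤ.≟ + 0))
... | yes (k , ne) = inj₂ (v , (λ ()) , ∙-self-pos v k ne)
... | no  none     = inj₁ (1 , s≤s z≤n , (λ ()) , λ k → cong (ℤ._*_ (+ 1)) (zeros k))
  where
  zeros : ∀ k → v k ≡ + 0
  zeros k with v k ℤ.≟ + 0
  ... | yes e = e
  ... | no ne = ⊥-elim (none (k , ne))
farkas {suc n} U v with farkas (U ∘ suc) v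
... | inj₁ (N , pos , a , eq) = inj₁ (N , pos , (0 ▹ a) ,
        λ k → trans (eq k) (sym (trans (cong (ℤ._+ ⟪ a , (λ i → U (suc i) k) ⟫) (ℤₚ.*-zeroˡ (U zero k))) (ℤₚ.+-identityˡ _))))
... | inj₂ (y , yU , yv) with y ∙ U zero ℤ.≤? + 0
...   | yes yu = inj₂ (y , (λ { zero → yu ; (suc i) → yU i }) , yv)
...   | no ¬yu = step (farkas U″ v″)
  where
  u : Fin _ → ℤ
  u = U zero
  s : ℤ
  s = y ∙ u
  s>0 : + 0 ℤ.< s
  s>0 = ℤₚ.≰⇒> ¬yu
  s≡ : + ℤ.∣ s ∣ ≡ s
  s≡ = ℤₚ.0≤i⇒+∣i∣≡i (ℤₚ.<⇒≤ s>0)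
  S>0 : 0 < ℤ.∣ s ∣
  S>0 = ℤₚ.drop‿+<+ (subst (+ 0 ℤ.<_) (sym s≡) s>0)
  -- Scaled by `s` to stay integral; `u` itself is sent to 0.
  project : (Fin _ → ℤ) → Fin _ → ℤ
  project x k = s ℤ.* x k ℤ.+ ℤ.- (y ∙ x) ℤ.* u k
  U″ = λ i → project (U (suc i))
  v″ = project v
  step : Cone U″ v″ ⊎ Separated U″ v″ → Cone U v ⊎ Separated U v
  step (inj₁ (N , pos , a , eq)) =
    inj₁ (N * ℤ.∣ s ∣ , ℕₚ.*-mono-< pos S>0 , (ℤ.∣ h ∣ ▹ (λ i → ℤ.∣ s ∣ * a i)) , eq′)
    where
    Q : ℤ
    Q = ⟪ a , (λ i → y ∙ U (suc i)) ⟫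
    Q′ : ℤ
    Q′ = ⟪ a , (λ i → ℤ.- (y ∙ U (suc i))) ⟫
    Q′≡ : Q′ ≡ ℤ.- Q
    Q′≡ = trans (∑ℤ.sum-cong-≗ (λ i → neg (+ a i) (y ∙ U (suc i)))) (trans (∑ℤ-* (ℤ.- + 1) (λ i → + a i ℤ.* (y ∙ U (suc i)))) (ℤₚ.-1*i≡-i Q))
      where
      neg : ∀ x y → x ℤ.* ℤ.- y ≡ ℤ.- + 1 ℤ.* (x ℤ.* y)
      neg = ℤ-Ring.solve-∀
    -- The coefficient of `u` once the projection is undone. It is nonnegative because `y` is
    -- positive on `v` and nonpositive on the remaining generators.
    h : ℤ
    h = + N ℤ.* (y ∙ v) ℤ.+ Q′
    h≡ : + ℤ.∣ h ∣ ≡ h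
    h≡ = ℤₚ.0≤i⇒+∣i∣≡i (ℤₚ.+-mono-≤ {+ 0} {_} {+ 0}
      (subst (ℤ._≤ + N ℤ.* (y ∙ v)) (ℤₚ.*-zeroʳ (+ N)) (ℤₚ.*-monoˡ-≤-nonNeg (+ N) (ℤₚ.<⇒≤ yv)))
      (subst (+ 0 ℤ.≤_) (sym Q′≡) (ℤₚ.neg-mono-≤ (pair-nonpos a _ yU))))
    eq′ : ∀ k → + (N * ℤ.∣ s ∣) ℤ.* v k ≡ + ℤ.∣ h ∣ ℤ.* u k ℤ.+ ⟪ (λ i → ℤ.∣ s ∣ * a i) , (λ i → U (suc i) k) ⟫
    eq′ k = begin
      + (N * ℤ.∣ s ∣) ℤ.* v k
        ≡⟨ cong (ℤ._* v k) (trans (ℤₚ.pos-* N ℤ.∣ s ∣) (cong (ℤ._*_ (+ N)) s≡)) ⟩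
      + N ℤ.* s ℤ.* v k
        ≡⟨ rearrange (+ N) s (v k) (y ∙ v) (u k) ⟩
      + N ℤ.* v″ k ℤ.+ + N ℤ.* (y ∙ v) ℤ.* u k
        ≡⟨ cong (ℤ._+ + N ℤ.* (y ∙ v) ℤ.* u k) (trans (eq k) (pair-linear a (λ i → U (suc i) k) (λ i → ℤ.- (y ∙ U (suc i))) s (u k))) ⟩
      s ℤ.* P ℤ.+ Q′ ℤ.* u k ℤ.+ + N ℤ.* (y ∙ v) ℤ.* u k
        ≡⟨ collect (s ℤ.* P) Q′ (u k) (+ N ℤ.* (y ∙ v)) ⟩
      h ℤ.* u k ℤ.+ s ℤ.* P
        ≡⟨ cong₂ (λ p q → p ℤ.* u k ℤ.+ q ℤ.* P) h≡ s≡ ⟨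
      + ℤ.∣ h ∣ ℤ.* u k ℤ.+ + ℤ.∣ s ∣ ℤ.* P
        ≡⟨ cong (ℤ._+_ (+ ℤ.∣ h ∣ ℤ.* u k)) (Cb.pair-* ℤ.∣ s ∣ a _) ⟨
      + ℤ.∣ h ∣ ℤ.* u k ℤ.+ ⟪ (λ i → ℤ.∣ s ∣ * a i) , (λ i → U (suc i) k) ⟫ ∎
      where
      open ≡-Reasoning
      P : ℤ
      P = ⟪ a , (λ i → U (suc i) k) ⟫
      rearrange : ∀ N s v w u → N ℤ.* s ℤ.* v ≡ N ℤ.* (s ℤ.* v ℤ.+ ℤ.- w ℤ.* u) ℤ.+ N ℤ.* w ℤ.* u
      rearrange = ℤ-Ring.solve-∀
      collect : ∀ p q u w → p ℤ.+ q ℤ.* u ℤ.+ w ℤ.* u ≡ (w ℤ.+ q) ℤ.* u ℤ.+ p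
      collect = ℤ-Ring.solve-∀
  step (inj₂ (z , zU , zv)) = inj₂ (b , bU , subst (+ 0 ℤ.<_) (sym (b∙ v)) zv)
    where
    -- The image of `z` under the adjoint of `project`: it takes on `x` the value of `z` on
    -- `project x`, and so vanishes on `u`.
    b : Fin _ → ℤ
    b k = s ℤ.* z k ℤ.+ ℤ.- (z ∙ u) ℤ.* y k
    b∙ : ∀ x → b ∙ x ≡ z ∙ project x
    b∙ x = trans (∙-linearˡ z y x s (ℤ.- (z ∙ u)))
      (trans (swap s (z ∙ x) (z ∙ u) (y ∙ x)) (sym (∙-linear z x u s (ℤ.- (y ∙ x)))))
      where
      swap : ∀ s p q r → s ℤ.* p ℤ.+ ℤ.- q ℤ.* r ≡ s ℤ.* p ℤ.+ ℤ.- r ℤ.* q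
      swap = ℤ-Ring.solve-∀
    bU : ∀ i → b ∙ U i ℤ.≤ + 0
    bU zero = ℤₚ.≤-reflexive (trans (∙-linearˡ z y u s (ℤ.- (z ∙ u))) (cancel s (z ∙ u)))
      where
      cancel : ∀ s q → s ℤ.* q ℤ.+ ℤ.- q ℤ.* s ≡ + 0
      cancel = ℤ-Ring.solve-∀
    bU (suc i) = subst (ℤ._≤ + 0) (sym (b∙ (U (suc i)))) (zU i)

cone? : ∀ {n d} (U : Fin n → Fin d → ℤ) v → Dec (Cone U v)
cone? U v with farkas U v
... | inj₁ c = yes c
... | inj₂ s = no (separated⇒¬cone U v s)

-- Carathéodory's theorem

-- Fraction-free Gaussian elimination among the points marked by `w`. A pivot `p` clears the first
-- coordinate of the others by cross-multiplication, at the price of one point and one dimension. In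
-- dimension 0 a single marked point is already dependent.
dependent : ∀ {n} d (X : Fin n → Fin d → ℤ) (w : Fin n → ℕ) → d < count w →
  Σ (Fin n → ℤ) λ c → (∃ λ i → c i ≢ + 0) × (∀ i → w i ≡ 0 → c i ≡ + 0) × (∀ k → c ∙ (λ i → X i k) ≡ + 0)
dependent zero X w lt with count-pos w lt
... | i , wi = (λ j → + δ i j) , (i , λ e → ℕₚ.1+n≢0 (trans (sym (δ-refl i)) (ℤₚ.+-injective e))) ,
  (λ j wj → cong +_ (δ-≢ {i = i} {j} λ { refl → wi wj })) , (λ ())
dependent {n} (suc d) X w lt
  with Finₚ.any? (λ i → ¬? (w i ℕₚ.≟ 0) ×-dec ¬? (X i zero ℤ.≟ + 0))
... | no none with dependent d (λ i k → X i (suc k)) w (ℕₚ.<-trans (ℕₚ.n<1+n d) lt)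
...   | c , nz , supp , dep = c , nz , supp , λ { zero → ∑ℤ-zero first ; (suc k) → dep k }
  where
  first : ∀ i → c i ℤ.* X i zero ≡ + 0
  first i with w i ℕₚ.≟ 0 | X i zero ℤ.≟ + 0
  ... | yes e | _     = cong (ℤ._* X i zero) (supp i e)
  ... | no _  | yes e = trans (cong (ℤ._*_ (c i)) e) (ℤₚ.*-zeroʳ (c i))
  ... | no ne | no ne′ = ⊥-elim (none (i , ne , ne′))
dependent {n} (suc d) X w lt | yes (p , wp , xp)
  with dependent d (λ i k → X p zero ℤ.* X i (suc k) ℤ.+ ℤ.- X p (suc k) ℤ.* X i zero) (w ∖ p)
    (s≤s⁻¹ (subst (suc d <_) (∖-count-suc w p wp) lt))
... | c′ , (q , cq) , supp′ , dep′ = c , (q , cq′) , supp , dep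
  where
  s t : ℤ
  s = X p zero
  -- The coefficient of the pivot that cancels the first coordinate; by the form of the eliminated
  -- columns it cancels every other coordinate too.
  t = ℤ.- (c′ ∙ (λ i → X i zero))
  c : Fin n → ℤ
  c i = s ℤ.* c′ i ℤ.+ t ℤ.* + δ p i
  away : ∀ {i} → p ≢ i → c i ≡ s ℤ.* c′ i
  away {i} ne = trans (cong (λ z → s ℤ.* c′ i ℤ.+ t ℤ.* + z) (δ-≢ ne))
    (trans (cong (ℤ._+_ (s ℤ.* c′ i)) (ℤₚ.*-zeroʳ t)) (ℤₚ.+-identityʳ _))
  q≢p : p ≢ q
  q≢p refl = cq (supp′ p (∖-refl w p))
  cq′ : c q ≢ + 0
  cq′ e with ℤₚ.i*j≡0⇒i≡0∨j≡0 s (trans (sym (away q≢p)) e)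
  ... | inj₁ s0 = xp s0
  ... | inj₂ c0 = cq c0
  supp : ∀ i → w i ≡ 0 → c i ≡ + 0
  supp i wi = trans (away p≢i) (trans (cong (ℤ._*_ s) (supp′ i (trans (∖-≢ w p≢i) wi))) (ℤₚ.*-zeroʳ s))
    where
    p≢i : p ≢ i
    p≢i refl = wp wi
  split : ∀ k → c ∙ (λ i → X i k) ≡ s ℤ.* (c′ ∙ (λ i → X i k)) ℤ.+ t ℤ.* X p k
  split k = trans (∙-linearˡ c′ (+_ ∘ δ p) (λ i → X i k) s t)
    (cong (λ z → s ℤ.* (c′ ∙ (λ i → X i k)) ℤ.+ t ℤ.* z) (Cb.pair-δ p (λ i → X i k)))
  dep : ∀ k → c ∙ (λ i → X i k) ≡ + 0
  dep zero = trans (split zero) (cancel s (c′ ∙ (λ i → X i zero)))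
    where
    cancel : ∀ s q → s ℤ.* q ℤ.+ ℤ.- q ℤ.* s ≡ + 0
    cancel = ℤ-Ring.solve-∀
  dep (suc k) = trans (split (suc k)) (trans (swap s _ (c′ ∙ (λ i → X i zero)) (X p (suc k)))
    (trans (sym (∙-linear c′ (λ i → X i (suc k)) (λ i → X i zero) s (ℤ.- X p (suc k)))) (dep′ k)))
    where
    swap : ∀ s p q r → s ℤ.* p ℤ.+ ℤ.- q ℤ.* r ≡ s ℤ.* p ℤ.+ ℤ.- r ℤ.* q
    swap = ℤ-Ring.solve-∀

-- The ratio test of the simplex method: among the positive `c i` it minimises `a i / c i`, compared
-- by cross-multiplication.
min-ratio : ∀ {n} (a : Fin n → ℕ) (c : Fin n → ℤ) → (∃ λ i → + 0 ℤ.< c i) →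
  ∃ λ i → + 0 ℤ.< c i × (∀ j → + 0 ℤ.< c j → + a i ℤ.* c j ℤ.≤ + a j ℤ.* c i)
min-ratio {suc n} a c ex with Finₚ.any? (λ i → + 0 ℤ.<? c (suc i))
min-ratio {suc n} a c (suc i , ci) | no none = ⊥-elim (none (i , ci))
min-ratio {suc n} a c (zero , c0)  | no none =
  zero , c0 , λ { zero _ → ℤₚ.≤-refl ; (suc j) cj → ⊥-elim (none (j , cj)) }
... | yes ex′ with min-ratio (a ∘ suc) (c ∘ suc) ex′ | + 0 ℤ.<? c zero
...   | i , ci , best | no ¬c0 =
  suc i , ci , λ { zero c0 → ⊥-elim (¬c0 c0) ; (suc j) → best j }
...   | i , ci , best | yes c0 with + a (suc i) ℤ.* c zero ℤ.≤? + a zero ℤ.* c (suc i)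
...     | yes le = suc i , ci , λ { zero _ → le ; (suc j) → best j }
...     | no ¬le = zero , c0 , λ { zero _ → ℤₚ.≤-refl ; (suc j) cj → through j cj }
  where
  through : ∀ j → + 0 ℤ.< c (suc j) → + a zero ℤ.* c (suc j) ℤ.≤ + a (suc j) ℤ.* c zero
  through j cj = ℤₚ.*-cancelʳ-≤-pos _ _ (c (suc i)) {{ℤ.positive ci}} (begin
    + a zero ℤ.* c (suc j) ℤ.* c (suc i)    ≡⟨ swap (+ a zero) (c (suc j)) (c (suc i)) ⟩
    + a zero ℤ.* c (suc i) ℤ.* c (suc j)    ≤⟨ ℤₚ.*-monoʳ-≤-nonNeg (c (suc j)) {{ℤ.nonNegative (ℤₚ.<⇒≤ cj)}} (ℤₚ.<⇒≤ (ℤₚ.≰⇒> ¬le)) ⟩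
    + a (suc i) ℤ.* c zero ℤ.* c (suc j)    ≡⟨ swap (+ a (suc i)) (c zero) (c (suc j)) ⟩
    + a (suc i) ℤ.* c (suc j) ℤ.* c zero    ≤⟨ ℤₚ.*-monoʳ-≤-nonNeg (c zero) {{ℤ.nonNegative (ℤₚ.<⇒≤ c0)}} (best j cj) ⟩
    + a (suc j) ℤ.* c (suc i) ℤ.* c zero    ≡⟨ swap (+ a (suc j)) (c (suc i)) (c zero) ⟩
    + a (suc j) ℤ.* c zero ℤ.* c (suc i)    ∎)
    where
    open ℤₚ.≤-Reasoning
    swap : ∀ x y z → x ℤ.* y ℤ.* z ≡ x ℤ.* z ℤ.* y
    swap = ℤ-Ring.solve-∀

-- v lies in the convex hull of 0 and the X i with S i ≢ 0, over the common denominator N;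
-- the weight of 0 is N ∸ ∑ coef.
record Hull {n d} (X : Fin n → Fin d → ℤ) (S : Fin n → ℕ) (v : Fin d → ℤ) : Set where
  field
    N     : ℕ
    N>0   : 0 < N
    coef  : Fin n → ℕ
    supp  : ∀ i → coef i ≢ 0 → S i ≢ 0
    total : ∑ℕ coef ≤ N
    comb  : ∀ k → + N ℤ.* v k ≡ ⟪ coef , (λ i → X i k) ⟫

-- Moves along a linear relation c until the first coefficient vanishes; ∑ c ≥ 0 keeps
-- the total from growing.
shrink : ∀ {n d} {X : Fin n → Fin d → ℤ} {S v} (h : Hull X S v) (c : Fin n → ℤ) → (∃ λ i → c i ≢ + 0) →
  (∀ i → Hull.coef h i ≡ 0 → c i ≡ + 0) → (∀ k → c ∙ (λ i → X i k) ≡ + 0) → + 0 ℤ.≤ ∑ℤ c →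
  Σ (Hull X S v) λ h′ → count (Hull.coef h′) < count (Hull.coef h)
shrink {n} {d} {X} {S} {v} h c (q , cq) supp-c dep ∑c≥0 with Finₚ.any? (λ i → + 0 ℤ.<? c i)
-- Without a positive entry, a nonnegative sum forces `c` to vanish, contrary to `cq`.
... | no none = ⊥-elim (cq (ℤₚ.≤-antisym (c≤0 q) (c≥0 q)))
  where
  c≤0 : ∀ i → c i ℤ.≤ + 0
  c≤0 i = ℤₚ.≮⇒≥ (λ lt → none (i , lt))
  -c≡ : ∀ i → + ℤ.∣ ℤ.- c i ∣ ≡ ℤ.- c i
  -c≡ i = ℤₚ.0≤i⇒+∣i∣≡i (ℤₚ.neg-mono-≤ (c≤0 i))
  -∑c : ℤ.- ∑ℤ c ≡ + ∑ℕ (λ i → ℤ.∣ ℤ.- c i ∣)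
  -∑c = trans (sym (ℤₚ.-1*i≡-i (∑ℤ c))) (trans (sym (∑ℤ-* (ℤ.- + 1) c))
    (trans (∑ℤ.sum-cong-≗ (λ i → trans (ℤₚ.-1*i≡-i (c i)) (sym (-c≡ i)))) (∑ℤ-pos (λ i → ℤ.∣ ℤ.- c i ∣))))
  c≥0 : ∀ i → + 0 ℤ.≤ c i
  c≥0 i = subst (+ 0 ℤ.≤_) (ℤₚ.neg-involutive (c i)) (ℤₚ.neg-mono-≤ {ℤ.- c i} (begin
    ℤ.- c i                          ≡⟨ -c≡ i ⟨
    + ℤ.∣ ℤ.- c i ∣                  ≤⟨ ℤ.+≤+ (term≤∑ℕ (λ i → ℤ.∣ ℤ.- c i ∣) i) ⟩
    + ∑ℕ (λ i → ℤ.∣ ℤ.- c i ∣)       ≡⟨ -∑c ⟨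
    ℤ.- ∑ℤ c                         ≤⟨ ℤₚ.neg-mono-≤ ∑c≥0 ⟩
    + 0                              ∎))
    where open ℤₚ.≤-Reasoning
... | yes ex with min-ratio (Hull.coef h) c ex
...   | m , cm , best = record
  { N = N * ℤ.∣ c m ∣
  ; N>0 = ℕₚ.*-mono-< N>0 Cm>0
  ; coef = a′
  ; supp = λ i ne → supp i (supp-a′ i ne)
  ; total = ℤₚ.drop‿+≤+ total′
  ; comb = comb′
  } , fewer
  where
  open Hull h renaming (coef to a)
  cm≡ : + ℤ.∣ c m ∣ ≡ c m
  cm≡ = ℤₚ.0≤i⇒+∣i∣≡i (ℤₚ.<⇒≤ cm)
  Cm>0 : 0 < ℤ.∣ c m ∣
  Cm>0 = ℤₚ.drop‿+<+ (subst (+ 0 ℤ.<_) (sym cm≡) cm)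
  -- This is `a - (a m / c m) c` multiplied by `c m`. Minimality of the ratio at `m` keeps it
  -- nonnegative.
  z : Fin n → ℤ
  z i = c m ℤ.* + a i ℤ.+ ℤ.- + a m ℤ.* c i
  z≡ : ∀ i → z i ≡ + a i ℤ.* c m ℤ.- + a m ℤ.* c i
  z≡ i = lemma (c m) (+ a i) (+ a m) (c i)
    where
    lemma : ∀ x y z w → x ℤ.* y ℤ.+ ℤ.- z ℤ.* w ≡ y ℤ.* x ℤ.- z ℤ.* w
    lemma = ℤ-Ring.solve-∀
  z≥0 : ∀ i → + 0 ℤ.≤ z i
  z≥0 i = subst (+ 0 ℤ.≤_) (sym (z≡ i)) (ℤₚ.i≤j⇒0≤j-i below)
    where
    below : + a m ℤ.* c i ℤ.≤ + a i ℤ.* c m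
    below with + 0 ℤ.<? c i
    ... | yes ci = best i ci
    ... | no ¬ci = ℤₚ.≤-trans
      (subst (+ a m ℤ.* c i ℤ.≤_) (ℤₚ.*-zeroʳ (+ a m)) (ℤₚ.*-monoˡ-≤-nonNeg (+ a m) (ℤₚ.≮⇒≥ ¬ci)))
      (subst (ℤ._≤ + a i ℤ.* c m) (ℤₚ.*-zeroʳ (+ a i)) (ℤₚ.*-monoˡ-≤-nonNeg (+ a i) (ℤₚ.<⇒≤ cm)))
  a′ : Fin n → ℕ
  a′ i = ℤ.∣ z i ∣
  a′≡ : ∀ i → + a′ i ≡ z i
  a′≡ i = ℤₚ.0≤i⇒+∣i∣≡i (z≥0 i)
  a′m : a′ m ≡ 0
  a′m = ℤₚ.+-injective (trans (a′≡ m) (lemma (c m) (+ a m)))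
    where
    lemma : ∀ x y → x ℤ.* y ℤ.+ ℤ.- y ℤ.* x ≡ + 0
    lemma = ℤ-Ring.solve-∀
  supp-a′ : ∀ i → a′ i ≢ 0 → a i ≢ 0
  supp-a′ i ne e = ne (ℤₚ.+-injective (trans (a′≡ i)
    (cong₂ ℤ._+_ (trans (cong (λ t → c m ℤ.* + t) e) (ℤₚ.*-zeroʳ (c m)))
                 (trans (cong (ℤ._*_ (ℤ.- + a m)) (supp-c i e)) (ℤₚ.*-zeroʳ (ℤ.- + a m))))))
  m≢ : ∀ i → a′ i ≢ 0 → m ≢ i
  m≢ i ne refl = ne a′m
  fewer : count a′ < count a
  fewer = begin-strict
    count a′            ≤⟨ count≤ (λ i ne → subst (_≢ 0) (sym (∖-≢ a (m≢ i ne))) (supp-a′ i ne)) ⟩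
    count (a ∖ m)       <⟨ ℕₚ.n<1+n _ ⟩
    suc (count (a ∖ m)) ≡⟨ ∖-count-suc a m (λ e → ℤₚ.<-irrefl (sym (supp-c m e)) cm) ⟨
    count a             ∎
    where open ≤-Reasoning
  total′ : + ∑ℕ a′ ℤ.≤ + (N * ℤ.∣ c m ∣)
  total′ = subst₂ ℤ._≤_ (sym step) (sym (trans (ℤₚ.pos-* N ℤ.∣ c m ∣) (trans (cong (ℤ._*_ (+ N)) cm≡) (ℤₚ.*-comm (+ N) (c m)))))
    (subst (c m ℤ.* + ∑ℕ a ℤ.+ ℤ.- + a m ℤ.* ∑ℤ c ℤ.≤_) (ℤₚ.+-identityʳ _)
      (ℤₚ.+-mono-≤ (ℤₚ.*-monoˡ-≤-nonNeg (c m) {{ℤ.nonNegative (ℤₚ.<⇒≤ cm)}} (ℤ.+≤+ total)) nonpos))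
    where
    step : + ∑ℕ a′ ≡ c m ℤ.* + ∑ℕ a ℤ.+ ℤ.- + a m ℤ.* ∑ℤ c
    step = trans (sym (∑ℤ-pos a′)) (trans (∑ℤ.sum-cong-≗ a′≡)
      (trans (∑ℤ-+ (λ i → c m ℤ.* + a i) (λ i → ℤ.- + a m ℤ.* c i))
        (cong₂ ℤ._+_ (trans (∑ℤ-* (c m) (+_ ∘ a)) (cong (ℤ._*_ (c m)) (∑ℤ-pos a))) (∑ℤ-* (ℤ.- + a m) c))))
    nonpos : ℤ.- + a m ℤ.* ∑ℤ c ℤ.≤ + 0
    nonpos = subst (ℤ._≤ + 0) (ℤₚ.neg-distribˡ-* (+ a m) (∑ℤ c)) (ℤₚ.neg-mono-≤
      (subst (ℤ._≤ + a m ℤ.* ∑ℤ c) (ℤₚ.*-zeroʳ (+ a m)) (ℤₚ.*-monoˡ-≤-nonNeg (+ a m) ∑c≥0)))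
  comb′ : ∀ k → + (N * ℤ.∣ c m ∣) ℤ.* v k ≡ ⟪ a′ , (λ i → X i k) ⟫
  comb′ k = begin
    + (N * ℤ.∣ c m ∣) ℤ.* v k
      ≡⟨ cong (ℤ._* v k) (trans (ℤₚ.pos-* N ℤ.∣ c m ∣) (cong (ℤ._*_ (+ N)) cm≡)) ⟩
    + N ℤ.* c m ℤ.* v k
      ≡⟨ lemma (+ N) (c m) (v k) (ℤ.- + a m) ⟩
    c m ℤ.* (+ N ℤ.* v k) ℤ.+ ℤ.- + a m ℤ.* + 0
      ≡⟨ cong₂ (λ p q → c m ℤ.* p ℤ.+ ℤ.- + a m ℤ.* q) (comb k) (sym (dep k)) ⟩
    c m ℤ.* ⟪ a , (λ i → X i k) ⟫ ℤ.+ ℤ.- + a m ℤ.* (c ∙ (λ i → X i k))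
      ≡⟨ ∙-linearˡ (+_ ∘ a) c (λ i → X i k) (c m) (ℤ.- + a m) ⟨
    z ∙ (λ i → X i k)
      ≡⟨ ∑ℤ.sum-cong-≗ (λ i → cong (ℤ._* X i k) (sym (a′≡ i))) ⟩
    ⟪ a′ , (λ i → X i k) ⟫ ∎
    where
    open ≡-Reasoning
    lemma : ∀ N x v y → N ℤ.* x ℤ.* v ≡ x ℤ.* (N ℤ.* v) ℤ.+ y ℤ.* + 0
    lemma = ℤ-Ring.solve-∀

-- More than `d` points suffice, instead of `d + 1`, because the weight of 0 is free: the relation
-- need not have sum 0, only a nonnegative sum, and this is reached by changing its sign.
carathéodory-step : ∀ {n d} {X : Fin n → Fin d → ℤ} {S v} (h : Hull X S v) → d < count (Hull.coef h) →
  Σ (Hull X S v) λ h′ → count (Hull.coef h′) < count (Hull.coef h)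
carathéodory-step {n} {d} {X} h lt with dependent d X (Hull.coef h) lt
... | c , (q , cq) , supp , dep with + 0 ℤ.≤? ∑ℤ c
...   | yes ∑≥0 = shrink h c (q , cq) supp dep ∑≥0
...   | no ∑≱0 = shrink h (λ i → ℤ.- c i) (q , λ e → cq (trans (sym (ℤₚ.neg-involutive (c q))) (cong ℤ.-_ e)))
    (λ i e → cong ℤ.-_ (supp i e))
    (λ k → trans (∑ℤ.sum-cong-≗ (λ i → neg (c i) (X i k)))
      (trans (∑ℤ-* (ℤ.- + 1) (λ i → c i ℤ.* X i k)) (cong (ℤ._*_ (ℤ.- + 1)) (dep k))))
    (subst (+ 0 ℤ.≤_) (trans (sym (ℤₚ.-1*i≡-i (∑ℤ c))) (trans (sym (∑ℤ-* (ℤ.- + 1) c)) (∑ℤ.sum-cong-≗ (λ i → ℤₚ.-1*i≡-i (c i)))))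
      (ℤₚ.neg-mono-≤ (ℤₚ.<⇒≤ (ℤₚ.≰⇒> ∑≱0))))
  where
  neg : ∀ x y → ℤ.- x ℤ.* y ≡ ℤ.- + 1 ℤ.* (x ℤ.* y)
  neg = ℤ-Ring.solve-∀

carathéodory : ∀ {n d} {X : Fin n → Fin d → ℤ} {S v} → Hull X S v →
  Σ (Hull X S v) λ h → count (Hull.coef h) ≤ d
carathéodory {d = d} {X} {S} {v} h₀ = go (count (Hull.coef h₀)) h₀ ℕₚ.≤-refl
  where
  go : ∀ fuel (h : Hull X S v) → count (Hull.coef h) ≤ fuel → Σ (Hull X S v) λ h → count (Hull.coef h) ≤ d
  go fuel h le with d ℕₚ.<? count (Hull.coef h)
  ... | no ¬lt = h , ℕₚ.≮⇒≥ ¬lt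
  go zero h le | yes lt = ⊥-elim (ℕₚ.n≮0 (ℕₚ.<-≤-trans lt le))
  go (suc fuel) h le | yes lt with carathéodory-step h lt
  ... | h′ , lt′ = go fuel h′ (s≤s⁻¹ (ℕₚ.≤-trans lt′ le))

-- Irreducible spanning sets

∑ℕ-≢0 : ∀ {n} (f : Fin n → ℕ) → ∑ℕ f ≢ 0 → ∃ λ i → f i ≢ 0
∑ℕ-≢0 {zero}  f ne = ⊥-elim (ne refl)
∑ℕ-≢0 {suc n} f ne with f zero ℕₚ.≟ 0
... | no  f0 = zero , f0
... | yes f0 with ∑ℕ-≢0 (f ∘ suc) (λ e → ne (cong₂ _+_ f0 e))
...   | i , fi = suc i , fi

∑ℕ≡0 : ∀ {n} (f : Fin n → ℕ) → ∑ℕ f ≡ 0 → ∀ i → f i ≡ 0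
∑ℕ≡0 f e i = ℕₚ.n≤0⇒n≡0 (subst (f i ≤_) e (term≤∑ℕ f i))

*≢0 : ∀ {a b} → a * b ≢ 0 → a ≢ 0 × b ≢ 0
*≢0 {a} {b} ne = (λ { refl → ne refl }) , (λ { refl → ne (ℕₚ.*-zeroʳ a) })

module _ {n d} (X : Fin n → Fin d → ℤ) where

  homogenise : ℕ → (Fin d → ℤ) → Fin (suc d) → ℤ
  homogenise m u = + m ▹ (λ k → + m ℤ.* u k)

  -- The extra coordinate records the total weight and turns the hull into a cone. The first
  -- generator is the origin. Unmarked points become the zero vector, which leaves the index type
  -- unchanged.
  generators : (Fin n → ℕ) → Fin (suc n) → Fin (suc d) → ℤ
  generators S = homogenise 1 (λ _ → + 0) ▹ (λ i → homogenise (sel (S i) 1) (X i))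

  cone⇒hull : ∀ {S v} → Cone (generators S) (homogenise 1 v) → Hull X S v
  cone⇒hull {S} {v} (N , N>0 , a , eq) = record
    { N = N
    ; N>0 = N>0
    ; coef = coef
    ; supp = λ i ne → proj₁ (sel-supp (S i) (proj₂ (*≢0 {a (suc i)} ne)))
    ; total = subst (∑ℕ coef ≤_) (sym N≡) (ℕₚ.m≤n+m _ _)
    ; comb = λ k → begin
        + N ℤ.* v k
          ≡⟨ cong (ℤ._*_ (+ N)) (ℤₚ.*-identityˡ (v k)) ⟨
        + N ℤ.* (+ 1 ℤ.* v k)
          ≡⟨ eq (suc k) ⟩
        + a zero ℤ.* (+ 1 ℤ.* + 0) ℤ.+ ⟪ a ∘ suc , (λ i → + sel (S i) 1 ℤ.* X i k) ⟫
          ≡⟨ trans (cong (ℤ._+ ⟪ a ∘ suc , (λ i → + sel (S i) 1 ℤ.* X i k) ⟫) (ℤₚ.*-zeroʳ (+ a zero))) (ℤₚ.+-identityˡ _) ⟩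
        ⟪ a ∘ suc , (λ i → + sel (S i) 1 ℤ.* X i k) ⟫
          ≡⟨ ∑ℤ.sum-cong-≗ (λ i → trans (sym (ℤₚ.*-assoc (+ a (suc i)) (+ sel (S i) 1) (X i k))) (cong (ℤ._* X i k) (sym (ℤₚ.pos-* (a (suc i)) (sel (S i) 1))))) ⟩
        ⟪ coef , (λ i → X i k) ⟫ ∎
    }
    where
    open ≡-Reasoning
    coef : Fin n → ℕ
    coef i = a (suc i) * sel (S i) 1
    N≡ : N ≡ a zero + ∑ℕ coef
    N≡ = ℤₚ.+-injective (begin
      + N             ≡⟨ ℤₚ.*-identityʳ (+ N) ⟨
      + N ℤ.* + 1     ≡⟨ eq zero ⟩
      + a zero ℤ.* + 1 ℤ.+ ⟪ a ∘ suc , (λ i → + sel (S i) 1) ⟫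
        ≡⟨ cong₂ ℤ._+_ (ℤₚ.*-identityʳ (+ a zero)) (trans (∑ℤ.sum-cong-≗ (λ i → sym (ℤₚ.pos-* (a (suc i)) (sel (S i) 1)))) (∑ℤ-pos coef)) ⟩
      + (a zero + ∑ℕ coef) ∎)

  hull⇒cone : ∀ {S v} → Hull X S v → Cone (generators S) (homogenise 1 v)
  hull⇒cone {S} {v} h = N , N>0 , ((N ∸ ∑ℕ coef) ▹ coef) , eq
    where
    open Hull h
    open ≡-Reasoning
    coef≡ : ∀ i → + coef i ℤ.* + sel (S i) 1 ≡ + coef i
    coef≡ i with S i ℕₚ.≟ 0 | coef i ℕₚ.≟ 0
    ... | _     | yes c0 rewrite c0 = ℤₚ.*-zeroˡ (+ sel (S i) 1)
    ... | yes s | no c≢0 = ⊥-elim (supp i c≢0 s)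
    ... | no ne | no _ with S i
    ...   | zero  = ⊥-elim (ne refl)
    ...   | suc _ = ℤₚ.*-identityʳ (+ coef i)
    eq : ∀ k → + N ℤ.* homogenise 1 v k ≡ ⟪ (N ∸ ∑ℕ coef) ▹ coef , (λ i → generators S i k) ⟫
    eq zero = begin
      + N ℤ.* + 1                          ≡⟨ ℤₚ.*-identityʳ (+ N) ⟩
      + N                                  ≡⟨ cong +_ (sym (ℕₚ.m∸n+n≡m total)) ⟩
      + (N ∸ ∑ℕ coef) ℤ.+ + ∑ℕ coef
        ≡⟨ cong₂ ℤ._+_ (sym (ℤₚ.*-identityʳ (+ (N ∸ ∑ℕ coef)))) (sym (trans (∑ℤ.sum-cong-≗ coef≡) (∑ℤ-pos coef))) ⟩
      + (N ∸ ∑ℕ coef) ℤ.* + 1 ℤ.+ ⟪ coef , (λ i → + sel (S i) 1) ⟫ ∎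
    eq (suc k) = begin
      + N ℤ.* (+ 1 ℤ.* v k)                ≡⟨ cong (ℤ._*_ (+ N)) (ℤₚ.*-identityˡ (v k)) ⟩
      + N ℤ.* v k                          ≡⟨ comb k ⟩
      ⟪ coef , (λ i → X i k) ⟫
        ≡⟨ ∑ℤ.sum-cong-≗ (λ i → trans (cong (ℤ._* X i k) (sym (coef≡ i))) (ℤₚ.*-assoc (+ coef i) (+ sel (S i) 1) (X i k))) ⟩
      ⟪ coef , (λ i → + sel (S i) 1 ℤ.* X i k) ⟫
        ≡⟨ trans (cong (ℤ._+ ⟪ coef , (λ i → + sel (S i) 1 ℤ.* X i k) ⟫) (ℤₚ.*-zeroʳ (+ (N ∸ ∑ℕ coef)))) (ℤₚ.+-identityˡ _) ⟨
      + (N ∸ ∑ℕ coef) ℤ.* (+ 1 ℤ.* + 0) ℤ.+ ⟪ coef , (λ i → + sel (S i) 1 ℤ.* X i k) ⟫ ∎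

  hull? : ∀ S v → Dec (Hull X S v)
  hull? S v with cone? (generators S) (homogenise 1 v)
  ... | yes c = yes (cone⇒hull c)
  ... | no ¬c = no (¬c ∘ hull⇒cone)

  -- A hull representation of every point at once. The common denominator `N` lets a further
  -- combination be substituted uniformly.
  record Spans (w : Fin n → ℕ) : Set where
    field
      N     : ℕ
      N>0   : 0 < N
      A     : Fin n → Fin n → ℕ
      supp  : ∀ i j → A i j ≢ 0 → w j ≢ 0
      total : ∀ i → ∑ℕ (A i) ≤ N
      comb  : ∀ i k → + N ℤ.* X i k ≡ ⟪ A i , (λ j → X j k) ⟫

  spans⇒hull : ∀ {w} → Spans w → ∀ i → Hull X w (X i)
  spans⇒hull s i = record { N = N ; N>0 = N>0 ; coef = A i ; supp = supp i ; total = total i ; comb = comb i }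
    where open Spans s

  spans-all : Spans (λ _ → 1)
  spans-all = record
    { N = 1 ; N>0 = s≤s z≤n ; A = δ ; supp = λ _ _ _ () ; total = λ i → ℕₚ.≤-reflexive (∑ℕ-δ i)
    ; comb = λ i k → trans (ℤₚ.*-identityˡ (X i k)) (sym (Cb.pair-δ i (λ j → X j k))) }

  -- Every use of `X p` is replaced by the combination `h`, which avoids `p`; the two denominators
  -- multiply.
  spans-∖ : ∀ {w} → Spans w → ∀ p → Hull X (w ∖ p) (X p) → Spans (w ∖ p)
  spans-∖ {w} s p h = record
    { N = H.N * N
    ; N>0 = ℕₚ.*-mono-< H.N>0 N>0
    ; A = A′
    ; supp = supp′
    ; total = total′
    ; comb = comb′
    }
    where
    open Spans s
    module H = Hull h
    A′ : Fin n → Fin n → ℕ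
    A′ i j = H.N * (A i ∖ p) j + A i p * H.coef j
    supp′ : ∀ i j → A′ i j ≢ 0 → (w ∖ p) j ≢ 0
    supp′ i j ne with H.coef j ℕₚ.≟ 0
    ... | no c≢0 = H.supp j c≢0
    ... | yes c0 with ∖-supp (A i) {p} {j} (proj₂ (*≢0 {H.N} left))
      where
      left : H.N * (A i ∖ p) j ≢ 0
      left e = ne (cong₂ _+_ e (trans (cong (_*_ (A i p)) c0) (ℕₚ.*-zeroʳ (A i p))))
    ...   | Aij , p≢j = subst (_≢ 0) (sym (∖-≢ w p≢j)) (supp i j Aij)
    total′ : ∀ i → ∑ℕ (A′ i) ≤ H.N * N
    total′ i = begin
      ∑ℕ (A′ i)                                        ≡⟨ ∑ℕ-+ (λ j → H.N * (A i ∖ p) j) (λ j → A i p * H.coef j) ⟩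
      ∑ℕ (λ j → H.N * (A i ∖ p) j) + ∑ℕ (λ j → A i p * H.coef j)
        ≡⟨ cong₂ _+_ (∑ℕ-const H.N (A i ∖ p)) (∑ℕ-const (A i p) H.coef) ⟩
      H.N * ∑ℕ (A i ∖ p) + A i p * ∑ℕ H.coef           ≤⟨ ℕₚ.+-monoʳ-≤ _ (ℕₚ.*-monoʳ-≤ (A i p) H.total) ⟩
      H.N * ∑ℕ (A i ∖ p) + A i p * H.N                 ≡⟨ cong (_+_ (H.N * ∑ℕ (A i ∖ p))) (ℕₚ.*-comm (A i p) H.N) ⟩
      H.N * ∑ℕ (A i ∖ p) + H.N * A i p                 ≡⟨ ℕₚ.*-distribˡ-+ H.N _ _ ⟨
      H.N * (∑ℕ (A i ∖ p) + A i p)                     ≡⟨ cong (_*_ H.N) (∖-∑ (A i) p) ⟨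
      H.N * ∑ℕ (A i)                                   ≤⟨ ℕₚ.*-monoʳ-≤ H.N (total i) ⟩
      H.N * N                                          ∎
      where open ≤-Reasoning
    comb′ : ∀ i k → + (H.N * N) ℤ.* X i k ≡ ⟪ A′ i , (λ j → X j k) ⟫
    comb′ i k = begin
      + (H.N * N) ℤ.* X i k                            ≡⟨ cong (ℤ._* X i k) (ℤₚ.pos-* H.N N) ⟩
      + H.N ℤ.* + N ℤ.* X i k                          ≡⟨ ℤₚ.*-assoc (+ H.N) (+ N) (X i k) ⟩
      + H.N ℤ.* (+ N ℤ.* X i k)                        ≡⟨ cong (ℤ._*_ (+ H.N)) (trans (comb i k) (∖-pairℤ (A i) p (λ j → X j k))) ⟩
      + H.N ℤ.* (⟪ A i ∖ p , (λ j → X j k) ⟫ ℤ.+ + A i p ℤ.* X p k)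
        ≡⟨ lemma (+ H.N) _ (+ A i p) (X p k) ⟩
      + H.N ℤ.* ⟪ A i ∖ p , (λ j → X j k) ⟫ ℤ.+ + A i p ℤ.* (+ H.N ℤ.* X p k)
        ≡⟨ cong (λ z → + H.N ℤ.* ⟪ A i ∖ p , (λ j → X j k) ⟫ ℤ.+ + A i p ℤ.* z) (H.comb k) ⟩
      + H.N ℤ.* ⟪ A i ∖ p , (λ j → X j k) ⟫ ℤ.+ + A i p ℤ.* ⟪ H.coef , (λ j → X j k) ⟫
        ≡⟨ cong₂ ℤ._+_ (Cb.pair-* H.N (A i ∖ p) (λ j → X j k)) (Cb.pair-* (A i p) H.coef (λ j → X j k)) ⟨
      ⟪ (λ j → H.N * (A i ∖ p) j) , (λ j → X j k) ⟫ ℤ.+ ⟪ (λ j → A i p * H.coef j) , (λ j → X j k) ⟫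
        ≡⟨ Cb.pair-+ (λ j → H.N * (A i ∖ p) j) (λ j → A i p * H.coef j) (λ j → X j k) ⟨
      ⟪ A′ i , (λ j → X j k) ⟫ ∎
      where
      open ≡-Reasoning
      lemma : ∀ h a b x → h ℤ.* (a ℤ.+ b ℤ.* x) ≡ h ℤ.* a ℤ.+ b ℤ.* (h ℤ.* x)
      lemma = ℤ-Ring.solve-∀

  Irreducible : (Fin n → ℕ) → Set
  Irreducible w = ∀ p → w p ≢ 0 → ¬ Hull X (w ∖ p) (X p)

  -- Points are discarded greedily, each time testing only against the points that remain. That the
  -- survivors are extreme among all points is a separate matter, settled by `irreducible⇒extreme`.
  irreducible-spanning : Σ (Fin n → ℕ) λ w → Spans w × Irreducible w
  irreducible-spanning = go (count {n} (λ _ → 1)) (λ _ → 1) ℕₚ.≤-refl spans-all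
    where
    go : ∀ fuel w → count w ≤ fuel → Spans w → Σ (Fin n → ℕ) λ w → Spans w × Irreducible w
    go fuel w le s with Finₚ.any? (λ p → ¬? (w p ℕₚ.≟ 0) ×-dec hull? (w ∖ p) (X p))
    ... | no none = w , s , λ p wp h → none (p , wp , h)
    go zero w le s | yes (p , wp , h) = ⊥-elim (ℕₚ.1+n≢0 (trans (sym (∖-count-suc w p wp)) (ℕₚ.n≤0⇒n≡0 le)))
    go (suc fuel) w le s | yes (p , wp , h) =
      go fuel (w ∖ p) (s≤s⁻¹ (subst (_≤ suc fuel) (∖-count-suc w p wp) le)) (spans-∖ s p h)

  Others : Fin n → Fin n → ℕ
  Others p = (λ _ → 1) ∖ p

  -- Substituting the spanning combinations into one that avoids X p leaves a coefficient
  -- of X p below the common denominator, so X p can be solved for.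
  irreducible⇒extreme : (∀ i j → (∀ k → X i k ≡ X j k) → i ≡ j) →
    ∀ {w} → Spans w → Irreducible w → ∀ p → w p ≢ 0 → ¬ Hull X (Others p) (X p)
  irreducible⇒extreme X-inj {w} s irr p wp h = irr p wp (record
    { N = N₀ * N ∸ β p
    ; N>0 = ℕₚ.m<n⇒0<n∸m βp<
    ; coef = β ∖ p
    ; supp = supp′
    ; total = total′
    ; comb = comb′
    })
    where
    open Spans s
    open Hull h using () renaming (N to N₀; N>0 to N₀>0; coef to c; supp to supp-c; total to total-c; comb to comb-c)
    cp : c p ≡ 0
    cp with c p ℕₚ.≟ 0
    ... | yes e = e
    ... | no ne = ⊥-elim (supp-c p ne (∖-refl (λ _ → 1) p))
    β : Fin n → ℕ
    β j = ∑ℕ (λ i → c i * A i j)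
    -- A coefficient as large as `N` leaves no weight for other points, so `X i` and `X p` would
    -- coincide.
    A<N : ∀ i → i ≢ p → A i p < N
    A<N i i≢p with A i p ℕₚ.<? N
    ... | yes lt = lt
    ... | no ¬lt = ⊥-elim (i≢p (X-inj i p (λ k → ℤₚ.*-cancelˡ-≡ (+ N) _ _ {{ℤ.≢-nonZero (λ e → ℕₚ.<-irrefl (sym (ℤₚ.+-injective e)) N>0)}} (same k))))
      where
      sum≡ : ∑ℕ (A i ∖ p) + A i p ≤ N
      sum≡ = subst (_≤ N) (∖-∑ (A i) p) (total i)
      N≤ : N ≤ A i p
      N≤ = ℕₚ.≮⇒≥ ¬lt
      rest≡0 : ∑ℕ (A i ∖ p) ≡ 0
      rest≡0 = ℕₚ.n≤0⇒n≡0 (ℕₚ.+-cancelʳ-≤ (A i p) _ 0 (ℕₚ.≤-trans sum≡ N≤))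
      Aip≡N : A i p ≡ N
      Aip≡N = ℕₚ.≤-antisym (ℕₚ.≤-trans (ℕₚ.m≤n+m _ _) sum≡) N≤
      same : ∀ k → + N ℤ.* X i k ≡ + N ℤ.* X p k
      same k = begin
        + N ℤ.* X i k                                             ≡⟨ comb i k ⟩
        ⟪ A i , (λ j → X j k) ⟫                                   ≡⟨ ∖-pairℤ (A i) p (λ j → X j k) ⟩
        ⟪ A i ∖ p , (λ j → X j k) ⟫ ℤ.+ + A i p ℤ.* X p k
          ≡⟨ cong₂ (λ x y → x ℤ.+ + y ℤ.* X p k) (trans (Cb.pair-congˡ {y = λ j → X j k} (∑ℕ≡0 (A i ∖ p) rest≡0)) (Cb.pair-0 (λ j → X j k))) Aip≡N ⟩
        + 0 ℤ.+ + N ℤ.* X p k                                     ≡⟨ ℤₚ.+-identityˡ _ ⟩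
        + N ℤ.* X p k                                             ∎
        where open ≡-Reasoning
    term : ∀ i → c i * A i p + c i ≤ N * c i
    term i with i Fin.≟ p
    ... | yes refl rewrite cp = z≤n
    ... | no i≢p = begin
      c i * A i p + c i     ≡⟨ ℕₚ.+-comm _ (c i) ⟩
      c i + c i * A i p     ≡⟨ ℕₚ.*-suc (c i) (A i p) ⟨
      c i * suc (A i p)     ≤⟨ ℕₚ.*-monoʳ-≤ (c i) (A<N i i≢p) ⟩
      c i * N               ≡⟨ ℕₚ.*-comm (c i) N ⟩
      N * c i               ∎
      where open ≤-Reasoning
    βp+ : β p + ∑ℕ c ≤ N * ∑ℕ c
    βp+ = begin
      β p + ∑ℕ c                        ≡⟨ ∑ℕ-+ (λ i → c i * A i p) c ⟨
      ∑ℕ (λ i → c i * A i p + c i)      ≤⟨ ∑ℕ-mono term ⟩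
      ∑ℕ (λ i → N * c i)                ≡⟨ ∑ℕ-const N c ⟩
      N * ∑ℕ c                          ∎
      where open ≤-Reasoning
    βp< : β p < N₀ * N
    βp< with ∑ℕ c ℕₚ.≟ 0
    ... | yes e = ℕₚ.≤-<-trans (subst (β p ≤_) (trans (cong (_*_ N) e) (ℕₚ.*-zeroʳ N)) (ℕₚ.≤-trans (ℕₚ.m≤m+n _ _) βp+)) (ℕₚ.*-mono-< N₀>0 N>0)
    ... | no ne = begin-strict
      β p             <⟨ ℕₚ.m<m+n (β p) (ℕₚ.n≢0⇒n>0 ne) ⟩
      β p + ∑ℕ c      ≤⟨ βp+ ⟩
      N * ∑ℕ c        ≤⟨ ℕₚ.*-monoʳ-≤ N total-c ⟩
      N * N₀          ≡⟨ ℕₚ.*-comm N N₀ ⟩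
      N₀ * N          ∎
      where open ≤-Reasoning
    supp′ : ∀ j → (β ∖ p) j ≢ 0 → (w ∖ p) j ≢ 0
    supp′ j ne with ∖-supp β {p} {j} ne
    ... | βj , p≢j with ∑ℕ-≢0 (λ i → c i * A i j) βj
    ...   | i , cA = subst (_≢ 0) (sym (∖-≢ w p≢j)) (supp i j (proj₂ (*≢0 {c i} cA)))
    ∑β : ∑ℕ β ≤ N₀ * N
    ∑β = begin
      ∑ℕ β                                  ≡⟨ wt-1 β ⟨
      ⟨ β , (λ _ → 1) ⟩                     ≡⟨ Wt.pair-∘ c A (λ _ → 1) ⟨
      ⟨ c , (λ i → ⟨ A i , (λ _ → 1) ⟩) ⟩   ≤⟨ ∑ℕ-mono (λ i → ℕₚ.*-monoʳ-≤ (c i) (subst (_≤ N) (sym (wt-1 (A i))) (total i))) ⟩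
      ∑ℕ (λ i → c i * N)                    ≡⟨ ∑ℕ.*-distribʳ-sum N c ⟨
      ∑ℕ c * N                              ≤⟨ ℕₚ.*-monoˡ-≤ N total-c ⟩
      N₀ * N                                ∎
      where open ≤-Reasoning
    total′ : ∑ℕ (β ∖ p) ≤ N₀ * N ∸ β p
    total′ = subst (_≤ N₀ * N ∸ β p) (trans (cong (_∸ β p) (∖-∑ β p)) (ℕₚ.m+n∸n≡m _ (β p))) (ℕₚ.∸-monoˡ-≤ (β p) ∑β)
    comb′ : ∀ k → + (N₀ * N ∸ β p) ℤ.* X p k ≡ ⟪ β ∖ p , (λ j → X j k) ⟫
    comb′ k = ℤ-+-cancelʳ (+ β p ℤ.* X p k) (begin
      + (N₀ * N ∸ β p) ℤ.* X p k ℤ.+ + β p ℤ.* X p k      ≡⟨ ℤₚ.*-distribʳ-+ (X p k) (+ (N₀ * N ∸ β p)) (+ β p) ⟨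
      + (N₀ * N ∸ β p + β p) ℤ.* X p k                    ≡⟨ cong (λ z → + z ℤ.* X p k) (ℕₚ.m∸n+n≡m (ℕₚ.<⇒≤ βp<)) ⟩
      + (N₀ * N) ℤ.* X p k                                ≡⟨ cong (ℤ._* X p k) (ℤₚ.pos-* N₀ N) ⟩
      + N₀ ℤ.* + N ℤ.* X p k                              ≡⟨ lemma (+ N₀) (+ N) (X p k) ⟩
      + N ℤ.* (+ N₀ ℤ.* X p k)                            ≡⟨ cong (ℤ._*_ (+ N)) (comb-c k) ⟩
      + N ℤ.* ⟪ c , (λ i → X i k) ⟫                       ≡⟨ ∑ℤ-* (+ N) (λ i → + c i ℤ.* X i k) ⟨
      ∑ℤ (λ i → + N ℤ.* (+ c i ℤ.* X i k))                ≡⟨ ∑ℤ.sum-cong-≗ (λ i → trans (*-swapℤ (+ N) (+ c i) (X i k)) (cong (ℤ._*_ (+ c i)) (comb i k))) ⟩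
      ⟪ c , (λ i → ⟪ A i , (λ j → X j k) ⟫) ⟫             ≡⟨ Cb.pair-∘ c A (λ j → X j k) ⟩
      ⟪ β , (λ j → X j k) ⟫                               ≡⟨ ∖-pairℤ β p (λ j → X j k) ⟩
      ⟪ β ∖ p , (λ j → X j k) ⟫ ℤ.+ + β p ℤ.* X p k       ∎)
      where
      open ≡-Reasoning
      lemma : ∀ a b x → a ℤ.* b ℤ.* x ≡ b ℤ.* (a ℤ.* x)
      lemma = ℤ-Ring.solve-∀

-- Diophantine approximation

-- The number of colours after `l` more refinements of `D` colours, each of which splits every
-- colour into `8 * M * D` cells.
stages : ℕ → ℕ → ℕ → ℕ
stages M zero    D = D
stages M (suc l) D = stages M l (D * (8 * M * D))

D≤stages : ∀ M .{{_ : NonZero M}} l D → 0 < D → D ≤ stages M l D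
D≤stages M zero    D D>0 = ℕₚ.≤-refl
D≤stages M (suc l) D D>0 = ℕₚ.≤-trans (ℕₚ.m≤m*n D (8 * M * D) {{>-nonZero 8MD>0}})
  (D≤stages M l (D * (8 * M * D)) (ℕₚ.*-mono-< D>0 8MD>0))
  where
  8MD>0 : 0 < 8 * M * D
  8MD>0 = ℕₚ.*-mono-< (ℕₚ.*-mono-< {0} {8} (s≤s z≤n) (>-nonZero⁻¹ M)) D>0

-- 8 M D is squared at every stage.
stages-bound : ∀ M .{{_ : NonZero M}} l D → stages M l D ≤ (8 * M * D) ^ (2 ^ l)
stages-bound M zero D = subst (D ≤_) (sym (ℕₚ.*-identityʳ (8 * M * D))) (ℕₚ.m≤n*m D (8 * M) {{ℕₚ.m*n≢0 8 M}})
stages-bound M (suc l) D = ℕₚ.≤-trans (stages-bound M l (D * (8 * M * D))) (ℕₚ.≤-reflexive (begin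
  (8 * M * (D * (8 * M * D))) ^ (2 ^ l)   ≡⟨ cong (_^ (2 ^ l)) (square (8 * M) D) ⟩
  ((8 * M * D) ^ 2) ^ (2 ^ l)             ≡⟨ ℕₚ.^-*-assoc (8 * M * D) 2 (2 ^ l) ⟩
  (8 * M * D) ^ (2 ^ suc l)               ∎))
  where
  open ≡-Reasoning
  square : ∀ m D → m * (D * (m * D)) ≡ (m * D) ^ 2
  square m D = trans (lemma m D) (cong (_*_ (m * D)) (sym (ℕₚ.*-identityʳ (m * D))))
    where
    lemma : ∀ m D → m * (D * (m * D)) ≡ m * D * (m * D)
    lemma = ℕ-Ring.solve-∀

-- For x = `a / N` this splits `k` x into an integral part `g` and a remainder `f / N` of total
-- weight at most 1. At least two copies are needed for the trade to pay off, since the remainder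
-- can cost one new point.
record SmallRemainder {n} (a : Fin n → ℕ) (N K : ℕ) : Set where
  field
    k     : ℕ
    2≤k   : 2 ≤ k
    k≤K   : k ≤ K
    g f   : Fin n → ℕ
    split : ∀ i → k * a i ≡ g i * N + f i
    total : ∑ℕ f ≤ N

-- Dirichlet's argument for x = a / N, applied only to the coordinates with x i ≥ 1/(4MD),
-- where D is the number of colours used so far.  Colouring such a coordinate by cells of
-- width at most x i / 2 squares D up to a factor; the coordinates never coloured stay below
-- 1/(4M) during the first D multiples.  Two multiples k₁ < k₂ ≤ D of equal colour yield
-- k = 1 + (k₂ - k₁), the fractional parts of k x being bounded by x + {k₂ x} - {k₁ x} ≥ 0.
module Dirichlet {n} (a : Fin n → ℕ) (N M : ℕ) .{{_ : NonZero N}} .{{_ : NonZero M}}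
  (∑a≡N : ∑ℕ a ≡ N) (count-a : count a ≤ M) where

  r : Fin n → ℕ → ℕ
  r i k = (k * a i) % N

  q : Fin n → ℕ → ℕ
  q i k = (k * a i) / N

  -- The error is measured against `a i`, which serves twice: it keeps `f i` nonnegative, and the
  -- errors of all coloured coordinates add up to at most `N / 2`.
  Coloured : ∀ {D} → (ℕ → Fin D) → Fin n → Set
  Coloured col i = ∀ k l → col k ≡ col l → 2 * r i k ≤ 2 * r i l + a i

  Tiny : ℕ → Fin n → Set
  Tiny D i = 4 * M * D * a i < N

  r<N : ∀ i k → r i k < N
  r<N i k = ℕ.m%n<n (k * a i) N

  cell-bound : ∀ c .{{_ : NonZero c}} i k → c * r i k / N < c
  cell-bound c i k = ℕ.m<n*o⇒m/o<n (ℕₚ.*-monoʳ-< c (r<N i k))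

  same-cell : ∀ c i k l → c * r i k / N ≡ c * r i l / N → c * r i k < c * r i l + N
  same-cell c i k l e = begin-strict
    c * r i k                                       ≡⟨ ℕ.m≡m%n+[m/n]*n (c * r i k) N ⟩
    (c * r i k) % N + (c * r i k / N) * N           <⟨ ℕₚ.+-monoˡ-< _ (ℕ.m%n<n (c * r i k) N) ⟩
    N + (c * r i k / N) * N                         ≡⟨ cong (λ z → N + z * N) e ⟩
    N + (c * r i l / N) * N                         ≤⟨ ℕₚ.+-monoʳ-≤ N (ℕ.m/n*n≤m (c * r i l) N) ⟩
    N + c * r i l                                   ≡⟨ ℕₚ.+-comm N _ ⟩
    c * r i l + N                                   ∎
    where open ≤-Reasoning

  record Colouring (K : ℕ) : Set where
    field
      D   : ℕ
      D>0 : 0 < D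
      D≤K : D ≤ K
      col : ℕ → Fin D
      all : ∀ i → Coloured col i ⊎ Tiny D i

  -- The support of `ρ` consists of the coordinates still to be coloured, and its size is the fuel.
  -- Since `D` grows, a coordinate that was tiny can cease to be so; all uncoloured coordinates are
  -- therefore tested again after each refinement.
  refine : ∀ l (ρ : Fin n → ℕ) D (col : ℕ → Fin D) → 0 < D → count ρ ≤ l →
    (∀ i → ρ i ≡ 0 → Coloured col i ⊎ a i ≡ 0) → Colouring (stages M l D)
  refine l ρ D col D>0 le inv
    with Finₚ.any? (λ i → ¬? (ρ i ℕₚ.≟ 0) ×-dec (N ℕₚ.≤? 4 * M * D * a i))
  ... | no none = record { D = D ; D>0 = D>0 ; D≤K = D≤stages M l D D>0 ; col = col ; all = classify }
    where
    classify : ∀ i → Coloured col i ⊎ Tiny D i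
    classify i with ρ i ℕₚ.≟ 0
    ... | no ne = inj₂ (ℕₚ.≰⇒> (λ N≤ → none (i , ne , N≤)))
    ... | yes e with inv i e
    ...   | inj₁ c = inj₁ c
    ...   | inj₂ a0 = inj₂ (subst (_< N) (sym (trans (cong (_*_ (4 * M * D)) a0) (ℕₚ.*-zeroʳ (4 * M * D)))) (>-nonZero⁻¹ N))
  refine zero ρ D col D>0 le inv | yes (i , ρi , _) =
    ⊥-elim (ℕₚ.1+n≢0 (trans (sym (∖-count-suc ρ i ρi)) (ℕₚ.n≤0⇒n≡0 le)))
  refine (suc l) ρ D col D>0 le inv | yes (i , ρi , N≤) =
    refine l (ρ ∖ i) (D * c) col′ (ℕₚ.*-mono-< D>0 (>-nonZero⁻¹ c))
      (s≤s⁻¹ (subst (_≤ suc l) (∖-count-suc ρ i ρi) le)) inv′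
    where
    -- `E` is the factor in the definition of `Tiny`. With twice as many cells, two remainders in
    -- the same cell differ by less than `N / c`, which is at most `a i / 2`.
    c E : ℕ
    c = 8 * M * D
    E = 4 * M * D
    instance
      _ : NonZero D
      _ = >-nonZero D>0
      4M≢0 : NonZero (4 * M)
      4M≢0 = ℕₚ.m*n≢0 4 M
      8M≢0 : NonZero (8 * M)
      8M≢0 = ℕₚ.m*n≢0 8 M
      E≢0 : NonZero E
      E≢0 = ℕₚ.m*n≢0 (4 * M) D
      c≢0 : NonZero c
      c≢0 = ℕₚ.m*n≢0 (8 * M) D
    cell : ℕ → Fin c
    cell k = fromℕ< (cell-bound c i k)
    col′ : ℕ → Fin (D * c)
    col′ k = Fin.combine (col k) (cell k)
    c≡ : ∀ x → c * x ≡ E * (2 * x)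
    c≡ x = lemma M D x
      where
      lemma : ∀ M D x → 8 * M * D * x ≡ 4 * M * D * (2 * x)
      lemma = ℕ-Ring.solve-∀
    coloured : Coloured col′ i
    coloured k l e = ℕₚ.<⇒≤ (ℕₚ.*-cancelˡ-< E _ _ (begin-strict
      E * (2 * r i k)             ≡⟨ c≡ (r i k) ⟨
      c * r i k                   <⟨ same-cell c i k l (Finₚ.fromℕ<-injective _ _ _ _ (Finₚ.combine-injectiveʳ (col k) (cell k) (col l) (cell l) e)) ⟩
      c * r i l + N               ≤⟨ ℕₚ.+-monoʳ-≤ _ N≤ ⟩
      c * r i l + E * a i         ≡⟨ cong (_+ E * a i) (c≡ (r i l)) ⟩
      E * (2 * r i l) + E * a i   ≡⟨ ℕₚ.*-distribˡ-+ E _ _ ⟨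
      E * (2 * r i l + a i)       ∎))
      where open ≤-Reasoning
    inv′ : ∀ j → (ρ ∖ i) j ≡ 0 → Coloured col′ j ⊎ a j ≡ 0
    inv′ j e with i Fin.≟ j
    ... | yes refl = inj₁ coloured
    ... | no i≢j with inv j (trans (sym (∖-≢ ρ i≢j)) e)
    ...   | inj₂ a0 = inj₂ a0
    ...   | inj₁ cl = inj₁ (λ k l eq → cl k l (Finₚ.combine-injectiveˡ (col k) (cell k) (col l) (cell l) eq))

  module Pair (K : ℕ) (C : Colouring K) where
    open Colouring C

    module _ (k₁ k₂ : ℕ) (k₁<k₂ : k₁ < k₂) (k₂≤D : k₂ ≤ D) (same : col k₁ ≡ col k₂) where

      e : ℕ
      e = k₂ ∸ k₁

      tiny-exact : ∀ i → Tiny D i → ∀ k → k ≤ D → 4 * M * r i k < N × r i k ≡ k * a i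
      tiny-exact i t k k≤D = subst (λ z → 4 * M * z < N) (sym exact) 4Mka<N , exact
        where
        open ≤-Reasoning
        4Mka<N : 4 * M * (k * a i) < N
        4Mka<N = begin-strict
          4 * M * (k * a i)     ≡⟨ ℕₚ.*-assoc (4 * M) k (a i) ⟨
          4 * M * k * a i       ≤⟨ ℕₚ.*-monoˡ-≤ (a i) (ℕₚ.*-monoʳ-≤ (4 * M) k≤D) ⟩
          4 * M * D * a i       <⟨ t ⟩
          N                     ∎
        exact : r i k ≡ k * a i
        exact = ℕ.m<n⇒m%n≡m (ℕₚ.≤-<-trans (ℕₚ.m≤n*m (k * a i) (4 * M) {{ℕₚ.m*n≢0 4 M}}) 4Mka<N)

      r₁≤ : ∀ i → r i k₁ ≤ a i + r i k₂
      r₁≤ i with all i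
      ... | inj₁ cl = ℕₚ.*-cancelˡ-≤ 2 (ℕₚ.≤-trans (cl k₁ k₂ same) (begin
        2 * r i k₂ + a i          ≤⟨ ℕₚ.+-monoʳ-≤ (2 * r i k₂) (ℕₚ.m≤m+n (a i) (1 * a i)) ⟩
        2 * r i k₂ + 2 * a i      ≡⟨ lemma (r i k₂) (a i) ⟩
        2 * (a i + r i k₂)        ∎))
        where
        open ≤-Reasoning
        lemma : ∀ x y → 2 * x + 2 * y ≡ 2 * (y + x)
        lemma = ℕ-Ring.solve-∀
      ... | inj₂ t = begin
        r i k₁                    ≡⟨ proj₂ (tiny-exact i t k₁ (ℕₚ.≤-trans (ℕₚ.<⇒≤ k₁<k₂) k₂≤D)) ⟩
        k₁ * a i                  ≤⟨ ℕₚ.*-monoˡ-≤ (a i) (ℕₚ.<⇒≤ k₁<k₂) ⟩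
        k₂ * a i                  ≡⟨ proj₂ (tiny-exact i t k₂ k₂≤D) ⟨
        r i k₂                    ≤⟨ ℕₚ.m≤n+m _ _ ⟩
        a i + r i k₂              ∎
        where open ≤-Reasoning

      -- After division by `4 * M`, the excess of the second remainder is at most `a i / 2` at a
      -- coloured coordinate and `N / (4 * M)` at a tiny one; `sgn` restricts the latter to nonzero
      -- coordinates, of which there are at most `M`. The total excess is thus at most
      -- `N / 2 + N / 4`, which leaves `∑ℕ f` below `2 * N`.
      r₂≤ : ∀ i → 4 * M * r i k₂ ≤ 4 * M * r i k₁ + (2 * M * a i + N * sgn (a i))
      r₂≤ i with all i
      ... | inj₁ cl = begin
        4 * M * r i k₂                          ≡⟨ lemma₁ M (r i k₂) ⟩
        2 * M * (2 * r i k₂)                    ≤⟨ ℕₚ.*-monoʳ-≤ (2 * M) (cl k₂ k₁ (sym same)) ⟩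
        2 * M * (2 * r i k₁ + a i)              ≡⟨ lemma₂ M (r i k₁) (a i) ⟩
        4 * M * r i k₁ + 2 * M * a i            ≤⟨ ℕₚ.+-monoʳ-≤ (4 * M * r i k₁) (ℕₚ.m≤m+n (2 * M * a i) (N * sgn (a i))) ⟩
        4 * M * r i k₁ + (2 * M * a i + N * sgn (a i)) ∎
        where
        open ≤-Reasoning
        lemma₁ : ∀ M x → 4 * M * x ≡ 2 * M * (2 * x)
        lemma₁ = ℕ-Ring.solve-∀
        lemma₂ : ∀ M x y → 2 * M * (2 * x + y) ≡ 4 * M * x + 2 * M * y
        lemma₂ = ℕ-Ring.solve-∀
      ... | inj₂ t = ℕₚ.≤-trans 4Mr≤ (ℕₚ.≤-trans (ℕₚ.m≤n+m (N * sgn (a i)) (2 * M * a i)) (ℕₚ.m≤n+m _ (4 * M * r i k₁)))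
        where
        4Mr≤ : 4 * M * r i k₂ ≤ N * sgn (a i)
        4Mr≤ with tiny-exact i t k₂ k₂≤D
        ... | lt , exact with a i
        ...   | suc _ = ℕₚ.≤-trans (ℕₚ.<⇒≤ lt) (ℕₚ.≤-reflexive (sym (ℕₚ.*-identityʳ N)))
        ...   | zero  = ℕₚ.≤-trans (ℕₚ.≤-reflexive (trans (cong (_*_ (4 * M)) (trans exact (ℕₚ.*-zeroʳ k₂))) (ℕₚ.*-zeroʳ (4 * M)))) z≤n

      f g : Fin n → ℕ
      f i = a i + r i k₂ ∸ r i k₁
      g i = q i k₂ ∸ q i k₁

      f+ : ∀ i → f i + r i k₁ ≡ a i + r i k₂
      f+ i = ℕₚ.m∸n+n≡m (r₁≤ i)

      g+ : ∀ i → g i + q i k₁ ≡ q i k₂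
      g+ i = ℕₚ.m∸n+n≡m (ℕ./-monoˡ-≤ N (ℕₚ.*-monoˡ-≤ (a i) (ℕₚ.<⇒≤ k₁<k₂)))

      split : ∀ i → suc e * a i ≡ g i * N + f i
      split i = ℕₚ.+-cancelʳ-≡ (r i k₁ + q i k₁ * N) _ _ (begin
        suc e * a i + (r i k₁ + q i k₁ * N)       ≡⟨ cong (_+_ (suc e * a i)) (ℕ.m≡m%n+[m/n]*n (k₁ * a i) N) ⟨
        suc e * a i + k₁ * a i                    ≡⟨ lemma₁ e k₁ (a i) ⟩
        a i + (e + k₁) * a i                      ≡⟨ cong (λ z → a i + z * a i) (ℕₚ.m∸n+n≡m (ℕₚ.<⇒≤ k₁<k₂)) ⟩
        a i + k₂ * a i                            ≡⟨ cong (_+_ (a i)) (ℕ.m≡m%n+[m/n]*n (k₂ * a i) N) ⟩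
        a i + (r i k₂ + q i k₂ * N)               ≡⟨ ℕₚ.+-assoc (a i) _ _ ⟨
        a i + r i k₂ + q i k₂ * N                 ≡⟨ cong₂ (λ x y → x + y * N) (sym (f+ i)) (sym (g+ i)) ⟩
        f i + r i k₁ + (g i + q i k₁) * N         ≡⟨ lemma₂ (f i) (r i k₁) (g i) (q i k₁) N ⟩
        g i * N + f i + (r i k₁ + q i k₁ * N)     ∎)
        where
        open ≡-Reasoning
        lemma₁ : ∀ e k a → suc e * a + k * a ≡ a + (e + k) * a
        lemma₁ = ℕ-Ring.solve-∀
        lemma₂ : ∀ f r g q N → f + r + (g + q) * N ≡ g * N + f + (r + q * N)
        lemma₂ = ℕ-Ring.solve-∀

      R₁ R₂ : ℕ
      R₁ = ∑ℕ (λ i → r i k₁)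
      R₂ = ∑ℕ (λ i → r i k₂)

      ∑f+ : ∑ℕ f + R₁ ≡ N + R₂
      ∑f+ = begin
        ∑ℕ f + R₁                           ≡⟨ ∑ℕ-+ f (λ i → r i k₁) ⟨
        ∑ℕ (λ i → f i + r i k₁)             ≡⟨ ∑ℕ.sum-cong-≗ f+ ⟩
        ∑ℕ (λ i → a i + r i k₂)             ≡⟨ ∑ℕ-+ a (λ i → r i k₂) ⟩
        ∑ℕ a + R₂                           ≡⟨ cong (_+ R₂) ∑a≡N ⟩
        N + R₂                              ∎
        where open ≡-Reasoning

      R₂≤ : 4 * M * R₂ ≤ 4 * M * R₁ + (2 * M * N + N * M)
      R₂≤ = begin
        4 * M * R₂                          ≡⟨ ∑ℕ-const (4 * M) (λ i → r i k₂) ⟨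
        ∑ℕ (λ i → 4 * M * r i k₂)           ≤⟨ ∑ℕ-mono r₂≤ ⟩
        ∑ℕ (λ i → 4 * M * r i k₁ + (2 * M * a i + N * sgn (a i)))
          ≡⟨ trans (∑ℕ-+ (λ i → 4 * M * r i k₁) (λ i → 2 * M * a i + N * sgn (a i)))
               (cong (_+_ (∑ℕ (λ i → 4 * M * r i k₁))) (∑ℕ-+ (λ i → 2 * M * a i) (λ i → N * sgn (a i)))) ⟩
        ∑ℕ (λ i → 4 * M * r i k₁) + (∑ℕ (λ i → 2 * M * a i) + ∑ℕ (λ i → N * sgn (a i)))
          ≡⟨ cong₂ _+_ (∑ℕ-const (4 * M) (λ i → r i k₁)) (cong₂ _+_ (∑ℕ-const (2 * M) a) (∑ℕ-const N (λ i → sgn (a i)))) ⟩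
        4 * M * R₁ + (2 * M * ∑ℕ a + N * count a)
          ≤⟨ ℕₚ.+-monoʳ-≤ (4 * M * R₁) (ℕₚ.+-mono-≤ (ℕₚ.≤-reflexive (cong (_*_ (2 * M)) ∑a≡N)) (ℕₚ.*-monoʳ-≤ N count-a)) ⟩
        4 * M * R₁ + (2 * M * N + N * M) ∎
        where open ≤-Reasoning

      ∑f<2N : ∑ℕ f < 2 * N
      ∑f<2N = ℕₚ.*-cancelˡ-< (4 * M) _ _ (ℕₚ.+-cancelʳ-< (4 * M * R₁) _ _ (begin-strict
        4 * M * ∑ℕ f + 4 * M * R₁                             ≡⟨ ℕₚ.*-distribˡ-+ (4 * M) (∑ℕ f) R₁ ⟨
        4 * M * (∑ℕ f + R₁)                                   ≡⟨ cong (_*_ (4 * M)) ∑f+ ⟩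
        4 * M * (N + R₂)                                      ≡⟨ ℕₚ.*-distribˡ-+ (4 * M) N R₂ ⟩
        4 * M * N + 4 * M * R₂                                ≤⟨ ℕₚ.+-monoʳ-≤ (4 * M * N) R₂≤ ⟩
        4 * M * N + (4 * M * R₁ + (2 * M * N + N * M))        <⟨ ℕₚ.m<m+n _ (ℕₚ.*-mono-< (>-nonZero⁻¹ M) (>-nonZero⁻¹ N)) ⟩
        4 * M * N + (4 * M * R₁ + (2 * M * N + N * M)) + M * N  ≡⟨ lemma M N R₁ ⟩
        4 * M * (2 * N) + 4 * M * R₁                          ∎))
        where
        open ≤-Reasoning
        lemma : ∀ M N R → 4 * M * N + (4 * M * R + (2 * M * N + N * M)) + M * N ≡ 4 * M * (2 * N) + 4 * M * R
        lemma = ℕ-Ring.solve-∀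

      kN≡ : suc e * N ≡ ∑ℕ g * N + ∑ℕ f
      kN≡ = begin
        suc e * N                           ≡⟨ cong (_*_ (suc e)) ∑a≡N ⟨
        suc e * ∑ℕ a                        ≡⟨ ∑ℕ-const (suc e) a ⟨
        ∑ℕ (λ i → suc e * a i)              ≡⟨ ∑ℕ.sum-cong-≗ split ⟩
        ∑ℕ (λ i → g i * N + f i)            ≡⟨ ∑ℕ-+ (λ i → g i * N) f ⟩
        ∑ℕ (λ i → g i * N) + ∑ℕ f           ≡⟨ cong (_+ ∑ℕ f) (∑ℕ.*-distribʳ-sum N g) ⟨
        ∑ℕ g * N + ∑ℕ f                     ∎
        where open ≡-Reasoning

      -- ∑ f is a multiple of N.
      ∑f≤N : ∑ℕ f ≤ N
      ∑f≤N with ∑ℕ f ℕₚ.≤? N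
      ... | yes le = le
      ... | no ¬le = ⊥-elim (ℕₚ.<⇒≱ G+1<k (s≤s⁻¹ k<G+2))
        where
        open ≤-Reasoning
        G : ℕ
        G = ∑ℕ g
        G+1<k : suc G < suc e
        G+1<k = ℕₚ.*-cancelʳ-< N _ _ (begin-strict
          N + G * N        ≡⟨ ℕₚ.+-comm N _ ⟩
          G * N + N        <⟨ ℕₚ.+-monoʳ-< (G * N) (ℕₚ.≰⇒> ¬le) ⟩
          G * N + ∑ℕ f     ≡⟨ kN≡ ⟨
          suc e * N        ∎)
        k<G+2 : suc e < suc (suc G)
        k<G+2 = ℕₚ.*-cancelʳ-< N _ _ (begin-strict
          suc e * N        ≡⟨ kN≡ ⟩
          G * N + ∑ℕ f     <⟨ ℕₚ.+-monoʳ-< (G * N) ∑f<2N ⟩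
          G * N + 2 * N    ≡⟨ lemma G N ⟩
          suc (suc G) * N  ∎)
          where
          lemma : ∀ G N → G * N + 2 * N ≡ suc (suc G) * N
          lemma = ℕ-Ring.solve-∀

      remainder : SmallRemainder a N (suc K)
      remainder = record
        { k = suc e ; 2≤k = s≤s (ℕₚ.m<n⇒0<n∸m k₁<k₂)
        ; k≤K = s≤s (ℕₚ.≤-trans (ℕₚ.m∸n≤m k₂ k₁) (ℕₚ.≤-trans k₂≤D D≤K))
        ; g = g ; f = f ; split = split ; total = ∑f≤N }

  -- One colour and at most `M` uncoloured coordinates at the start give `stages M M 1`. The `D + 1`
  -- multiples from 0 to `D` then share `D` colours.
  small-remainder : SmallRemainder a N (suc (stages M M 1))
  small-remainder = found (Finₚ.pigeonhole (ℕₚ.n<1+n D) (col ∘ toℕ))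
    where
    C : Colouring (stages M M 1)
    C = refine M a 1 (λ _ → zero) (s≤s z≤n) count-a (λ i → inj₂)
    open Colouring C
    found : (∃ λ i → ∃ λ j → i Fin.< j × col (toℕ i) ≡ col (toℕ j)) → SmallRemainder a N (suc (stages M M 1))
    found (i , j , i<j , same) = Pair.remainder _ C (toℕ i) (toℕ j) i<j (s≤s⁻¹ (Finₚ.toℕ<n j)) same

-- Parity and midpoints

sel-∑ : ∀ {n} m (f : Fin n → ℕ) → sel m (∑ℕ f) ≡ ∑ℕ (λ i → sel m (f i))
sel-∑ {n} zero    f = sym (trans (∑ℕ.sum-cong-≗ {n} (λ _ → refl)) (∑ℕ.sum-replicate-zero n))
sel-∑     (suc m) f = refl

unsel-∑ : ∀ {n} m (f : Fin n → ℕ) → unsel m (∑ℕ f) ≡ ∑ℕ (λ i → unsel m (f i))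
unsel-∑     zero    f = refl
unsel-∑ {n} (suc m) f = sym (∑ℕ.sum-replicate-zero n)

sgn-sel : ∀ m x → sgn x ≡ sgn (sel m x) + sgn (unsel m x)
sgn-sel zero    x = refl
sgn-sel (suc m) x = sym (ℕₚ.+-identityʳ (sgn x))

-- Splitting by the parity of one coordinate leaves more than 2 ^ d points in one class.
same-parity : ∀ {n} d (X : Fin n → Fin d → ℤ) (f : Fin n → ℕ) → 2 ^ d < count f →
  ∃ λ i → ∃ λ j → i ≢ j × f i ≢ 0 × f j ≢ 0 × (∀ k → X i k ℤ.%ℕ 2 ≡ X j k ℤ.%ℕ 2)
same-parity zero X f lt with count-two f lt
... | i , j , i≢j , fi , fj = i , j , i≢j , fi , fj , λ ()
same-parity (suc d) X f lt = halve (2 ^ d ℕₚ.<? count odd) (2 ^ d ℕₚ.<? count even)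
  where
  par : Fin _ → ℕ
  par i = X i zero ℤ.%ℕ 2
  odd even : Fin _ → ℕ
  odd i = sel (par i) (f i)
  even i = unsel (par i) (f i)
  split : count f ≡ count odd + count even
  split = trans (∑ℕ.sum-cong-≗ (λ i → sgn-sel (par i) (f i))) (∑ℕ-+ (sgn ∘ odd) (sgn ∘ even))
  par-odd : ∀ i → odd i ≢ 0 → par i ≡ 1
  par-odd i ne = ℕₚ.≤-antisym (s≤s⁻¹ (ℤ.n%ℕd<d (X i zero) 2)) (ℕₚ.n≢0⇒n>0 (proj₁ (sel-supp (par i) ne)))
  halve : Dec (2 ^ d < count odd) → Dec (2 ^ d < count even) → _
  halve (yes lt′) _ with same-parity d (λ i k → X i (suc k)) odd lt′
  ... | i , j , i≢j , fi , fj , eq = i , j , i≢j , proj₂ (sel-supp (par i) fi) , proj₂ (sel-supp (par j) fj) ,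
    λ { zero → trans (par-odd i fi) (sym (par-odd j fj)) ; (suc k) → eq k }
  halve (no _) (yes lt′) with same-parity d (λ i k → X i (suc k)) even lt′
  ... | i , j , i≢j , fi , fj , eq = i , j , i≢j , proj₂ (unsel-supp (par i) fi) , proj₂ (unsel-supp (par j) fj) ,
    λ { zero → trans (proj₁ (unsel-supp (par i) fi)) (sym (proj₁ (unsel-supp (par j) fj))) ; (suc k) → eq k }
  halve (no ¬o) (no ¬e) = ⊥-elim (ℕₚ.<⇒≱ lt (subst (_≤ 2 ^ suc d) (sym split)
    (ℕₚ.+-mono-≤ (ℕₚ.≮⇒≥ ¬o) (ℕₚ.≤-trans (ℕₚ.≮⇒≥ ¬e) (ℕₚ.≤-reflexive (sym (ℕₚ.+-identityʳ (2 ^ d))))))))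

half-sum : ∀ x y → x ℤ.%ℕ 2 ≡ y ℤ.%ℕ 2 → Σ ℤ λ h → x ℤ.+ y ≡ + 2 ℤ.* h
half-sum x y e = h , (begin
  x ℤ.+ y
    ≡⟨ cong₂ ℤ._+_ (ℤ.a≡a%ℕn+[a/ℕn]*n x 2) (ℤ.a≡a%ℕn+[a/ℕn]*n y 2) ⟩
  (+ (x ℤ.%ℕ 2) ℤ.+ (x ℤ./ℕ 2) ℤ.* + 2) ℤ.+ (+ (y ℤ.%ℕ 2) ℤ.+ (y ℤ./ℕ 2) ℤ.* + 2)
    ≡⟨ cong (λ z → (+ (x ℤ.%ℕ 2) ℤ.+ (x ℤ./ℕ 2) ℤ.* + 2) ℤ.+ (+ z ℤ.+ (y ℤ./ℕ 2) ℤ.* + 2)) (sym e) ⟩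
  (+ (x ℤ.%ℕ 2) ℤ.+ (x ℤ./ℕ 2) ℤ.* + 2) ℤ.+ (+ (x ℤ.%ℕ 2) ℤ.+ (y ℤ./ℕ 2) ℤ.* + 2)
    ≡⟨ lemma (+ (x ℤ.%ℕ 2)) (x ℤ./ℕ 2) (y ℤ./ℕ 2) ⟩
  + 2 ℤ.* h ∎)
  where
  open ≡-Reasoning
  h : ℤ
  h = + (x ℤ.%ℕ 2) ℤ.+ (x ℤ./ℕ 2) ℤ.+ (y ℤ./ℕ 2)
  lemma : ∀ r p q → (r ℤ.+ p ℤ.* + 2) ℤ.+ (r ℤ.+ q ℤ.* + 2) ≡ + 2 ℤ.* (r ℤ.+ p ℤ.+ q)
  lemma = ℤ-Ring.solve-∀

norm : ∀ {d} → (Fin d → ℤ) → ℕ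
norm u = ∑ℕ (λ k → ℤ.∣ u k ∣ * ℤ.∣ u k ∣)

norm-cong : ∀ {d} {u v : Fin d → ℤ} → (∀ k → u k ≡ v k) → norm u ≡ norm v
norm-cong eq = ∑ℕ.sum-cong-≗ (λ k → cong (λ z → ℤ.∣ z ∣ * ℤ.∣ z ∣) (eq k))

-- By the parallelogram law the two sides differ by half of `|u - v|²`, which is positive.
midpoint-norm : ∀ {d} (u v h : Fin d → ℤ) → (∀ k → u k ℤ.+ v k ≡ + 2 ℤ.* h k) → ¬ (∀ k → u k ≡ v k) →
  2 * norm h < norm u + norm v
midpoint-norm {d} u v h mid u≢v = ℕₚ.*-cancelˡ-< 2 _ _ (begin-strict
  2 * (2 * norm h)                    ≡⟨ ℕₚ.*-assoc 2 2 (norm h) ⟨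
  4 * norm h                          <⟨ ℕₚ.m<m+n _ diff>0 ⟩
  4 * norm h + norm diff              ≡⟨ parallelogram ⟨
  2 * (norm u + norm v)               ∎)
  where
  open ≤-Reasoning
  diff : Fin d → ℤ
  diff k = u k ℤ.- v k
  sq : ℤ → ℕ
  sq z = ℤ.∣ z ∣ * ℤ.∣ z ∣
  parallelogram₁ : ∀ k → 2 * (sq (u k) + sq (v k)) ≡ 4 * sq (h k) + sq (diff k)
  parallelogram₁ k = ℤₚ.+-injective (E.begin
    + (2 * (sq (u k) + sq (v k)))                   E.≡⟨ ℤₚ.pos-* 2 (sq (u k) + sq (v k)) ⟩
    + 2 ℤ.* (+ sq (u k) ℤ.+ + sq (v k))             E.≡⟨ cong₂ (λ p q → + 2 ℤ.* (p ℤ.+ q)) (sym (sq-nonneg (u k))) (sym (sq-nonneg (v k))) ⟩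
    + 2 ℤ.* (u k ℤ.* u k ℤ.+ v k ℤ.* v k)           E.≡⟨ lemma₁ (u k) (v k) ⟩
    (u k ℤ.+ v k) ℤ.* (u k ℤ.+ v k) ℤ.+ diff k ℤ.* diff k
      E.≡⟨ cong (λ z → z ℤ.* z ℤ.+ diff k ℤ.* diff k) (mid k) ⟩
    (+ 2 ℤ.* h k) ℤ.* (+ 2 ℤ.* h k) ℤ.+ diff k ℤ.* diff k
      E.≡⟨ lemma₂ (h k) (diff k ℤ.* diff k) ⟩
    + 4 ℤ.* (h k ℤ.* h k) ℤ.+ diff k ℤ.* diff k     E.≡⟨ cong₂ (λ p q → + 4 ℤ.* p ℤ.+ q) (sq-nonneg (h k)) (sq-nonneg (diff k)) ⟩
    + 4 ℤ.* + sq (h k) ℤ.+ + sq (diff k)            E.≡⟨ cong (ℤ._+ + sq (diff k)) (ℤₚ.pos-* 4 (sq (h k))) ⟨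
    + (4 * sq (h k) + sq (diff k))                  E.∎)
    where
    module E = ≡-Reasoning
    lemma₁ : ∀ x y → + 2 ℤ.* (x ℤ.* x ℤ.+ y ℤ.* y) ≡ (x ℤ.+ y) ℤ.* (x ℤ.+ y) ℤ.+ (x ℤ.- y) ℤ.* (x ℤ.- y)
    lemma₁ = ℤ-Ring.solve-∀
    lemma₂ : ∀ x y → (+ 2 ℤ.* x) ℤ.* (+ 2 ℤ.* x) ℤ.+ y ≡ + 4 ℤ.* (x ℤ.* x) ℤ.+ y
    lemma₂ = ℤ-Ring.solve-∀
  parallelogram : 2 * (norm u + norm v) ≡ 4 * norm h + norm diff
  parallelogram = begin-equality
    2 * (norm u + norm v)                           ≡⟨ cong (_*_ 2) (∑ℕ-+ (sq ∘ u) (sq ∘ v)) ⟨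
    2 * ∑ℕ (λ k → sq (u k) + sq (v k))              ≡⟨ ∑ℕ-const 2 (λ k → sq (u k) + sq (v k)) ⟨
    ∑ℕ (λ k → 2 * (sq (u k) + sq (v k)))            ≡⟨ ∑ℕ.sum-cong-≗ parallelogram₁ ⟩
    ∑ℕ (λ k → 4 * sq (h k) + sq (diff k))           ≡⟨ ∑ℕ-+ (λ k → 4 * sq (h k)) (sq ∘ diff) ⟩
    ∑ℕ (λ k → 4 * sq (h k)) + norm diff             ≡⟨ cong (_+ norm diff) (∑ℕ-const 4 (sq ∘ h)) ⟩
    4 * norm h + norm diff                          ∎
  diff>0 : 0 < norm diff
  diff>0 = ℕₚ.n≢0⇒n>0 (λ e → u≢v (λ k → ℤₚ.i-j≡0⇒i≡j (u k) (v k) (ℤₚ.∣i∣≡0⇒i≡0 (square≡0 (∑ℕ≡0 (sq ∘ diff) e k)))))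
    where
    square≡0 : ∀ {m} → m * m ≡ 0 → m ≡ 0
    square≡0 {zero} _ = refl

-- Operations on hulls

hull-mono : ∀ {n d} {X : Fin n → Fin d → ℤ} {S T v} → (∀ i → S i ≢ 0 → T i ≢ 0) → Hull X S v → Hull X T v
hull-mono S⊆T h = record { N = N ; N>0 = N>0 ; coef = coef ; supp = λ i ne → S⊆T i (supp i ne) ; total = total ; comb = comb }
  where open Hull h

hull-cong : ∀ {n d} {X : Fin n → Fin d → ℤ} {S u v} → (∀ k → u k ≡ v k) → Hull X S u → Hull X S v
hull-cong eq h = record { N = N ; N>0 = N>0 ; coef = coef ; supp = supp ; total = total
                        ; comb = λ k → trans (cong (ℤ._*_ (+ N)) (sym (eq k))) (comb k) }
  where open Hull h

hull-vertex : ∀ {n d} {X : Fin n → Fin d → ℤ} {S} i → S i ≢ 0 → Hull X S (X i)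
hull-vertex {X = X} {S} i Si = record
  { N = 1 ; N>0 = s≤s z≤n ; coef = δ i ; supp = supp ; total = ℕₚ.≤-reflexive (∑ℕ-δ i)
  ; comb = λ k → trans (ℤₚ.*-identityˡ (X i k)) (sym (Cb.pair-δ i (λ j → X j k))) }
  where
  supp : ∀ j → δ i j ≢ 0 → S j ≢ 0
  supp j ne with i Fin.≟ j
  ... | yes refl = Si
  ... | no i≢j = ⊥-elim (ne (δ-≢ i≢j))

midpoint-hull : ∀ {n d} {X : Fin n → Fin d → ℤ} {S u v h} → Hull X S u → Hull X S v →
  (∀ k → u k ℤ.+ v k ≡ + 2 ℤ.* h k) → Hull X S h
midpoint-hull {n} {X = X} {S} {u} {v} {h} hu hv mid = record
  { N = 2 * (U.N * V.N)
  ; N>0 = ℕₚ.*-mono-< {0} {2} (s≤s z≤n) (ℕₚ.*-mono-< U.N>0 V.N>0)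
  ; coef = c
  ; supp = supp
  ; total = total
  ; comb = comb
  }
  where
  module U = Hull hu
  module V = Hull hv
  c : Fin n → ℕ
  c i = V.N * U.coef i + U.N * V.coef i
  supp : ∀ i → c i ≢ 0 → S i ≢ 0
  supp i ne with U.coef i ℕₚ.≟ 0 | V.coef i ℕₚ.≟ 0
  ... | no ne′ | _      = U.supp i ne′
  ... | yes _  | no ne′ = V.supp i ne′
  ... | yes e  | yes e′ = ⊥-elim (ne (cong₂ _+_ (trans (cong (_*_ V.N) e) (ℕₚ.*-zeroʳ V.N)) (trans (cong (_*_ U.N) e′) (ℕₚ.*-zeroʳ U.N))))
  total : ∑ℕ c ≤ 2 * (U.N * V.N)
  total = begin
    ∑ℕ c                                         ≡⟨ ∑ℕ-+ (λ i → V.N * U.coef i) (λ i → U.N * V.coef i) ⟩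
    ∑ℕ (λ i → V.N * U.coef i) + ∑ℕ (λ i → U.N * V.coef i)
      ≡⟨ cong₂ _+_ (∑ℕ-const V.N U.coef) (∑ℕ-const U.N V.coef) ⟩
    V.N * ∑ℕ U.coef + U.N * ∑ℕ V.coef            ≤⟨ ℕₚ.+-mono-≤ (ℕₚ.*-monoʳ-≤ V.N U.total) (ℕₚ.*-monoʳ-≤ U.N V.total) ⟩
    V.N * U.N + U.N * V.N                        ≡⟨ lemma U.N V.N ⟩
    2 * (U.N * V.N)                              ∎
    where
    open ≤-Reasoning
    lemma : ∀ x y → y * x + x * y ≡ 2 * (x * y)
    lemma = ℕ-Ring.solve-∀
  comb : ∀ k → + (2 * (U.N * V.N)) ℤ.* h k ≡ ⟪ c , (λ i → X i k) ⟫
  comb k = begin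
    + (2 * (U.N * V.N)) ℤ.* h k                   ≡⟨ cong (ℤ._* h k) (trans (ℤₚ.pos-* 2 (U.N * V.N)) (cong (ℤ._*_ (+ 2)) (ℤₚ.pos-* U.N V.N))) ⟩
    + 2 ℤ.* (+ U.N ℤ.* + V.N) ℤ.* h k             ≡⟨ lemma₁ (+ U.N) (+ V.N) (h k) ⟩
    + U.N ℤ.* + V.N ℤ.* (+ 2 ℤ.* h k)             ≡⟨ cong (ℤ._*_ (+ U.N ℤ.* + V.N)) (mid k) ⟨
    + U.N ℤ.* + V.N ℤ.* (u k ℤ.+ v k)             ≡⟨ lemma₂ (+ U.N) (+ V.N) (u k) (v k) ⟩
    + V.N ℤ.* (+ U.N ℤ.* u k) ℤ.+ + U.N ℤ.* (+ V.N ℤ.* v k)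
      ≡⟨ cong₂ (λ p q → + V.N ℤ.* p ℤ.+ + U.N ℤ.* q) (U.comb k) (V.comb k) ⟩
    + V.N ℤ.* ⟪ U.coef , (λ i → X i k) ⟫ ℤ.+ + U.N ℤ.* ⟪ V.coef , (λ i → X i k) ⟫
      ≡⟨ cong₂ ℤ._+_ (Cb.pair-* V.N U.coef (λ i → X i k)) (Cb.pair-* U.N V.coef (λ i → X i k)) ⟨
    ⟪ (λ i → V.N * U.coef i) , (λ i → X i k) ⟫ ℤ.+ ⟪ (λ i → U.N * V.coef i) , (λ i → X i k) ⟫
      ≡⟨ Cb.pair-+ (λ i → V.N * U.coef i) (λ i → U.N * V.coef i) (λ i → X i k) ⟨
    ⟪ c , (λ i → X i k) ⟫ ∎
    where
    open ≡-Reasoning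
    lemma₁ : ∀ x y z → + 2 ℤ.* (x ℤ.* y) ℤ.* z ≡ x ℤ.* y ℤ.* (+ 2 ℤ.* z)
    lemma₁ = ℤ-Ring.solve-∀
    lemma₂ : ∀ x y u v → x ℤ.* y ℤ.* (u ℤ.+ v) ≡ y ℤ.* (x ℤ.* u) ℤ.+ x ℤ.* (y ℤ.* v)
    lemma₂ = ℤ-Ring.solve-∀

-- The two moves and their termination

All-points : ∀ {n} → Fin n → ℕ
All-points _ = 1

-- Instantiated with the nonzero lattice points of the polytope. Its convexity enters through
-- `closed`: an integral vector of the hull is 0 or one of the listed points.
module Descent {n d} (X : Fin n → Fin d → ℤ) (X-inj : ∀ i j → (∀ k → X i k ≡ X j k) → i ≡ j)
  (closed : ∀ r → Hull X All-points r → (∀ k → r k ≡ + 0) ⊎ ∃ λ i → ∀ k → X i k ≡ r k) where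

  col : Fin d → Fin n → ℤ
  col k i = X i k

  -- A lattice point of the hull as a multiplicity function: 0 is omitted.
  record Point (r : Fin d → ℤ) : Set where
    field
      ρ     : Fin n → ℕ
      ∑ρ≤1  : ∑ℕ ρ ≤ 1
      value : ∀ k → ⟪ ρ , col k ⟫ ≡ r k
      supp  : ∀ i → ρ i ≢ 0 → ∀ k → X i k ≡ r k

    weight≤ : ∀ (t : Fin n → ℕ) B → (∀ i → ρ i ≢ 0 → t i ≤ B) → ⟨ ρ , t ⟩ ≤ B
    weight≤ t B t≤B = begin
      ⟨ ρ , t ⟩              ≤⟨ ∑ℕ-mono term ⟩
      ∑ℕ (λ i → ρ i * B)     ≡⟨ ∑ℕ.*-distribʳ-sum B ρ ⟨
      ∑ℕ ρ * B               ≤⟨ ℕₚ.*-monoˡ-≤ B ∑ρ≤1 ⟩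
      1 * B                  ≡⟨ ℕₚ.*-identityˡ B ⟩
      B                      ∎
      where
      open ≤-Reasoning
      term : ∀ i → ρ i * t i ≤ ρ i * B
      term i with ρ i ℕₚ.≟ 0
      ... | yes e rewrite e = z≤n
      ... | no ne = ℕₚ.*-monoʳ-≤ (ρ i) (t≤B i ne)

  point : ∀ {S r} → Hull X S r → Point r
  point {r = r} h with closed r (hull-mono (λ _ _ ()) h)
  ... | inj₁ r≡0 = record
    { ρ = λ _ → 0 ; ∑ρ≤1 = subst (_≤ 1) (sym (∑ℕ.sum-replicate-zero n)) z≤n
    ; value = λ k → trans (Cb.pair-0 (col k)) (sym (r≡0 k)) ; supp = λ i ne → ⊥-elim (ne refl) }
  ... | inj₂ (m , Xm≡r) = record
    { ρ = δ m ; ∑ρ≤1 = ℕₚ.≤-reflexive (∑ℕ-δ m)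
    ; value = λ k → trans (Cb.pair-δ m (col k)) (Xm≡r k) ; supp = supp }
    where
    supp : ∀ i → δ m i ≢ 0 → ∀ k → X i k ≡ r k
    supp i ne with m Fin.≟ i
    ... | yes refl = Xm≡r
    ... | no m≢i = ⊥-elim (ne (δ-≢ m≢i))

  -- S marks the points whose multiplicity is not to be reduced.
  module Outside (S : Fin n → ℕ) where

    τ : Fin n → ℕ
    τ i = unsel (S i) 1

    τ≤1 : ∀ i → τ i ≤ 1
    τ≤1 i = unsel-≤ (S i) 1

    τ≡1 : ∀ i {x} → unsel (S i) x ≢ 0 → τ i ≡ 1
    τ≡1 i ne = cong (λ s → unsel s 1) (proj₁ (unsel-supp (S i) ne))

    -- The two measures are used lexicographically: a midpoint move lowers `energy` without raising
    -- `weight`, while a trade inside a simplex lowers `weight` and may do anything to `energy`.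
    weight energy : (Fin n → ℕ) → ℕ
    weight λ′ = ⟨ λ′ , τ ⟩
    energy λ′ = ⟨ λ′ , (λ i → τ i * norm (X i)) ⟩

    outside : (Fin n → ℕ) → Fin n → ℕ
    outside λ′ i = unsel (S i) (λ′ i)

    -- `Reg` is a region that the support must not leave: no restriction in the reduction to `2 ^ d`
    -- points, the simplex in the later descent.
    record Improved (Reg : Fin n → Set) (μ₀ μ : Fin n → ℕ) : Set where
      field
        value : ∀ k → ⟪ μ , col k ⟫ ≡ ⟪ μ₀ , col k ⟫
        reg   : ∀ i → μ i ≢ 0 → Reg i
        lighter : weight μ ≤ weight μ₀

    -- The midpoint may be 0 or a marked point and then does not count at all, so `weight` is only
    -- bounded and not preserved. The strict decrease of `energy` comes from `midpoint-norm`.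
    merge-at : ∀ (Reg : Fin n → Set) → (∀ i j q → Reg i → Reg j → (∀ k → X i k ℤ.+ X j k ≡ + 2 ℤ.* X q k) → Reg q) →
      ∀ μ → (∀ i → μ i ≢ 0 → Reg i) → ∀ i j → i ≢ j → outside μ i ≢ 0 → outside μ j ≢ 0 →
      ∀ h → (∀ k → X i k ℤ.+ X j k ≡ + 2 ℤ.* h k) → Point h →
      Σ (Fin n → ℕ) λ μ′ → Improved Reg μ μ′ × energy μ′ < energy μ
    merge-at Reg Reg-mid μ reg i j i≢j oi oj h mid P = μ′ ,
      record { value = value ; reg = reg′ ; lighter = lighter } , energy<
      where
      μi : μ i ≢ 0
      μi = proj₂ (unsel-supp (S i) oi)
      μj : μ j ≢ 0
      μj = proj₂ (unsel-supp (S j) oj)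
      open Point P using (ρ; weight≤) renaming (value to ρ-value; supp to ρ-supp)
      pair : Fin n → ℕ
      pair q = δ i q + δ j q
      pair≤ : ∀ q → pair q ≤ μ q
      pair≤ q with i Fin.≟ q | j Fin.≟ q
      ... | yes refl | yes refl = ⊥-elim (i≢j refl)
      ... | yes refl | no j≢q rewrite δ-refl i | δ-≢ j≢q = ℕₚ.n≢0⇒n>0 μi
      ... | no i≢q | yes refl rewrite δ-refl j | δ-≢ i≢q = ℕₚ.n≢0⇒n>0 μj
      ... | no i≢q | no j≢q rewrite δ-≢ i≢q | δ-≢ j≢q = z≤n
      μ′ : Fin n → ℕ
      μ′ q = (μ q ∸ pair q) + 2 * ρ q
      exchange : ∀ q → μ′ q + pair q ≡ μ q + 2 * ρ q
      exchange q = trans (lemma (μ q ∸ pair q) (2 * ρ q) (pair q)) (cong (_+ 2 * ρ q) (ℕₚ.m∸n+n≡m (pair≤ q)))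
        where
        lemma : ∀ x y z → x + y + z ≡ x + z + y
        lemma = ℕ-Ring.solve-∀
      weights : ∀ (t : Fin n → ℕ) → ⟨ μ′ , t ⟩ + (t i + t j) ≡ ⟨ μ , t ⟩ + 2 * ⟨ ρ , t ⟩
      weights t = begin
        ⟨ μ′ , t ⟩ + (t i + t j)        ≡⟨ cong (_+_ ⟨ μ′ , t ⟩) (trans (Wt.pair-+ (δ i) (δ j) t) (cong₂ _+_ (Wt.pair-δ i t) (Wt.pair-δ j t))) ⟨
        ⟨ μ′ , t ⟩ + ⟨ pair , t ⟩       ≡⟨ Wt.pair-exchange μ′ pair μ (λ q → 2 * ρ q) t exchange ⟩
        ⟨ μ , t ⟩ + ⟨ (λ q → 2 * ρ q) , t ⟩ ≡⟨ cong (_+_ ⟨ μ , t ⟩) (Wt.pair-* 2 ρ t) ⟩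
        ⟨ μ , t ⟩ + 2 * ⟨ ρ , t ⟩       ∎
        where open ≡-Reasoning
      value : ∀ k → ⟪ μ′ , col k ⟫ ≡ ⟪ μ , col k ⟫
      value k = ℤ-+-cancelʳ (X i k ℤ.+ X j k) (begin
        ⟪ μ′ , col k ⟫ ℤ.+ (X i k ℤ.+ X j k)
          ≡⟨ cong (ℤ._+_ ⟪ μ′ , col k ⟫) (trans (Cb.pair-+ (δ i) (δ j) (col k)) (cong₂ ℤ._+_ (Cb.pair-δ i (col k)) (Cb.pair-δ j (col k)))) ⟨
        ⟪ μ′ , col k ⟫ ℤ.+ ⟪ pair , col k ⟫
          ≡⟨ Cb.pair-exchange μ′ pair μ (λ q → 2 * ρ q) (col k) exchange ⟩
        ⟪ μ , col k ⟫ ℤ.+ ⟪ (λ q → 2 * ρ q) , col k ⟫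
          ≡⟨ cong (ℤ._+_ ⟪ μ , col k ⟫) (trans (Cb.pair-* 2 ρ (col k)) (trans (cong (ℤ._*_ (+ 2)) (ρ-value k)) (sym (mid k)))) ⟩
        ⟪ μ , col k ⟫ ℤ.+ (X i k ℤ.+ X j k) ∎)
        where open ≡-Reasoning
      reg′ : ∀ q → μ′ q ≢ 0 → Reg q
      reg′ q ne with μ q ℕₚ.≟ 0 | ρ q ℕₚ.≟ 0
      ... | no μq | _ = reg q μq
      ... | yes _ | no ρq = Reg-mid i j q (reg i μi) (reg j μj)
        (λ k → trans (mid k) (cong (ℤ._*_ (+ 2)) (sym (ρ-supp q ρq k))))
      ... | yes e | yes e′ = ⊥-elim (ne (cong₂ (λ x y → (x ∸ pair q) + 2 * y) e e′ ▸ ℕₚ.0∸n≡0 (pair q)))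
        where
        _▸_ : ∀ {x} → x ≡ (0 ∸ pair q) + 2 * 0 → 0 ∸ pair q ≡ 0 → x ≡ 0
        eq ▸ z = trans eq (trans (ℕₚ.+-identityʳ _) z)
      lighter : weight μ′ ≤ weight μ
      lighter = ℕₚ.+-cancelʳ-≤ 2 _ _ (begin
        weight μ′ + 2                   ≡⟨ cong (_+_ (weight μ′)) (cong₂ _+_ (sym (τ≡1 i oi)) (sym (τ≡1 j oj))) ⟩
        weight μ′ + (τ i + τ j)         ≡⟨ weights τ ⟩
        weight μ + 2 * ⟨ ρ , τ ⟩        ≤⟨ ℕₚ.+-monoʳ-≤ (weight μ) (ℕₚ.*-monoʳ-≤ 2 (weight≤ τ 1 (λ q _ → τ≤1 q))) ⟩
        weight μ + 2                    ∎)
        where open ≤-Reasoning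
      energy< : energy μ′ < energy μ
      energy< = ℕₚ.+-cancelʳ-< (norm (X i) + norm (X j)) _ _ (begin-strict
        energy μ′ + (norm (X i) + norm (X j))   ≡⟨ cong (_+_ (energy μ′)) (cong₂ _+_ (masked i oi) (masked j oj)) ⟩
        energy μ′ + (t i + t j)                 ≡⟨ weights t ⟩
        energy μ + 2 * ⟨ ρ , t ⟩                ≤⟨ ℕₚ.+-monoʳ-≤ (energy μ) (ℕₚ.*-monoʳ-≤ 2 (weight≤ t (norm h) t≤)) ⟩
        energy μ + 2 * norm h                   <⟨ ℕₚ.+-monoʳ-< (energy μ) (midpoint-norm (X i) (X j) h mid (i≢j ∘ X-inj i j)) ⟩
        energy μ + (norm (X i) + norm (X j))    ∎)
        where
        open ≤-Reasoning
        t : Fin n → ℕ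
        t q = τ q * norm (X q)
        masked : ∀ q {x} → unsel (S q) x ≢ 0 → norm (X q) ≡ t q
        masked q ne = sym (trans (cong (_* norm (X q)) (τ≡1 q ne)) (ℕₚ.*-identityˡ _))
        t≤ : ∀ q → ρ q ≢ 0 → t q ≤ norm h
        t≤ q ρq = ℕₚ.≤-trans (ℕₚ.*-monoˡ-≤ (norm (X q)) (τ≤1 q))
          (ℕₚ.≤-reflexive (trans (ℕₚ.*-identityˡ _) (norm-cong (ρ-supp q ρq))))

    merge : ∀ (Reg : Fin n → Set) → (∀ i j q → Reg i → Reg j → (∀ k → X i k ℤ.+ X j k ≡ + 2 ℤ.* X q k) → Reg q) →
      ∀ μ → (∀ i → μ i ≢ 0 → Reg i) → 2 ^ d < count (outside μ) →
      Σ (Fin n → ℕ) λ μ′ → Improved Reg μ μ′ × energy μ′ < energy μ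
    merge Reg Reg-mid μ reg lt with same-parity d X (outside μ) lt
    ... | i , j , i≢j , oi , oj , par = merge-at Reg Reg-mid μ reg i j i≢j oi oj h mid
      (point (midpoint-hull (hull-vertex {X = X} {All-points} i (λ ())) (hull-vertex j (λ ())) mid))
      where
      h : Fin d → ℤ
      h k = proj₁ (half-sum (X i k) (X j k) (par k))
      mid : ∀ k → X i k ℤ.+ X j k ≡ + 2 ℤ.* h k
      mid k = proj₂ (half-sum (X i k) (X j k) (par k))

    -- The argument of Eisenbrand and Shmonin.
    small-support : ∀ (Reg : Fin n → Set) → (∀ i j q → Reg i → Reg j → (∀ k → X i k ℤ.+ X j k ≡ + 2 ℤ.* X q k) → Reg q) →
      ∀ μ → (∀ i → μ i ≢ 0 → Reg i) → Σ (Fin n → ℕ) λ μ′ → Improved Reg μ μ′ × count (outside μ′) ≤ 2 ^ d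
    small-support Reg Reg-mid μ reg = go (suc (energy μ)) μ reg ℕₚ.≤-refl
      where
      Result : (Fin n → ℕ) → Set
      Result μ = Σ (Fin n → ℕ) λ μ′ → Improved Reg μ μ′ × count (outside μ′) ≤ 2 ^ d
      after : ∀ {μ μ₁} → Improved Reg μ μ₁ → Result μ₁ → Result μ
      after imp₁ (μ₂ , imp₂ , small) = μ₂ , record
        { value = λ k → trans (Improved.value imp₂ k) (Improved.value imp₁ k)
        ; reg = Improved.reg imp₂
        ; lighter = ℕₚ.≤-trans (Improved.lighter imp₂) (Improved.lighter imp₁) } , small
      go : ∀ fuel μ → (∀ i → μ i ≢ 0 → Reg i) → energy μ < fuel → Result μ
      step : ∀ fuel μ → (∀ i → μ i ≢ 0 → Reg i) → energy μ < suc fuel → Dec (2 ^ d < count (outside μ)) → Result μ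
      continue : ∀ fuel μ → energy μ < suc fuel →
        (Σ (Fin n → ℕ) λ μ′ → Improved Reg μ μ′ × energy μ′ < energy μ) → Result μ
      go (suc fuel) μ reg lt = step fuel μ reg lt (2 ^ d ℕₚ.<? count (outside μ))
      step fuel μ reg lt (no ¬lt) = μ , record { value = λ _ → refl ; reg = reg ; lighter = ℕₚ.≤-refl } , ℕₚ.≮⇒≥ ¬lt
      step fuel μ reg lt (yes big) = continue fuel μ lt (merge Reg Reg-mid μ reg big)
      continue fuel μ lt (μ₁ , imp₁ , lt₁) = after imp₁ (go fuel μ₁ (Improved.reg imp₁) (ℕₚ.<-≤-trans lt₁ (s≤s⁻¹ lt)))

  -- The simplex has the support of `a` and the origin as corners. A trade uses at most `suc cap`
  -- copies, so every multiplicity above `cap` has enough of them.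
  module Simplex (cap : ℕ)
    (small-remainder : ∀ {n} (a : Fin n → ℕ) N .{{_ : NonZero N}} → ∑ℕ a ≡ N → count a ≤ suc d → SmallRemainder a N (suc cap))
    (a : Fin n → ℕ) (count-a : count a ≤ d) where
    open Outside a

    Reg : Fin n → Set
    Reg q = Hull X a (X q)

    record Replaced (μ μ′ : Fin n → ℕ) : Set where
      field
        value   : ∀ k → ⟪ μ′ , col k ⟫ ≡ ⟪ μ , col k ⟫
        reg     : ∀ i → μ′ i ≢ 0 → Reg i
        lighter : weight μ′ < weight μ

    -- k X i is a combination of the X q with a q ≢ 0 plus a single lattice point of the simplex.
    module Replace (μ : Fin n → ℕ) (reg : ∀ i → μ i ≢ 0 → Reg i) (i : Fin n) (big : cap < outside μ i)
      (hull : Reg i) (rem : SmallRemainder ((Hull.N hull ∸ ∑ℕ (Hull.coef hull)) ▹ Hull.coef hull) (Hull.N hull) (suc cap)) where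

      open Hull hull using (N; N>0; total; comb) renaming (coef to c; supp to supp-c)
      open SmallRemainder rem renaming (total to ∑f≤N; g to g₀; f to f₀)
      instance
        N≢0 : NonZero N
        N≢0 = >-nonZero N>0
      oi : outside μ i ≢ 0
      oi e = ℕₚ.n≮0 (subst (cap <_) e big)
      f g : Fin n → ℕ
      f = f₀ ∘ suc
      g = g₀ ∘ suc
      k≤μi : k ≤ μ i
      k≤μi = ℕₚ.≤-trans k≤K (ℕₚ.≤-trans big (unsel-≤ (a i) (μ i)))
      supp-gf : ∀ q → g q * N + f q ≢ 0 → a q ≢ 0
      supp-gf q ne = supp-c q (proj₂ (*≢0 {k} (λ e → ne (trans (sym (split (suc q))) e))))
      supp-f : ∀ q → f q ≢ 0 → a q ≢ 0
      supp-f q ne = supp-gf q (λ e → ne (ℕₚ.m+n≡0⇒n≡0 (g q * N) e))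
      supp-g : ∀ q → g q ≢ 0 → a q ≢ 0
      supp-g q ne = supp-gf q (λ e → ne (ℕₚ.m*n≡0⇒m≡0 (g q) N (ℕₚ.m+n≡0⇒m≡0 (g q * N) e)))
      -- Integral as a difference of integral vectors, and in the simplex because `split` identifies
      -- it with the combination of the corners with weights `f / N`.
      r : Fin d → ℤ
      r κ = + k ℤ.* X i κ ℤ.- ⟪ g , col κ ⟫
      r-hull : Hull X a r
      r-hull = record
        { N = N ; N>0 = N>0 ; coef = f ; supp = supp-f
        ; total = ℕₚ.≤-trans (ℕₚ.m≤n+m _ (f₀ zero)) ∑f≤N
        ; comb = λ κ → begin
            + N ℤ.* r κ
              ≡⟨ lemma₁ (+ N) (+ k) (X i κ) ⟪ g , col κ ⟫ ⟩
            + k ℤ.* (+ N ℤ.* X i κ) ℤ.- + N ℤ.* ⟪ g , col κ ⟫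
              ≡⟨ cong (λ z → + k ℤ.* z ℤ.- + N ℤ.* ⟪ g , col κ ⟫) (comb κ) ⟩
            + k ℤ.* ⟪ c , col κ ⟫ ℤ.- + N ℤ.* ⟪ g , col κ ⟫
              ≡⟨ cong (ℤ._- + N ℤ.* ⟪ g , col κ ⟫) (trans (sym (Cb.pair-* k c (col κ))) (trans (Cb.pair-congˡ {y = col κ} (λ q → trans (split (suc q)) (cong (_+ f q) (ℕₚ.*-comm (g q) N)))) (trans (Cb.pair-+ (λ q → N * g q) f (col κ)) (cong (ℤ._+ ⟪ f , col κ ⟫) (Cb.pair-* N g (col κ)))))) ⟩
            (+ N ℤ.* ⟪ g , col κ ⟫ ℤ.+ ⟪ f , col κ ⟫) ℤ.- + N ℤ.* ⟪ g , col κ ⟫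
              ≡⟨ lemma₂ (+ N ℤ.* ⟪ g , col κ ⟫) ⟪ f , col κ ⟫ ⟩
            ⟪ f , col κ ⟫ ∎
        }
        where
        open ≡-Reasoning
        lemma₁ : ∀ N k x g → N ℤ.* (k ℤ.* x ℤ.- g) ≡ k ℤ.* (N ℤ.* x) ℤ.- N ℤ.* g
        lemma₁ = ℤ-Ring.solve-∀
        lemma₂ : ∀ x y → (x ℤ.+ y) ℤ.- x ≡ y
        lemma₂ = ℤ-Ring.solve-∀
      module At (P : Point r) where
        open Point P using (ρ; weight≤) renaming (value to ρ-value; supp to ρ-supp)
        kδ : Fin n → ℕ
        kδ q = k * δ i q
        kδ≤ : ∀ q → kδ q ≤ μ q
        kδ≤ q with i Fin.≟ q
        ... | yes refl rewrite δ-refl i = subst (_≤ μ i) (sym (ℕₚ.*-identityʳ k)) k≤μi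
        ... | no i≢q rewrite δ-≢ i≢q = subst (_≤ μ q) (sym (ℕₚ.*-zeroʳ k)) z≤n
        μ′ : Fin n → ℕ
        μ′ q = (μ q ∸ kδ q) + (g q + ρ q)
        exchange : ∀ q → μ′ q + kδ q ≡ μ q + (g q + ρ q)
        exchange q = trans (lemma (μ q ∸ kδ q) (g q + ρ q) (kδ q)) (cong (_+ (g q + ρ q)) (ℕₚ.m∸n+n≡m (kδ≤ q)))
          where
          lemma : ∀ x y z → x + y + z ≡ x + z + y
          lemma = ℕ-Ring.solve-∀
        value : ∀ κ → ⟪ μ′ , col κ ⟫ ≡ ⟪ μ , col κ ⟫
        value κ = ℤ-+-cancelʳ (+ k ℤ.* X i κ) (begin
          ⟪ μ′ , col κ ⟫ ℤ.+ + k ℤ.* X i κ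
            ≡⟨ cong (ℤ._+_ ⟪ μ′ , col κ ⟫) (trans (Cb.pair-* k (δ i) (col κ)) (cong (ℤ._*_ (+ k)) (Cb.pair-δ i (col κ)))) ⟨
          ⟪ μ′ , col κ ⟫ ℤ.+ ⟪ kδ , col κ ⟫
            ≡⟨ Cb.pair-exchange μ′ kδ μ (λ q → g q + ρ q) (col κ) exchange ⟩
          ⟪ μ , col κ ⟫ ℤ.+ ⟪ (λ q → g q + ρ q) , col κ ⟫
            ≡⟨ cong (ℤ._+_ ⟪ μ , col κ ⟫) (trans (Cb.pair-+ g ρ (col κ)) (trans (cong (ℤ._+_ ⟪ g , col κ ⟫) (ρ-value κ)) (lemma ⟪ g , col κ ⟫ (+ k ℤ.* X i κ)))) ⟩
          ⟪ μ , col κ ⟫ ℤ.+ + k ℤ.* X i κ ∎)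
          where
          open ≡-Reasoning
          lemma : ∀ x y → x ℤ.+ (y ℤ.- x) ≡ y
          lemma = ℤ-Ring.solve-∀
        reg′ : ∀ q → μ′ q ≢ 0 → Reg q
        reg′ q ne with μ q ℕₚ.≟ 0 | g q ℕₚ.≟ 0 | ρ q ℕₚ.≟ 0
        ... | no μq | _ | _ = reg q μq
        ... | yes _ | no gq | _ = hull-vertex q (supp-g q gq)
        ... | yes _ | yes _ | no ρq = hull-cong (λ κ → sym (ρ-supp q ρq κ)) r-hull
        ... | yes e | yes e′ | yes e″ = ⊥-elim (ne (trans (cong₂ (λ x y → (x ∸ kδ q) + y) e (cong₂ _+_ e′ e″))
          (trans (ℕₚ.+-identityʳ _) (ℕₚ.0∸n≡0 (kδ q)))))
        g-weight : ⟨ g , τ ⟩ ≡ 0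
        g-weight = trans (∑ℕ.sum-cong-≗ term) (∑ℕ.sum-replicate-zero n)
          where
          term : ∀ q → g q * τ q ≡ 0
          term q with g q ℕₚ.≟ 0 | a q ℕₚ.≟ 0
          ... | yes e | _ rewrite e = refl
          ... | no gq | yes aq = ⊥-elim (supp-g q gq aq)
          ... | no _  | no aq with a q
          ...   | zero  = ⊥-elim (aq refl)
          ...   | suc _ = ℕₚ.*-zeroʳ (g q)
        lighter : weight μ′ < weight μ
        lighter = ℕₚ.+-cancelʳ-≤ 1 _ _ (begin
          suc (weight μ′) + 1                       ≡⟨ lemma (weight μ′) ⟩
          weight μ′ + 2                             ≤⟨ ℕₚ.+-monoʳ-≤ (weight μ′) 2≤k ⟩
          weight μ′ + k
            ≡⟨ cong (_+_ (weight μ′)) (trans (Wt.pair-* k (δ i) τ) (trans (cong (_*_ k) (trans (Wt.pair-δ i τ) (τ≡1 i oi))) (ℕₚ.*-identityʳ k))) ⟨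
          weight μ′ + ⟨ kδ , τ ⟩                    ≡⟨ Wt.pair-exchange μ′ kδ μ (λ q → g q + ρ q) τ exchange ⟩
          weight μ + ⟨ (λ q → g q + ρ q) , τ ⟩      ≡⟨ cong (_+_ (weight μ)) (trans (Wt.pair-+ g ρ τ) (cong (_+ ⟨ ρ , τ ⟩) g-weight)) ⟩
          weight μ + ⟨ ρ , τ ⟩                      ≤⟨ ℕₚ.+-monoʳ-≤ (weight μ) (weight≤ τ 1 (λ q _ → τ≤1 q)) ⟩
          weight μ + 1                              ∎)
          where
          open ≤-Reasoning
          lemma : ∀ x → suc x + 1 ≡ x + 2
          lemma = ℕ-Ring.solve-∀

        replaced : Σ (Fin n → ℕ) (Replaced μ)
        replaced = μ′ , record { value = value ; reg = reg′ ; lighter = lighter }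

    -- The weight of the origin is prepended as one more coordinate. The coefficients then sum to
    -- exactly `N`, which makes the sum of the remainders a multiple of `N`; this is why the
    -- approximation works with `suc d` coordinates.
    replace : ∀ μ → (∀ i → μ i ≢ 0 → Reg i) → ∀ i → cap < outside μ i → Σ (Fin n → ℕ) (Replaced μ)
    replace μ reg i big = Replace.At.replaced μ reg i big hull
      (small-remainder (slack ▹ c) N {{>-nonZero N>0}} (ℕₚ.m∸n+n≡m total) count≤suc-d)
      (point (Replace.r-hull μ reg i big hull
        (small-remainder (slack ▹ c) N {{>-nonZero N>0}} (ℕₚ.m∸n+n≡m total) count≤suc-d)))
      where
      hull : Reg i
      hull = reg i (proj₂ (unsel-supp (a i) (λ e → ℕₚ.n≮0 (subst (cap <_) e big))))
      open Hull hull using (N; N>0; total) renaming (coef to c; supp to supp-c)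
      slack : ℕ
      slack = N ∸ ∑ℕ c
      count≤suc-d : count (slack ▹ c) ≤ suc d
      count≤suc-d = ℕₚ.+-mono-≤ (sgn≤ {slack} {1} (λ _ ())) (ℕₚ.≤-trans (count≤ {f = c} {g = a} supp-c) count-a)

    record Capped (μ₀ : Fin n → ℕ) : Set where
      field
        μ     : Fin n → ℕ
        value : ∀ k → ⟪ μ , col k ⟫ ≡ ⟪ μ₀ , col k ⟫
        reg   : ∀ i → μ i ≢ 0 → Reg i
        few   : count (outside μ) ≤ 2 ^ d
        small : ∀ i → outside μ i ≤ cap

    -- Midpoint moves are exhausted before every trade. They never raise `weight` and each trade
    -- lowers it, so `weight` is fuel for the alternation.
    capped : ∀ μ → (∀ i → μ i ≢ 0 → Reg i) → Capped μ
    capped μ reg = go (suc (weight μ)) μ reg ℕₚ.≤-refl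
      where
      after : ∀ {μ μ₁ μ₂} → Improved Reg μ μ₁ → Replaced μ₁ μ₂ → Capped μ₂ → Capped μ
      after imp rep c = record
        { μ = Capped.μ c
        ; value = λ k → trans (Capped.value c k) (trans (Replaced.value rep k) (Improved.value imp k))
        ; reg = Capped.reg c ; few = Capped.few c ; small = Capped.small c }
      go : ∀ fuel μ → (∀ i → μ i ≢ 0 → Reg i) → weight μ < fuel → Capped μ
      step : ∀ fuel μ → weight μ < suc fuel →
        (Σ (Fin n → ℕ) λ μ′ → Improved Reg μ μ′ × count (outside μ′) ≤ 2 ^ d) → Capped μ
      decide : ∀ fuel μ μ₁ → weight μ < suc fuel → Improved Reg μ μ₁ → count (outside μ₁) ≤ 2 ^ d →
        Dec (∃ λ i → cap < outside μ₁ i) → Capped μ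
      continue : ∀ fuel μ μ₁ → weight μ < suc fuel → Improved Reg μ μ₁ → Σ (Fin n → ℕ) (Replaced μ₁) → Capped μ
      go (suc fuel) μ reg lt = step fuel μ lt (small-support Reg (λ i j q ri rj mid → midpoint-hull ri rj mid) μ reg)
      step fuel μ lt (μ₁ , imp , few) = decide fuel μ μ₁ lt imp few (Finₚ.any? (λ i → cap ℕₚ.<? outside μ₁ i))
      decide fuel μ μ₁ lt imp few (no none) = record
        { μ = μ₁ ; value = Improved.value imp ; reg = Improved.reg imp ; few = few
        ; small = λ i → ℕₚ.≮⇒≥ (λ big → none (i , big)) }
      decide fuel μ μ₁ lt imp few (yes (i , big)) = continue fuel μ μ₁ lt imp (replace μ₁ (Improved.reg imp) i big)
      continue fuel μ μ₁ lt imp (μ₂ , rep) = after imp rep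
        (go fuel μ₂ (Replaced.reg rep) (ℕₚ.<-≤-trans (Replaced.lighter rep) (ℕₚ.≤-trans (Improved.lighter imp) (s≤s⁻¹ lt))))

-- Summing the decompositions of the single points

count-zero : ∀ {n} (f : Fin n → ℕ) → (∀ i → f i ≡ 0) → count f ≡ 0
count-zero {n} f z = ℕₚ.n≤0⇒n≡0 (ℕₚ.≤-trans (count≤ {f = f} {g = λ _ → 0} (λ i ne → ⊥-elim (ne (z i))))
  (ℕₚ.≤-reflexive (count-0 n)))

sel-0 : ∀ m → sel m 0 ≡ 0
sel-0 zero    = refl
sel-0 (suc m) = refl

unsel-0 : ∀ m → unsel m 0 ≡ 0
unsel-0 zero    = refl
unsel-0 (suc m) = refl

unsel-≡0 : ∀ {m} x → m ≡ 0 → unsel m x ≡ x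
unsel-≡0 x refl = refl

module Assembly {n d} (X : Fin n → Fin d → ℤ) (X-inj : ∀ i j → (∀ k → X i k ≡ X j k) → i ≡ j)
  (closed : ∀ r → Hull X All-points r → (∀ k → r k ≡ + 0) ⊎ ∃ λ i → ∀ k → X i k ≡ r k)
  (cap : ℕ)
  (small-remainder : ∀ {n} (a : Fin n → ℕ) N .{{_ : NonZero N}} → ∑ℕ a ≡ N → count a ≤ suc d → SmallRemainder a N (suc cap))
  (w : Fin n → ℕ) (spans : Spans X w) (extreme : ∀ p → w p ≢ 0 → ¬ Hull X (Others X p) (X p)) where

  open Descent X X-inj closed

  -- The decomposition of `ℓ` copies of `X j`. The factors `sgn ℓ` make an absent point cost
  -- nothing, so that a sum over all `j` is controlled by the size of the support.
  record Group (j : Fin n) (ℓ : ℕ) : Set where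
    field
      μ     : Fin n → ℕ
      value : ∀ k → ⟪ μ , col k ⟫ ≡ + ℓ ℤ.* X j k
      inner : count (λ i → sel (w i) (μ i)) ≤ d * sgn ℓ
      outer : count (λ i → unsel (w i) (μ i)) ≤ 2 ^ d * sgn ℓ
      small : ∀ i → unsel (w i) (μ i) ≤ cap * sgn ℓ
      nonvertex : ∀ i → unsel (w i) (μ i) ≢ 0 → Hull X (Others X i) (X i)

  module Nonempty (j : Fin n) (ℓ : ℕ) (h : Hull X w (X j)) (count-a : count (Hull.coef h) ≤ d) where
    open Hull h using () renaming (coef to a; supp to a⊆w)
    module Sx = Simplex cap small-remainder a count-a

    start : Fin n → ℕ
    start q = suc ℓ * δ j q

    start-reg : ∀ q → start q ≢ 0 → Sx.Reg q
    start-reg q ne with j Fin.≟ q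
    ... | yes refl = record { N = H.N ; N>0 = H.N>0 ; coef = a ; supp = λ _ ne → ne ; total = H.total ; comb = H.comb }
      where module H = Hull h
    ... | no j≢q = ⊥-elim (ne (trans (cong (_*_ (suc ℓ)) (δ-≢ j≢q)) (ℕₚ.*-zeroʳ (suc ℓ))))

    w0⇒a0 : ∀ i → w i ≡ 0 → a i ≡ 0
    w0⇒a0 i w0 with a i ℕₚ.≟ 0
    ... | yes a0 = a0
    ... | no a≢0 = ⊥-elim (a⊆w i a≢0 w0)

    -- A point of the simplex that is not a corner is represented by corners different from itself.
    others : ∀ q → a q ≡ 0 → Sx.Reg q → Hull X (Others X q) (X q)
    others q aq = hull-mono (λ i ai → subst (_≢ 0) (sym (∖-≢ All-points (q≢ i ai))) (λ ()))
      where
      q≢ : ∀ i → a i ≢ 0 → q ≢ i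
      q≢ i ai refl = ai aq

    module From (c : Sx.Capped start) where
      open Sx.Capped c

      -- An extreme point in the simplex has to be a corner, so no vertex outside the support of `a`
      -- occurs and at most `d` vertices remain.
      μ≢0⇒a≢0 : ∀ i → w i ≢ 0 → μ i ≢ 0 → a i ≢ 0
      μ≢0⇒a≢0 i wi μi ai = extreme i wi (others i ai (reg i μi))

      group : Group j (suc ℓ)
      group = record
        { μ = μ
        ; value = λ k → trans (value k) (trans (Cb.pair-* (suc ℓ) (δ j) (col k)) (cong (ℤ._*_ (+ suc ℓ)) (Cb.pair-δ j (col k))))
        ; inner = ℕₚ.≤-trans (count≤ {g = a} (λ i ne → μ≢0⇒a≢0 i (proj₁ (sel-supp (w i) ne)) (proj₂ (sel-supp (w i) ne))))
                    (ℕₚ.≤-trans count-a (ℕₚ.≤-reflexive (sym (ℕₚ.*-identityʳ d))))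
        ; outer = ℕₚ.≤-trans (count≤ {f = λ i → unsel (w i) (μ i)} {g = λ i → unsel (a i) (μ i)} outside≢0)
                    (ℕₚ.≤-trans few (ℕₚ.≤-reflexive (sym (ℕₚ.*-identityʳ (2 ^ d)))))
        ; small = λ i → ℕₚ.≤-trans (unsel-antitone (μ i) (w0⇒a0 i)) (ℕₚ.≤-trans (small i) (ℕₚ.≤-reflexive (sym (ℕₚ.*-identityʳ cap))))
        ; nonvertex = λ i ne → others i (w0⇒a0 i (proj₁ (unsel-supp (w i) ne))) (reg i (proj₂ (unsel-supp (w i) ne)))
        }
        where
        outside≢0 : ∀ i → unsel (w i) (μ i) ≢ 0 → unsel (a i) (μ i) ≢ 0
        outside≢0 i ne = subst (_≢ 0) (sym (unsel-≡0 (μ i) (w0⇒a0 i (proj₁ (unsel-supp (w i) ne))))) (proj₂ (unsel-supp (w i) ne))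

  group : ∀ j ℓ → Group j ℓ
  group j zero = record
    { μ = λ _ → 0
    ; value = λ k → trans (Cb.pair-0 (col k)) (sym (ℤₚ.*-zeroˡ (X j k)))
    ; inner = ℕₚ.≤-trans (ℕₚ.≤-reflexive (count-zero (λ i → sel (w i) 0) (λ i → sel-0 (w i)))) z≤n
    ; outer = ℕₚ.≤-trans (ℕₚ.≤-reflexive (count-zero (λ i → unsel (w i) 0) (λ i → unsel-0 (w i)))) z≤n
    ; small = λ i → ℕₚ.≤-trans (ℕₚ.≤-reflexive (unsel-0 (w i))) z≤n
    ; nonvertex = λ i ne → ⊥-elim (ne (unsel-0 (w i)))
    }
  group j (suc ℓ) = N.From.group (N.Sx.capped N.start N.start-reg)
    where module N = Nonempty j ℓ (proj₁ (carathéodory (spans⇒hull X spans j))) (proj₂ (carathéodory (spans⇒hull X spans j)))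

  record Decomposition (λ₀ : Fin n → ℕ) : Set where
    field
      Λ     : Fin n → ℕ
      value : ∀ k → ⟪ Λ , col k ⟫ ≡ ⟪ λ₀ , col k ⟫
      inner : count (λ i → sel (w i) (Λ i)) ≤ d * 2 ^ d
      outer : count (λ i → unsel (w i) (Λ i)) ≤ 2 ^ d * 2 ^ d
      small : ∀ i → unsel (w i) (Λ i) ≤ cap * 2 ^ d
      nonvertex : ∀ i → unsel (w i) (Λ i) ≢ 0 → Hull X (Others X i) (X i)

  module Sum (λ₁ : Fin n → ℕ) (few : count λ₁ ≤ 2 ^ d) (G : ∀ j → Group j (λ₁ j)) where
    open Group

    ∑sgn≤ : ∀ m → ∑ℕ (λ j → m * sgn (λ₁ j)) ≤ m * 2 ^ d
    ∑sgn≤ m = ℕₚ.≤-trans (ℕₚ.≤-reflexive (∑ℕ-const m (λ j → sgn (λ₁ j)))) (ℕₚ.*-monoʳ-≤ m few)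

    total : Fin n → ℕ
    total i = ∑ℕ (λ j → μ (G j) i)

    decomposition : Decomposition λ₁
    decomposition = record
      { Λ = total
      ; value = λ k → trans (sym (Cb.pair-∑ (λ j → μ (G j)) (col k))) (∑ℤ.sum-cong-≗ (λ j → value (G j) k))
      ; inner = begin
          count (λ i → sel (w i) (total i))
            ≡⟨ ∑ℕ.sum-cong-≗ (λ i → cong sgn (sel-∑ (w i) (λ j → μ (G j) i))) ⟩
          count (λ i → ∑ℕ (λ j → sel (w i) (μ (G j) i)))
            ≤⟨ count-∑ (λ j i → sel (w i) (μ (G j) i)) ⟩
          ∑ℕ (λ j → count (λ i → sel (w i) (μ (G j) i)))
            ≤⟨ ∑ℕ-mono (λ j → inner (G j)) ⟩
          ∑ℕ (λ j → d * sgn (λ₁ j))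
            ≤⟨ ∑sgn≤ d ⟩
          d * 2 ^ d ∎
      ; outer = begin
          count (λ i → unsel (w i) (total i))
            ≡⟨ ∑ℕ.sum-cong-≗ (λ i → cong sgn (unsel-∑ (w i) (λ j → μ (G j) i))) ⟩
          count (λ i → ∑ℕ (λ j → unsel (w i) (μ (G j) i)))
            ≤⟨ count-∑ (λ j i → unsel (w i) (μ (G j) i)) ⟩
          ∑ℕ (λ j → count (λ i → unsel (w i) (μ (G j) i)))
            ≤⟨ ∑ℕ-mono (λ j → outer (G j)) ⟩
          ∑ℕ (λ j → 2 ^ d * sgn (λ₁ j))
            ≤⟨ ∑sgn≤ (2 ^ d) ⟩
          2 ^ d * 2 ^ d ∎
      ; small = λ i → begin
          unsel (w i) (total i)                         ≡⟨ unsel-∑ (w i) (λ j → μ (G j) i) ⟩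
          ∑ℕ (λ j → unsel (w i) (μ (G j) i))            ≤⟨ ∑ℕ-mono (λ j → small (G j) i) ⟩
          ∑ℕ (λ j → cap * sgn (λ₁ j))                   ≤⟨ ∑sgn≤ cap ⟩
          cap * 2 ^ d                                   ∎
      ; nonvertex = nonvertex′
      }
      where
      open ≤-Reasoning
      nonvertex′ : ∀ i → unsel (w i) (total i) ≢ 0 → Hull X (Others X i) (X i)
      nonvertex′ i ne with ∑ℕ-≢0 (λ j → unsel (w i) (μ (G j) i)) (subst (_≢ 0) (unsel-∑ (w i) (λ j → μ (G j) i)) ne)
      ... | j , ne′ = nonvertex (G j) i ne′

  decompose : ∀ λ₀ → Decomposition λ₀
  decompose λ₀ = from (small-support (λ _ → ⊤) (λ _ _ _ _ _ _ → tt) λ₀ (λ _ _ → tt))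
    where
    -- Nothing is marked, so `outside` is the identity and the bound `2 ^ d` applies to the whole
    -- support.
    open Outside (λ _ → 0)
    from : (Σ (Fin n → ℕ) λ λ₁ → Improved (λ _ → ⊤) λ₀ λ₁ × count λ₁ ≤ 2 ^ d) → Decomposition λ₀
    from (λ₁ , imp , few) = record
      { Λ = D.Λ ; value = λ k → trans (D.value k) (Improved.value imp k) ; inner = D.inner ; outer = D.outer
      ; small = D.small ; nonvertex = D.nonvertex }
      where module D = Decomposition (Sum.decomposition λ₁ few (λ j → group j (λ₁ j)))

-- Rational combinations

toℚᵘ-toℚ : ∀ z → ℚ.toℚᵘ (toℚ z) ℚᵘ.≃ mkℚᵘ z 0
toℚᵘ-toℚ z = ℚₚ.toℚᵘ-fromℚᵘ (mkℚᵘ z 0)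

toℚ-+ : ∀ a b → toℚ (a ℤ.+ b) ≡ toℚ a ℚ.+ toℚ b
toℚ-+ a b = ℚₚ.toℚᵘ-injective (begin
  ℚ.toℚᵘ (toℚ (a ℤ.+ b))                  ≈⟨ toℚᵘ-toℚ (a ℤ.+ b) ⟩
  mkℚᵘ (a ℤ.+ b) 0                        ≈⟨ *≡* (lemma a b) ⟩
  mkℚᵘ a 0 ℚᵘ.+ mkℚᵘ b 0                  ≈⟨ ℚᵘₚ.+-cong (toℚᵘ-toℚ a) (toℚᵘ-toℚ b) ⟨
  ℚ.toℚᵘ (toℚ a) ℚᵘ.+ ℚ.toℚᵘ (toℚ b)      ≈⟨ ℚₚ.toℚᵘ-homo-+ (toℚ a) (toℚ b) ⟨
  ℚ.toℚᵘ (toℚ a ℚ.+ toℚ b)                ∎)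
  where
  open ℚᵘₚ.≃-Reasoning
  lemma : ∀ a b → (a ℤ.+ b) ℤ.* + 1 ≡ (a ℤ.* + 1 ℤ.+ b ℤ.* + 1) ℤ.* + 1
  lemma = ℤ-Ring.solve-∀

toℚ-* : ∀ a b → toℚ (a ℤ.* b) ≡ toℚ a ℚ.* toℚ b
toℚ-* a b = ℚₚ.toℚᵘ-injective (begin
  ℚ.toℚᵘ (toℚ (a ℤ.* b))                  ≈⟨ toℚᵘ-toℚ (a ℤ.* b) ⟩
  mkℚᵘ a 0 ℚᵘ.* mkℚᵘ b 0                  ≈⟨ ℚᵘₚ.*-cong (toℚᵘ-toℚ a) (toℚᵘ-toℚ b) ⟨
  ℚ.toℚᵘ (toℚ a) ℚᵘ.* ℚ.toℚᵘ (toℚ b)      ≈⟨ ℚₚ.toℚᵘ-homo-* (toℚ a) (toℚ b) ⟨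
  ℚ.toℚᵘ (toℚ a ℚ.* toℚ b)                ∎)
  where open ℚᵘₚ.≃-Reasoning

toℚ-mono : ∀ {a b} → a ℤ.≤ b → toℚ a ℚ.≤ toℚ b
toℚ-mono {a} {b} le = ℚₚ.toℚᵘ-cancel-≤ (ℚᵘₚ.≤-respˡ-≃ (ℚᵘₚ.≃-sym (toℚᵘ-toℚ a)) (ℚᵘₚ.≤-respʳ-≃ (ℚᵘₚ.≃-sym (toℚᵘ-toℚ b))
  (*≤* (ℤₚ.*-monoʳ-≤-nonNeg (+ 1) le))))

toℚ-cancel : ∀ {a b} → toℚ a ℚ.≤ toℚ b → a ℤ.≤ b
toℚ-cancel {a} {b} le with ℚᵘₚ.≤-respˡ-≃ (toℚᵘ-toℚ a) (ℚᵘₚ.≤-respʳ-≃ (toℚᵘ-toℚ b) (ℚₚ.toℚᵘ-mono-≤ le))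
... | *≤* le′ = subst₂ ℤ._≤_ (ℤₚ.*-identityʳ a) (ℤₚ.*-identityʳ b) le′

toℚ-injective : ∀ {a b} → toℚ a ≡ toℚ b → a ≡ b
toℚ-injective e = ℤₚ.≤-antisym (toℚ-cancel (ℚₚ.≤-reflexive e)) (toℚ-cancel (ℚₚ.≤-reflexive (sym e)))

numerator : ∀ q → toℚ (ℚ.↧ q) ℚ.* q ≡ toℚ (ℚ.↥ q)
numerator q@(ℚ.mkℚ n d-1 _) = ℚₚ.toℚᵘ-injective (begin
  ℚ.toℚᵘ (toℚ (ℚ.↧ q) ℚ.* q)                 ≈⟨ ℚₚ.toℚᵘ-homo-* (toℚ (ℚ.↧ q)) q ⟩
  ℚ.toℚᵘ (toℚ (ℚ.↧ q)) ℚᵘ.* mkℚᵘ n d-1       ≈⟨ ℚᵘₚ.*-congʳ (toℚᵘ-toℚ (ℚ.↧ q)) ⟩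
  mkℚᵘ (ℚ.↧ q) 0 ℚᵘ.* mkℚᵘ n d-1             ≈⟨ *≡* (trans (lemma (ℚ.↧ q) n) (cong (λ z → n ℤ.* + suc z) (sym (ℕₚ.+-identityʳ d-1)))) ⟩
  mkℚᵘ n 0                                   ≈⟨ toℚᵘ-toℚ n ⟨
  ℚ.toℚᵘ (toℚ n)                             ∎)
  where
  open ℚᵘₚ.≃-Reasoning
  lemma : ∀ d n → d ℤ.* n ℤ.* + 1 ≡ n ℤ.* d
  lemma = ℤ-Ring.solve-∀

numerator-nonNeg : ∀ q → 0ℚ ℚ.≤ q → + 0 ℤ.≤ ℚ.↥ q
numerator-nonNeg q@(ℚ.mkℚ n _ _) q≥0 = ℤₚ.nonNegative⁻¹ n {{ℚ.nonNegative q≥0}}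

reciprocal : ∀ N → 0 < N → Σ ℚ λ q → 0ℚ ℚ.≤ q × toℚ (+ N) ℚ.* q ≡ 1ℚ
reciprocal (suc N) _ = + 1 ℚ./ suc N , ℚₚ.nonNegative⁻¹ _ {{ℚₚ.normalize-nonNeg 1 (suc N)}} , ℚₚ.toℚᵘ-injective (begin
  ℚ.toℚᵘ (toℚ (+ suc N) ℚ.* (+ 1 ℚ./ suc N))                ≈⟨ ℚₚ.toℚᵘ-homo-* (toℚ (+ suc N)) (+ 1 ℚ./ suc N) ⟩
  ℚ.toℚᵘ (toℚ (+ suc N)) ℚᵘ.* ℚ.toℚᵘ (+ 1 ℚ./ suc N)        ≈⟨ ℚᵘₚ.*-cong (toℚᵘ-toℚ (+ suc N)) (ℚₚ.toℚᵘ-fromℚᵘ (mkℚᵘ (+ 1) N)) ⟩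
  mkℚᵘ (+ suc N) 0 ℚᵘ.* mkℚᵘ (+ 1) N                        ≈⟨ *≡* (trans (lemma (+ suc N)) (cong (λ z → + 1 ℤ.* + suc z) (sym (ℕₚ.+-identityʳ N)))) ⟩
  ℚᵘ.1ℚᵘ                                                    ∎)
  where
  open ℚᵘₚ.≃-Reasoning
  lemma : ∀ n → n ℤ.* + 1 ℤ.* + 1 ≡ + 1 ℤ.* n
  lemma = ℤ-Ring.solve-∀

dotℚ-toℚ : ∀ {d} (a x : Vec ℤ d) → dotℚ (toℚVec a) (toℚVec x) ≡ toℚ (dotℤ a x)
dotℚ-toℚ []       []       = refl
dotℚ-toℚ (a ∷ as) (x ∷ xs) = trans (cong₂ ℚ._+_ (sym (toℚ-* a x)) (dotℚ-toℚ as xs)) (sym (toℚ-+ (a ℤ.* x) (dotℤ as xs)))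

dotℤ-∙ : ∀ {d} (a x : Vec ℤ d) → dotℤ a x ≡ lookup a ∙ lookup x
dotℤ-∙ []       []       = refl
dotℤ-∙ (a ∷ as) (x ∷ xs) = cong (ℤ._+_ (a ℤ.* x)) (dotℤ-∙ as xs)

lookup-combℚ : ∀ {d} p q (L : List (Vec ℤ d × ℚ)) k →
  lookup (combℚ ((p , q) ∷ L)) k ≡ q ℚ.* toℚ (lookup p k) ℚ.+ lookup (combℚ L) k
lookup-combℚ p q L k = trans (Vecₚ.lookup-zipWith ℚ._+_ k (q ·ℚv toℚVec p) (combℚ L))
  (cong (ℚ._+ lookup (combℚ L) k) (trans (Vecₚ.lookup-map k (ℚ._*_ q) (toℚVec p)) (cong (ℚ._*_ q) (Vecₚ.lookup-map k toℚ p))))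

lookup-combℤ : ∀ {d} p m (L : List (Vec ℤ d × ℕ)) k →
  lookup (combℤ ((p , m) ∷ L)) k ≡ + m ℤ.* lookup p k ℤ.+ lookup (combℤ L) k
lookup-combℤ p m L k = trans (Vecₚ.lookup-zipWith ℤ._+_ k (m ·ℤv p) (combℤ L))
  (cong (ℤ._+ lookup (combℤ L) k) (Vecₚ.lookup-map k (λ z → + m ℤ.* z) p))

weighted : ∀ {n d} → (Fin n → Vec ℤ d) → (Fin n → ℕ) → ℚ → List (Vec ℤ d × ℚ)
weighted p c q = List.tabulate (λ i → p i , toℚ (+ c i) ℚ.* q)

sumℚ-weighted : ∀ {n d} (p : Fin n → Vec ℤ d) c q → sumℚ (weighted p c q) ≡ toℚ (+ ∑ℕ c) ℚ.* q
sumℚ-weighted {zero}  p c q = sym (ℚₚ.*-zeroˡ q)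
sumℚ-weighted {suc n} p c q = begin
  toℚ (+ c zero) ℚ.* q ℚ.+ sumℚ (weighted (p ∘ suc) (c ∘ suc) q)    ≡⟨ cong (ℚ._+_ (toℚ (+ c zero) ℚ.* q)) (sumℚ-weighted (p ∘ suc) (c ∘ suc) q) ⟩
  toℚ (+ c zero) ℚ.* q ℚ.+ toℚ (+ ∑ℕ (c ∘ suc)) ℚ.* q               ≡⟨ ℚₚ.*-distribʳ-+ q (toℚ (+ c zero)) (toℚ (+ ∑ℕ (c ∘ suc))) ⟨
  (toℚ (+ c zero) ℚ.+ toℚ (+ ∑ℕ (c ∘ suc))) ℚ.* q                   ≡⟨ cong (ℚ._* q) (toℚ-+ (+ c zero) (+ ∑ℕ (c ∘ suc))) ⟨
  toℚ (+ ∑ℕ c) ℚ.* q                                                ∎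
  where open ≡-Reasoning

combℚ-weighted : ∀ {n d} (p : Fin n → Vec ℤ d) c q k →
  lookup (combℚ (weighted p c q)) k ≡ toℚ ⟪ c , (λ i → lookup (p i) k) ⟫ ℚ.* q
combℚ-weighted {zero}  p c q k = trans (Vecₚ.lookup-replicate k 0ℚ) (sym (ℚₚ.*-zeroˡ q))
combℚ-weighted {suc n} p c q k = begin
  lookup (combℚ (weighted p c q)) k
    ≡⟨ lookup-combℚ (p zero) (toℚ (+ c zero) ℚ.* q) (weighted (p ∘ suc) (c ∘ suc) q) k ⟩
  toℚ (+ c zero) ℚ.* q ℚ.* toℚ x ℚ.+ lookup (combℚ (weighted (p ∘ suc) (c ∘ suc) q)) k
    ≡⟨ cong (ℚ._+_ (toℚ (+ c zero) ℚ.* q ℚ.* toℚ x)) (combℚ-weighted (p ∘ suc) (c ∘ suc) q k) ⟩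
  toℚ (+ c zero) ℚ.* q ℚ.* toℚ x ℚ.+ toℚ y ℚ.* q
    ≡⟨ lemma (toℚ (+ c zero)) q (toℚ x) (toℚ y) ⟩
  (toℚ (+ c zero) ℚ.* toℚ x ℚ.+ toℚ y) ℚ.* q
    ≡⟨ cong (λ z → (z ℚ.+ toℚ y) ℚ.* q) (toℚ-* (+ c zero) x) ⟨
  (toℚ (+ c zero ℤ.* x) ℚ.+ toℚ y) ℚ.* q
    ≡⟨ cong (ℚ._* q) (toℚ-+ (+ c zero ℤ.* x) y) ⟨
  toℚ ⟪ c , (λ i → lookup (p i) k) ⟫ ℚ.* q ∎
  where
  open ≡-Reasoning
  x y : ℤ
  x = lookup (p zero) k
  y = ⟪ c ∘ suc , (λ i → lookup (p (suc i)) k) ⟫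
  lemma : ∀ a q x y → a ℚ.* q ℚ.* x ℚ.+ y ℚ.* q ≡ (a ℚ.* x ℚ.+ y) ℚ.* q
  lemma = solve 4 (λ a q x y → a :* q :* x :+ y :* q := (a :* x :+ y) :* q) refl
    where open ℚ-Solver.+-*-Solver

-- ι stands for toℚ, kept abstract so that it does not unfold.
module Denominators (ι : ℤ → ℚ) (ι-0 : ι (+ 0) ≡ 0ℚ)
  (ι-+ : ∀ a b → ι (a ℤ.+ b) ≡ ι a ℚ.+ ι b) (ι-* : ∀ a b → ι (a ℤ.* b) ≡ ι a ℚ.* ι b)
  (ι-mono : ∀ {a b} → a ℤ.≤ b → ι a ℚ.≤ ι b)
  (ι-numerator : ∀ q → ι (ℚ.↧ q) ℚ.* q ≡ ι (ℚ.↥ q))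
  (ι-comb : ∀ {d} p q (L : List (Vec ℤ d × ℚ)) k → lookup (combℚ ((p , q) ∷ L)) k ≡ q ℚ.* ι (lookup p k) ℚ.+ lookup (combℚ L) k)
  {n d} (p : Fin n → Vec ℤ d) (S : Fin n → ℕ) where

  col : Fin d → Fin n → ℤ
  col k i = lookup (p i) k

  -- A multiplicity function worth v; the empty one stands for the point 0.
  record Unit (v : Vec ℤ d) : Set where
    field
      ρ     : Fin n → ℕ
      total : ∑ℕ ρ ≤ 1
      supp  : ∀ i → ρ i ≢ 0 → S i ≢ 0
      value : ∀ k → ⟪ ρ , col k ⟫ ≡ lookup v k

  -- The total is only bounded above: entries of `L` at the origin add to `sumℚ L` but receive no
  -- coefficient.
  record Cleared (L : List (Vec ℤ d × ℚ)) : Set where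
    field
      N     : ℕ
      N>0   : 0 < N
      c     : Fin n → ℕ
      supp  : ∀ i → c i ≢ 0 → S i ≢ 0
      total : ι (+ ∑ℕ c) ℚ.≤ ι (+ N) ℚ.* sumℚ L
      comb  : ∀ k → ι (+ N) ℚ.* lookup (combℚ L) k ≡ ι ⟪ c , col k ⟫

  -- With `q` equal to `m / D`, the old coefficients are scaled by `D` and the new point receives
  -- `N * m`, over the denominator `D * N`.
  extend : ∀ {v q L} D m → 0 < D → ι (+ D) ℚ.* q ≡ ι (+ m) → Unit v → Cleared L → Cleared ((v , q) ∷ L)
  extend {v} {q} {L} D m D>0 Dq u cl = record
    { N = D * N ; N>0 = ℕₚ.*-mono-< D>0 N>0 ; c = c′ ; supp = supp′ ; total = total′ ; comb = comb′ }
    where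
    open Cleared cl
    open Unit u using (ρ) renaming (total to ∑ρ≤1; supp to ρ-supp; value to ρ-value)
    c′ : Fin n → ℕ
    c′ i = D * c i + N * m * ρ i
    scale : ∀ s → ι (+ (D * N)) ℚ.* (q ℚ.+ s) ≡ ι (+ D) ℚ.* (ι (+ N) ℚ.* s) ℚ.+ ι (+ (N * m))
    scale s = begin
      ι (+ (D * N)) ℚ.* (q ℚ.+ s)
        ≡⟨ cong (ℚ._* (q ℚ.+ s)) (trans (cong ι (ℤₚ.pos-* D N)) (ι-* (+ D) (+ N))) ⟩
      ι (+ D) ℚ.* ι (+ N) ℚ.* (q ℚ.+ s)
        ≡⟨ lemma (ι (+ D)) (ι (+ N)) q s ⟩
      ι (+ D) ℚ.* (ι (+ N) ℚ.* s) ℚ.+ ι (+ N) ℚ.* (ι (+ D) ℚ.* q)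
        ≡⟨ cong (λ z → ι (+ D) ℚ.* (ι (+ N) ℚ.* s) ℚ.+ ι (+ N) ℚ.* z) Dq ⟩
      ι (+ D) ℚ.* (ι (+ N) ℚ.* s) ℚ.+ ι (+ N) ℚ.* ι (+ m)
        ≡⟨ cong (ℚ._+_ (ι (+ D) ℚ.* (ι (+ N) ℚ.* s))) (trans (cong ι (ℤₚ.pos-* N m)) (ι-* (+ N) (+ m))) ⟨
      ι (+ D) ℚ.* (ι (+ N) ℚ.* s) ℚ.+ ι (+ (N * m)) ∎
      where
      open ≡-Reasoning
      lemma : ∀ D N q s → D ℚ.* N ℚ.* (q ℚ.+ s) ≡ D ℚ.* (N ℚ.* s) ℚ.+ N ℚ.* (D ℚ.* q)
      lemma = solve 4 (λ D N q s → D :* N :* (q :+ s) := D :* (N :* s) :+ N :* (D :* q)) refl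
        where open ℚ-Solver.+-*-Solver
    supp′ : ∀ i → c′ i ≢ 0 → S i ≢ 0
    supp′ i ne with c i ℕₚ.≟ 0 | ρ i ℕₚ.≟ 0
    ... | no ci | _     = supp i ci
    ... | yes _ | no ρi = ρ-supp i ρi
    ... | yes e | yes e′ = ⊥-elim (ne (cong₂ _+_ (trans (cong (_*_ D) e) (ℕₚ.*-zeroʳ D)) (trans (cong (_*_ (N * m)) e′) (ℕₚ.*-zeroʳ (N * m)))))
    ∑c′ : ∑ℕ c′ ≤ D * ∑ℕ c + N * m
    ∑c′ = begin
      ∑ℕ c′                                  ≡⟨ ∑ℕ-+ (λ i → D * c i) (λ i → N * m * ρ i) ⟩
      ∑ℕ (λ i → D * c i) + ∑ℕ (λ i → N * m * ρ i)
        ≡⟨ cong₂ _+_ (∑ℕ-const D c) (∑ℕ-const (N * m) ρ) ⟩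
      D * ∑ℕ c + N * m * ∑ℕ ρ                ≤⟨ ℕₚ.+-monoʳ-≤ (D * ∑ℕ c) (ℕₚ.*-monoʳ-≤ (N * m) ∑ρ≤1) ⟩
      D * ∑ℕ c + N * m * 1                   ≡⟨ cong (_+_ (D * ∑ℕ c)) (ℕₚ.*-identityʳ (N * m)) ⟩
      D * ∑ℕ c + N * m                       ∎
      where open ≤-Reasoning
    0≤ιD : 0ℚ ℚ.≤ ι (+ D)
    0≤ιD = subst (ℚ._≤ ι (+ D)) ι-0 (ι-mono (ℤ.+≤+ z≤n))
    total′ : ι (+ ∑ℕ c′) ℚ.≤ ι (+ (D * N)) ℚ.* (q ℚ.+ sumℚ L)
    total′ = begin
      ι (+ ∑ℕ c′)                                          ≤⟨ ι-mono (ℤ.+≤+ ∑c′) ⟩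
      ι (+ (D * ∑ℕ c + N * m))                             ≡⟨ ι-+ (+ (D * ∑ℕ c)) (+ (N * m)) ⟩
      ι (+ (D * ∑ℕ c)) ℚ.+ ι (+ (N * m))                 ≡⟨ cong (ℚ._+ ι (+ (N * m))) (trans (cong ι (ℤₚ.pos-* D (∑ℕ c))) (ι-* (+ D) (+ ∑ℕ c))) ⟩
      ι (+ D) ℚ.* ι (+ ∑ℕ c) ℚ.+ ι (+ (N * m))         ≤⟨ ℚₚ.+-monoˡ-≤ (ι (+ (N * m))) (ℚₚ.*-monoˡ-≤-nonNeg (ι (+ D)) {{ℚ.nonNegative 0≤ιD}} total) ⟩
      ι (+ D) ℚ.* (ι (+ N) ℚ.* sumℚ L) ℚ.+ ι (+ (N * m)) ≡⟨ scale (sumℚ L) ⟨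
      ι (+ (D * N)) ℚ.* (q ℚ.+ sumℚ L)                     ∎
      where open ℚₚ.≤-Reasoning
    comb′ : ∀ k → ι (+ (D * N)) ℚ.* lookup (combℚ ((v , q) ∷ L)) k ≡ ι ⟪ c′ , col k ⟫
    comb′ k = begin
      ι (+ (D * N)) ℚ.* lookup (combℚ ((v , q) ∷ L)) k
        ≡⟨ cong₂ ℚ._*_ (trans (cong ι (ℤₚ.pos-* D N)) (ι-* (+ D) (+ N))) (ι-comb v q L k) ⟩
      ι (+ D) ℚ.* ι (+ N) ℚ.* (q ℚ.* x ℚ.+ lookup (combℚ L) k)
        ≡⟨ lemma (ι (+ D)) (ι (+ N)) q x (lookup (combℚ L) k) ⟩
      ι (+ D) ℚ.* (ι (+ N) ℚ.* lookup (combℚ L) k) ℚ.+ ι (+ N) ℚ.* (ι (+ D) ℚ.* q) ℚ.* x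
        ≡⟨ cong₂ (λ y z → ι (+ D) ℚ.* y ℚ.+ ι (+ N) ℚ.* z ℚ.* x) (comb k) Dq ⟩
      ι (+ D) ℚ.* ι ⟪ c , col k ⟫ ℚ.+ ι (+ N) ℚ.* ι (+ m) ℚ.* x
        ≡⟨ cong₂ (λ y z → y ℚ.+ z ℚ.* x) (sym (ι-* (+ D) ⟪ c , col k ⟫)) (trans (sym (ι-* (+ N) (+ m))) (cong ι (sym (ℤₚ.pos-* N m)))) ⟩
      ι (+ D ℤ.* ⟪ c , col k ⟫) ℚ.+ ι (+ (N * m)) ℚ.* x
        ≡⟨ cong (ℚ._+_ (ι (+ D ℤ.* ⟪ c , col k ⟫))) (sym (ι-* (+ (N * m)) (lookup v k))) ⟩
      ι (+ D ℤ.* ⟪ c , col k ⟫) ℚ.+ ι (+ (N * m) ℤ.* lookup v k)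
        ≡⟨ ι-+ (+ D ℤ.* ⟪ c , col k ⟫) (+ (N * m) ℤ.* lookup v k) ⟨
      ι (+ D ℤ.* ⟪ c , col k ⟫ ℤ.+ + (N * m) ℤ.* lookup v k)
        ≡⟨ cong ι (cong₂ ℤ._+_ (sym (Cb.pair-* D c (col k))) (trans (cong (ℤ._*_ (+ (N * m))) (sym (ρ-value k))) (sym (Cb.pair-* (N * m) ρ (col k))))) ⟩
      ι (⟪ (λ i → D * c i) , col k ⟫ ℤ.+ ⟪ (λ i → N * m * ρ i) , col k ⟫)
        ≡⟨ cong ι (Cb.pair-+ (λ i → D * c i) (λ i → N * m * ρ i) (col k)) ⟨
      ι ⟪ c′ , col k ⟫ ∎
      where
      open ≡-Reasoning
      x : ℚ
      x = ι (lookup v k)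
      lemma : ∀ D N q x y → D ℚ.* N ℚ.* (q ℚ.* x ℚ.+ y) ≡ D ℚ.* (N ℚ.* y) ℚ.+ N ℚ.* (D ℚ.* q) ℚ.* x
      lemma = solve 5 (λ D N q x y → D :* N :* (q :* x :+ y) := D :* (N :* y) :+ N :* (D :* q) :* x) refl
        where open ℚ-Solver.+-*-Solver

  clear : ∀ L → All (λ e → Unit (proj₁ e) × 0ℚ ℚ.≤ proj₂ e) L → Cleared L
  clear [] [] = record
    { N = 1 ; N>0 = s≤s z≤n ; c = λ _ → 0 ; supp = λ i ne → ⊥-elim (ne refl)
    ; total = ℚₚ.≤-reflexive (trans (cong (λ z → ι (+ z)) (∑ℕ.sum-replicate-zero n)) (trans ι-0 (sym (ℚₚ.*-zeroʳ (ι (+ 1))))))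
    ; comb = λ k → trans (cong (ℚ._*_ (ι (+ 1))) (Vecₚ.lookup-replicate k 0ℚ))
        (trans (ℚₚ.*-zeroʳ (ι (+ 1))) (sym (trans (cong ι (Cb.pair-0 (col k))) ι-0)))
    }
  clear ((v , q) ∷ L) ((u , q≥0) ∷ all) =
    extend (ℚ.↧ₙ q) ℤ.∣ ℚ.↥ q ∣ (s≤s z≤n)
      (trans (ι-numerator q) (cong ι (sym (ℤₚ.0≤i⇒+∣i∣≡i (numerator-nonNeg q q≥0))))) u (clear L all)

-- The doubly exponential bound

1+n≤2^n : ∀ n → suc n ≤ 2 ^ n
1+n≤2^n zero    = s≤s z≤n
1+n≤2^n (suc n) = begin
  suc (suc n)           ≤⟨ ℕₚ.+-mono-≤ (ℕₚ.≤-trans (s≤s z≤n) (1+n≤2^n n)) (1+n≤2^n n) ⟩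
  2 ^ n + 2 ^ n         ≡⟨ cong (_+_ (2 ^ n)) (ℕₚ.+-identityʳ (2 ^ n)) ⟨
  2 ^ suc n             ∎
  where open ≤-Reasoning

-- The factor `2 ^ d` is the number of groups whose multiplicities can add up at one point. Writing
-- the base as a power of 2 gives a total exponent of at most `2 ^ (2 * d + 3)`, and `2 * d + 3` is
-- at most `5 * d` once `d` is positive; hence the constant 5.
cap-bound : ∀ d .{{_ : NonZero d}} → stages (suc d) (suc d) 1 * 2 ^ d ≤ 2 ^ (2 ^ (5 * d))
cap-bound d = begin
  stages (suc d) (suc d) 1 * 2 ^ d                  ≤⟨ ℕₚ.*-monoˡ-≤ (2 ^ d) (stages-bound (suc d) (suc d) 1) ⟩
  (8 * suc d * 1) ^ (2 ^ suc d) * 2 ^ d             ≤⟨ ℕₚ.*-monoˡ-≤ (2 ^ d) (ℕₚ.^-monoˡ-≤ (2 ^ suc d) base) ⟩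
  (2 ^ (3 + d)) ^ (2 ^ suc d) * 2 ^ d               ≡⟨ cong (_* 2 ^ d) (ℕₚ.^-*-assoc 2 (3 + d) (2 ^ suc d)) ⟩
  2 ^ ((3 + d) * 2 ^ suc d) * 2 ^ d                 ≡⟨ ℕₚ.^-distribˡ-+-* 2 ((3 + d) * 2 ^ suc d) d ⟨
  2 ^ ((3 + d) * 2 ^ suc d + d)                     ≤⟨ ℕₚ.^-monoʳ-≤ 2 exponent ⟩
  2 ^ (2 ^ (5 * d))                                 ∎
  where
  open ≤-Reasoning
  base : 8 * suc d * 1 ≤ 2 ^ (3 + d)
  base = begin
    8 * suc d * 1       ≡⟨ ℕₚ.*-identityʳ (8 * suc d) ⟩
    8 * suc d           ≤⟨ ℕₚ.*-monoʳ-≤ 8 (1+n≤2^n d) ⟩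
    8 * 2 ^ d           ≡⟨ ℕₚ.^-distribˡ-+-* 2 3 d ⟨
    2 ^ (3 + d)         ∎
  exponent : (3 + d) * 2 ^ suc d + d ≤ 2 ^ (5 * d)
  exponent = begin
    (3 + d) * 2 ^ suc d + d                 ≤⟨ ℕₚ.+-monoʳ-≤ _ (ℕₚ.m≤m*n d (2 ^ suc d) {{ℕₚ.m^n≢0 2 (suc d)}}) ⟩
    (3 + d) * 2 ^ suc d + d * 2 ^ suc d     ≡⟨ ℕₚ.*-distribʳ-+ (2 ^ suc d) (3 + d) d ⟨
    (3 + d + d) * 2 ^ suc d                 ≤⟨ ℕₚ.*-monoˡ-≤ (2 ^ suc d) slope ⟩
    2 ^ (2 + d) * 2 ^ suc d                 ≡⟨ ℕₚ.^-distribˡ-+-* 2 (2 + d) (suc d) ⟨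
    2 ^ (2 + d + suc d)                     ≤⟨ ℕₚ.^-monoʳ-≤ 2 linear ⟩
    2 ^ (5 * d)                             ∎
    where
    slope : 3 + d + d ≤ 2 ^ (2 + d)
    slope = begin
      3 + d + d                     ≤⟨ ℕₚ.m≤m+n (3 + d + d) (1 + d + d) ⟩
      3 + d + d + (1 + d + d)       ≡⟨ lemma d ⟩
      4 * suc d                     ≤⟨ ℕₚ.*-monoʳ-≤ 4 (1+n≤2^n d) ⟩
      4 * 2 ^ d                     ≡⟨ ℕₚ.^-distribˡ-+-* 2 2 d ⟨
      2 ^ (2 + d)                   ∎
      where
      lemma : ∀ d → 3 + d + d + (1 + d + d) ≡ 4 * suc d
      lemma = ℕ-Ring.solve-∀
    linear : 2 + d + suc d ≤ 5 * d
    linear = begin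
      2 + d + suc d                 ≡⟨ lemma₁ d ⟩
      3 * 1 + 2 * d                 ≤⟨ ℕₚ.+-monoˡ-≤ (2 * d) (ℕₚ.*-monoʳ-≤ 3 (>-nonZero⁻¹ d)) ⟩
      3 * d + 2 * d                 ≡⟨ lemma₂ d ⟩
      5 * d                         ∎
      where
      lemma₁ : ∀ d → 2 + d + suc d ≡ 3 * 1 + 2 * d
      lemma₁ = ℕ-Ring.solve-∀
      lemma₂ : ∀ d → 3 * d + 2 * d ≡ 5 * d
      lemma₂ = ℕ-Ring.solve-∀

-- Multiplicity functions as lists

entries : ∀ {n d} → (Fin n → Vec ℤ d) → (Fin n → ℕ) → List (Vec ℤ d × ℕ)
entries {zero}  p f = []
entries {suc n} p f with f zero
... | zero  = entries (p ∘ suc) (f ∘ suc)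
... | suc m = (p zero , suc m) ∷ entries (p ∘ suc) (f ∘ suc)

combℤ-++ : ∀ {d} (L M : List (Vec ℤ d × ℕ)) k → lookup (combℤ (L ++ M)) k ≡ lookup (combℤ L) k ℤ.+ lookup (combℤ M) k
combℤ-++ []            M k = sym (trans (cong (ℤ._+ lookup (combℤ M) k) (Vecₚ.lookup-replicate k (+ 0))) (ℤₚ.+-identityˡ _))
combℤ-++ ((p , m) ∷ L) M k = begin
  lookup (combℤ ((p , m) ∷ L ++ M)) k                                       ≡⟨ lookup-combℤ p m (L ++ M) k ⟩
  + m ℤ.* lookup p k ℤ.+ lookup (combℤ (L ++ M)) k                          ≡⟨ cong (ℤ._+_ (+ m ℤ.* lookup p k)) (combℤ-++ L M k) ⟩
  + m ℤ.* lookup p k ℤ.+ (lookup (combℤ L) k ℤ.+ lookup (combℤ M) k)        ≡⟨ ℤₚ.+-assoc (+ m ℤ.* lookup p k) _ _ ⟨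
  + m ℤ.* lookup p k ℤ.+ lookup (combℤ L) k ℤ.+ lookup (combℤ M) k          ≡⟨ cong (ℤ._+ lookup (combℤ M) k) (lookup-combℤ p m L k) ⟨
  lookup (combℤ ((p , m) ∷ L)) k ℤ.+ lookup (combℤ M) k                     ∎
  where open ≡-Reasoning

combℤ-entries : ∀ {n d} (p : Fin n → Vec ℤ d) f k → lookup (combℤ (entries p f)) k ≡ ⟪ f , (λ i → lookup (p i) k) ⟫
combℤ-entries {zero}  p f k = Vecₚ.lookup-replicate k (+ 0)
combℤ-entries {suc n} p f k with f zero
... | zero  = trans (combℤ-entries (p ∘ suc) (f ∘ suc) k)
  (sym (trans (cong (ℤ._+ ⟪ f ∘ suc , (λ i → lookup (p (suc i)) k) ⟫) (ℤₚ.*-zeroˡ (lookup (p zero) k))) (ℤₚ.+-identityˡ _)))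
... | suc m = trans (lookup-combℤ (p zero) (suc m) (entries (p ∘ suc) (f ∘ suc)) k)
  (cong (ℤ._+_ (+ suc m ℤ.* lookup (p zero) k)) (combℤ-entries (p ∘ suc) (f ∘ suc) k))

length-entries : ∀ {n d} (p : Fin n → Vec ℤ d) f → length (entries p f) ≡ count f
length-entries {zero}  p f = refl
length-entries {suc n} p f with f zero
... | zero  = length-entries (p ∘ suc) (f ∘ suc)
... | suc m = cong suc (length-entries (p ∘ suc) (f ∘ suc))

all-entries : ∀ {n d} (p : Fin n → Vec ℤ d) f {Q : Vec ℤ d × ℕ → Set} → (∀ i → f i ≢ 0 → Q (p i , f i)) → All Q (entries p f)
all-entries {zero}  p f q = []
all-entries {suc n} p f q with f zero | q zero
... | zero  | _  = all-entries (p ∘ suc) (f ∘ suc) (q ∘ suc)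
... | suc m | q₀ = q₀ (λ ()) ∷ all-entries (p ∘ suc) (f ∘ suc) (q ∘ suc)

unique-entries : ∀ {n d} (p : Fin n → Vec ℤ d) f → (∀ i j → p i ≡ p j → i ≡ j) → Unique (map proj₁ (entries p f))
unique-entries {zero}  p f inj = []
unique-entries {suc n} p f inj with f zero
... | zero  = unique-entries (p ∘ suc) (f ∘ suc) (λ i j e → Finₚ.suc-injective (inj (suc i) (suc j) e))
... | suc m = Allₚ.map⁺ (all-entries (p ∘ suc) (f ∘ suc) {Q = λ e → p zero ≢ proj₁ e} (λ i _ e → Finₚ.0≢1+n (inj zero (suc i) e)))
  ∷ unique-entries (p ∘ suc) (f ∘ suc) (λ i j e → Finₚ.suc-injective (inj (suc i) (suc j) e))

∈-entries : ∀ {n d} (p : Fin n → Vec ℤ d) f {x} → x ∈ map proj₁ (entries p f) → ∃ λ i → f i ≢ 0 × x ≡ p i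
∈-entries p f x∈ = All.lookup {P = λ x → ∃ λ i → f i ≢ 0 × x ≡ p i}
  (Allₚ.map⁺ (all-entries p f {λ e → ∃ λ i → f i ≢ 0 × proj₁ e ≡ p i} (λ i fi → i , fi , refl))) x∈

-- Enumeration of a box of integer vectors

unique-lookup : ∀ {A : Set} {xs : List A} → Unique xs → ∀ i j → List.lookup xs i ≡ List.lookup xs j → i ≡ j
unique-lookup (x∉ ∷ u) zero    zero    e = refl
unique-lookup (x∉ ∷ u) zero    (suc j) e = ⊥-elim (All.lookup x∉ (∈ₚ.∈-lookup j) e)
unique-lookup (x∉ ∷ u) (suc i) zero    e = ⊥-elim (All.lookup x∉ (∈ₚ.∈-lookup i) (sym e))
unique-lookup (x∉ ∷ u) (suc i) (suc j) e = cong suc (unique-lookup u i j e)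

interval : ℕ → List ℤ
interval B = List.map +_ (List.upTo (suc B)) ++ List.map -[1+_] (List.upTo B)

∈-interval : ∀ {B} z → ℤ.∣ z ∣ ≤ B → z ∈ interval B
∈-interval {B} (+ k)    le = ∈ₚ.∈-++⁺ˡ (∈ₚ.∈-map⁺ +_ (∈ₚ.∈-upTo⁺ (s≤s le)))
∈-interval {B} -[1+ k ] le = ∈ₚ.∈-++⁺ʳ (List.map +_ (List.upTo (suc B))) (∈ₚ.∈-map⁺ -[1+_] (∈ₚ.∈-upTo⁺ le))

box : ℕ → ∀ d → List (Vec ℤ d)
box B zero    = [] ∷ []
box B (suc d) = List.cartesianProductWith _∷_ (interval B) (box B d)

∈-box : ∀ {B d} (x : Vec ℤ d) → (∀ k → ℤ.∣ lookup x k ∣ ≤ B) → x ∈ box B d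
∈-box []       le = Any.here refl
∈-box (z ∷ x) le = ∈ₚ.∈-cartesianProductWith⁺ _∷_ (∈-interval z (le zero)) (∈-box x (le ∘ suc))

toℚ-abs : ∀ z {B} → ℚ.∣ toℚ z ∣ ℚ.≤ toℚ (+ B) → ℤ.∣ z ∣ ≤ B
toℚ-abs (+ k) {B} le = ℤₚ.drop‿+≤+ (toℚ-cancel {+ k} {+ B} (subst (ℚ._≤ toℚ (+ B)) (ℚₚ.0≤p⇒∣p∣≡p (toℚ-mono {+ 0} {+ k} (ℤ.+≤+ z≤n))) le))
toℚ-abs -[1+ k ] {B} le = toℚ-abs (+ suc k) (subst (ℚ._≤ toℚ (+ B)) (ℚₚ.∣-p∣≡∣p∣ (toℚ (+ suc k))) le)

lookup-≡ : ∀ {A : Set} {d} {x y : Vec A d} → (∀ k → lookup x k ≡ lookup y k) → x ≡ y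
lookup-≡ {x = x} {y} eq = trans (sym (Vecₚ.tabulate∘lookup x)) (trans (Vecₚ.tabulate-cong eq) (Vecₚ.tabulate∘lookup y))

SparseDecomposition : ∀ {m d} → ℤMat m d → Vec ℕ m → ℕ → ℤVec d → Set
SparseDecomposition {d = d} A c B b =
  Σ (List (ℤVec d × ℕ)) λ Lv → Σ (List (ℤVec d × ℕ)) λ Ln →
    Unique (map proj₁ (Lv ++ Ln))
  × All (λ e → IsVertexI A c (proj₁ e)) Lv
  × All (λ e → InPℤ A c (proj₁ e) × ¬ IsVertexI A c (proj₁ e)) Ln
  × combℤ (Lv ++ Ln) ≡ b
  × All (λ e → proj₂ e ≤ B) Ln
  × length Lv ≤ d * 2 ^ d
  × length Ln ≤ 2 ^ (2 * d)

-- The lattice points of the polytope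

module _ {m d} (A : ℤMat m d) (c : Vec ℕ m) (poly : IsPolytope A c) where

  origin : Vec ℤ d
  origin = replicate d (+ 0)

  InPℤ-origin : InPℤ A c origin
  InPℤ-origin i = subst (ℤ._≤ + lookup c i) (sym (trans (dotℤ-∙ (lookup A i) origin) (∑ℤ-zero zeros))) (ℤ.+≤+ z≤n)
    where
    zeros : ∀ k → lookup (lookup A i) k ℤ.* lookup origin k ≡ + 0
    zeros k = trans (cong (ℤ._*_ (lookup (lookup A i) k)) (Vecₚ.lookup-replicate k (+ 0))) (ℤₚ.*-zeroʳ (lookup (lookup A i) k))

  bounded : ∀ x → InPℤ A c x → ∀ k → ℤ.∣ lookup x k ∣ ≤ proj₁ poly
  bounded x x∈P k = toℚ-abs (lookup x k) (subst (λ q → ℚ.∣ q ∣ ℚ.≤ toℚ (+ proj₁ poly)) (Vecₚ.lookup-map k toℚ x)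
    (proj₂ poly (toℚVec x) (λ i → subst (ℚ._≤ toℚ (+ lookup c i)) (sym (dotℚ-toℚ (lookup A i) x)) (toℚ-mono (x∈P i))) k))

  _≟ᵥ_ : (x y : Vec ℤ d) → Dec (x ≡ y)
  _≟ᵥ_ = Vecₚ.≡-dec ℤ._≟_

  -- The origin is excluded: it does not affect a combination, and every `Hull` contains it
  -- implicitly.
  Listed : Vec ℤ d → Set
  Listed x = InPℤ A c x × x ≢ origin

  listed? : ∀ x → Dec (Listed x)
  listed? x = Finₚ.all? (λ i → dotℤ (lookup A i) x ℤ.≤? + lookup c i) ×-dec ¬? (x ≟ᵥ origin)

  points : List (Vec ℤ d)
  points = List.deduplicate _≟ᵥ_ (List.filter listed? (box (proj₁ poly) d))

  pt : Fin (length points) → Vec ℤ d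
  pt = List.lookup points

  pt-listed : ∀ i → Listed (pt i)
  pt-listed i = proj₂ (∈ₚ.∈-filter⁻ listed? {xs = box (proj₁ poly) d}
    (∈ₚ.∈-deduplicate⁻ _≟ᵥ_ (List.filter listed? (box (proj₁ poly) d)) (∈ₚ.∈-lookup i)))

  pt-injective : ∀ i j → pt i ≡ pt j → i ≡ j
  pt-injective = unique-lookup (DecUniqueₚ.deduplicate-! _≟ᵥ_ (List.filter listed? (box (proj₁ poly) d)))

  pt-complete : ∀ x → Listed x → ∃ λ i → pt i ≡ x
  pt-complete x l = Any.index x∈ , sym (Anyₚ.lookup-index x∈)
    where
    x∈ : x ∈ points
    x∈ = ∈ₚ.∈-deduplicate⁺ _≟ᵥ_ (∈ₚ.∈-filter⁺ listed? (∈-box x (bounded x (proj₁ l))) l)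

  module Points {n} (p : Fin n → Vec ℤ d) (p-listed : ∀ i → Listed (p i)) (p-injective : ∀ i j → p i ≡ p j → i ≡ j)
    (p-complete : ∀ x → Listed x → ∃ λ i → p i ≡ x) where

    X : Fin n → Fin d → ℤ
    X i k = lookup (p i) k

    X-inj : ∀ i j → (∀ k → X i k ≡ X j k) → i ≡ j
    X-inj i j eq = p-injective i j (lookup-≡ eq)

    hull⇒InPℤ : ∀ {S} x → Hull X S (lookup x) → InPℤ A c x
    hull⇒InPℤ x h i = ℤₚ.*-cancelˡ-≤-pos _ _ (+ N) {{ℤ.positive (ℤ.+<+ N>0)}} (begin
      + N ℤ.* dotℤ row x                              ≡⟨ cong (ℤ._*_ (+ N)) (dotℤ-∙ row x) ⟩
      + N ℤ.* (lookup row ∙ lookup x)                 ≡⟨ ∑ℤ-* (+ N) (λ k → lookup row k ℤ.* lookup x k) ⟨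
      ∑ℤ (λ k → + N ℤ.* (lookup row k ℤ.* lookup x k)) ≡⟨ ∑ℤ.sum-cong-≗ (λ k → trans (*-swapℤ (+ N) (lookup row k) (lookup x k)) (cong (ℤ._*_ (lookup row k)) (comb k))) ⟩
      lookup row ∙ (λ k → ⟪ coef , (λ j → X j k) ⟫)   ≡⟨ ∙-pair coef X (lookup row) ⟩
      ⟪ coef , (λ j → lookup row ∙ X j) ⟫             ≤⟨ ∑ℤ-mono (λ j → ℤₚ.*-monoˡ-≤-nonNeg (+ coef j) (subst (ℤ._≤ + lookup c i) (dotℤ-∙ row (p j)) (proj₁ (p-listed j) i))) ⟩
      ∑ℤ (λ j → + coef j ℤ.* + lookup c i)            ≡⟨ ∑ℤ.sum-cong-≗ (λ j → sym (ℤₚ.pos-* (coef j) (lookup c i))) ⟩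
      ∑ℤ (λ j → + (coef j * lookup c i))              ≡⟨ ∑ℤ-pos (λ j → coef j * lookup c i) ⟩
      + ∑ℕ (λ j → coef j * lookup c i)                ≡⟨ cong +_ (∑ℕ.*-distribʳ-sum (lookup c i) coef) ⟨
      -- The weight missing from `N` belongs to the origin, which satisfies the inequality because
      -- `lookup c i` is a natural number.
      + (∑ℕ coef * lookup c i)                        ≤⟨ ℤ.+≤+ (ℕₚ.*-monoˡ-≤ (lookup c i) total) ⟩
      + (N * lookup c i)                              ≡⟨ ℤₚ.pos-* N (lookup c i) ⟩
      + N ℤ.* + lookup c i                            ∎)
      where
      open Hull h
      open ℤₚ.≤-Reasoning
      row : Vec ℤ d
      row = lookup A i

    closed : ∀ r → Hull X All-points r → (∀ k → r k ≡ + 0) ⊎ ∃ λ i → ∀ k → X i k ≡ r k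
    closed r h = classify (x ≟ᵥ origin)
      where
      x : Vec ℤ d
      x = tabulate r
      x≗r : ∀ k → lookup x k ≡ r k
      x≗r = Vecₚ.lookup∘tabulate r
      classify : Dec (x ≡ origin) → (∀ k → r k ≡ + 0) ⊎ ∃ λ i → ∀ k → X i k ≡ r k
      classify (yes e) = inj₁ (λ k → trans (sym (x≗r k)) (trans (cong (λ y → lookup y k) e) (Vecₚ.lookup-replicate k (+ 0))))
      classify (no ne) with p-complete x (hull⇒InPℤ x (hull-cong (sym ∘ x≗r) h) , ne)
      ... | i , e = inj₂ (i , λ k → trans (cong (λ y → lookup y k) e) (x≗r k))

    module Den (S : Fin n → ℕ) = Denominators toℚ refl toℚ-+ toℚ-* toℚ-mono numerator lookup-combℚ p S

    unit : ∀ {S} v → InPℤ A c v → (∀ i → p i ≡ v → S i ≢ 0) → Den.Unit S v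
    unit {S} v v∈P Sv = classify (v ≟ᵥ origin)
      where
      classify : Dec (v ≡ origin) → Den.Unit S v
      classify (yes refl) = record
        { ρ = λ _ → 0 ; total = subst (_≤ 1) (sym (∑ℕ.sum-replicate-zero n)) z≤n ; supp = λ i ne → ⊥-elim (ne refl)
        ; value = λ k → trans (Cb.pair-0 (λ i → X i k)) (sym (Vecₚ.lookup-replicate k (+ 0))) }
      classify (no ne) with p-complete v (v∈P , ne)
      ... | j , refl = record
        { ρ = δ j ; total = ℕₚ.≤-reflexive (∑ℕ-δ j) ; supp = supp
        ; value = λ k → Cb.pair-δ j (λ i → X i k) }
        where
        supp : ∀ i → δ j i ≢ 0 → S i ≢ 0
        supp i ne′ with j Fin.≟ i
        ... | yes refl = Sv i refl
        ... | no j≢i = ⊥-elim (ne′ (δ-≢ j≢i))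

    -- Entries at the origin go into the slack of the hull; every other entry is some `p j` with `j`
    -- different from `i`.
    convOthers⇒hull : ∀ i → InConvOthers A c (p i) (toℚVec (p i)) → Hull X (Others X i) (X i)
    convOthers⇒hull i (L , all , ∑≡1 , comb≡) = record
      { N = N ; N>0 = N>0 ; coef = C.c ; supp = C.supp
      ; total = ℤₚ.drop‿+≤+ (toℚ-cancel (subst (toℚ (+ ∑ℕ C.c) ℚ.≤_) (trans (cong (ℚ._*_ (toℚ (+ N))) ∑≡1) (ℚₚ.*-identityʳ _)) C.total))
      ; comb = λ k → toℚ-injective (begin
          toℚ (+ N ℤ.* X i k)                          ≡⟨ toℚ-* (+ N) (X i k) ⟩
          toℚ (+ N) ℚ.* toℚ (X i k)                    ≡⟨ cong (ℚ._*_ (toℚ (+ N))) (trans (cong (λ y → lookup y k) comb≡) (Vecₚ.lookup-map k toℚ (p i))) ⟨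
          toℚ (+ N) ℚ.* lookup (combℚ L) k             ≡⟨ C.comb k ⟩
          toℚ ⟪ C.c , (λ j → X j k) ⟫                  ∎)
      }
      where
      open ≡-Reasoning
      avoids : ∀ {v} → v ≢ p i → ∀ j → p j ≡ v → Others X i j ≢ 0
      avoids v≢ j e = subst (_≢ 0) (sym (∖-≢ All-points i≢j)) (λ ())
        where
        i≢j : i ≢ j
        i≢j refl = v≢ (sym e)
      units : All (λ e → Den.Unit (Others X i) (proj₁ e) × 0ℚ ℚ.≤ proj₂ e) L
      units = All.map (λ { (v∈P , v≢ , q≥0) → unit _ v∈P (avoids v≢) , q≥0 }) all
      cleared : Den.Cleared (Others X i) L
      cleared = Den.clear (Others X i) L units
      module C = Den.Cleared (Others X i) cleared
      open C using (N; N>0)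

    -- The slack N - ∑ coef is the weight of the origin, which also replaces X i itself.
    hull⇒convOthers : ∀ i → Hull X (Others X i) (X i) → InConvOthers A c (p i) (toℚVec (p i))
    hull⇒convOthers i h = convex (reciprocal N N>0)
      where
      open Hull h
      open ≡-Reasoning
      p′ : Fin n → Vec ℤ d
      p′ j with i Fin.≟ j
      ... | yes _ = origin
      ... | no _  = p j
      origin≢ : origin ≢ p i
      origin≢ e = proj₂ (p-listed i) (sym e)
      p′-good : ∀ j → InPℤ A c (p′ j) × p′ j ≢ p i
      p′-good j with i Fin.≟ j
      ... | yes _  = InPℤ-origin , origin≢
      ... | no i≢j = proj₁ (p-listed j) , λ e → i≢j (sym (p-injective j i e))
      p′-term : ∀ k j → + coef j ℤ.* lookup (p′ j) k ≡ + coef j ℤ.* X j k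
      p′-term k j with i Fin.≟ j
      ... | no _ = refl
      ... | yes refl with coef i ℕₚ.≟ 0
      ...   | yes e  rewrite e = trans (ℤₚ.*-zeroˡ (lookup origin k)) (sym (ℤₚ.*-zeroˡ (X i k)))
      ...   | no ne = ⊥-elim (supp i ne (∖-refl All-points i))
      a : Fin (suc n) → ℕ
      a = (N ∸ ∑ℕ coef) ▹ coef
      v : Fin (suc n) → Vec ℤ d
      v = origin ▹ p′
      v-good : ∀ j → InPℤ A c (v j) × v j ≢ p i
      v-good zero    = InPℤ-origin , origin≢
      v-good (suc j) = p′-good j
      v-comb : ∀ k → ⟪ a , (λ j → lookup (v j) k) ⟫ ≡ + N ℤ.* X i k
      v-comb k = begin
        + (N ∸ ∑ℕ coef) ℤ.* lookup origin k ℤ.+ ⟪ coef , (λ j → lookup (p′ j) k) ⟫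
          ≡⟨ cong₂ ℤ._+_ (trans (cong (ℤ._*_ (+ (N ∸ ∑ℕ coef))) (Vecₚ.lookup-replicate k (+ 0))) (ℤₚ.*-zeroʳ (+ (N ∸ ∑ℕ coef)))) (∑ℤ.sum-cong-≗ (p′-term k)) ⟩
        + 0 ℤ.+ ⟪ coef , (λ j → X j k) ⟫          ≡⟨ ℤₚ.+-identityˡ _ ⟩
        ⟪ coef , (λ j → X j k) ⟫                  ≡⟨ comb k ⟨
        + N ℤ.* X i k                             ∎
      convex : (Σ ℚ λ q → 0ℚ ℚ.≤ q × toℚ (+ N) ℚ.* q ≡ 1ℚ) → InConvOthers A c (p i) (toℚVec (p i))
      convex (q , q≥0 , Nq≡1) = weighted v a q , Allₚ.tabulate⁺ good , sum≡ , lookup-≡ coord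
        where
        good : ∀ j → InPℤ A c (v j) × v j ≢ p i × 0ℚ ℚ.≤ toℚ (+ a j) ℚ.* q
        good j = proj₁ (v-good j) , proj₂ (v-good j) ,
          subst (ℚ._≤ toℚ (+ a j) ℚ.* q) (ℚₚ.*-zeroˡ q) (ℚₚ.*-monoʳ-≤-nonNeg q {{ℚ.nonNegative q≥0}} (toℚ-mono {+ 0} {+ a j} (ℤ.+≤+ z≤n)))
        sum≡ : sumℚ (weighted v a q) ≡ 1ℚ
        sum≡ = trans (sumℚ-weighted v a q) (trans (cong (λ s → toℚ (+ s) ℚ.* q) (ℕₚ.m∸n+n≡m total)) Nq≡1)
        coord : ∀ k → lookup (combℚ (weighted v a q)) k ≡ lookup (toℚVec (p i)) k
        coord k = begin
          lookup (combℚ (weighted v a q)) k                     ≡⟨ combℚ-weighted v a q k ⟩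
          toℚ ⟪ a , (λ j → lookup (v j) k) ⟫ ℚ.* q              ≡⟨ cong (λ s → toℚ s ℚ.* q) (v-comb k) ⟩
          toℚ (+ N ℤ.* X i k) ℚ.* q                             ≡⟨ cong (ℚ._* q) (trans (toℚ-* (+ N) (X i k)) (ℚₚ.*-comm (toℚ (+ N)) (toℚ (X i k)))) ⟩
          toℚ (X i k) ℚ.* toℚ (+ N) ℚ.* q                       ≡⟨ ℚₚ.*-assoc (toℚ (X i k)) (toℚ (+ N)) q ⟩
          toℚ (X i k) ℚ.* (toℚ (+ N) ℚ.* q)                     ≡⟨ trans (cong (ℚ._*_ (toℚ (X i k))) Nq≡1) (ℚₚ.*-identityʳ _) ⟩
          toℚ (X i k)                                           ≡⟨ Vecₚ.lookup-map k toℚ (p i) ⟨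
          lookup (toℚVec (p i)) k                               ∎

    -- Repeated entries of the list are merged here, and entries at the origin disappear.
    multiplicities : ∀ L → All (λ e → InPℤ A c (proj₁ e)) L →
      Σ (Fin n → ℕ) λ μ → ∀ k → ⟪ μ , (λ i → X i k) ⟫ ≡ lookup (combℤ L) k
    multiplicities [] [] = (λ _ → 0) , λ k → trans (Cb.pair-0 (λ i → X i k)) (sym (Vecₚ.lookup-replicate k (+ 0)))
    multiplicities ((v , m) ∷ L) (v∈P ∷ all) = add (multiplicities L all) (unit {All-points} v v∈P (λ _ _ ()))
      where
      open ≡-Reasoning
      add : (Σ (Fin n → ℕ) λ μ → ∀ k → ⟪ μ , (λ i → X i k) ⟫ ≡ lookup (combℤ L) k) → Den.Unit All-points v →
        Σ (Fin n → ℕ) λ μ → ∀ k → ⟪ μ , (λ i → X i k) ⟫ ≡ lookup (combℤ ((v , m) ∷ L)) k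
      add (μ , eq) u = (λ i → m * ρ i + μ i) , λ k → begin
        ⟪ (λ i → m * ρ i + μ i) , (λ i → X i k) ⟫                          ≡⟨ Cb.pair-+ (λ i → m * ρ i) μ (λ i → X i k) ⟩
        ⟪ (λ i → m * ρ i) , (λ i → X i k) ⟫ ℤ.+ ⟪ μ , (λ i → X i k) ⟫      ≡⟨ cong₂ ℤ._+_ (trans (Cb.pair-* m ρ (λ i → X i k)) (cong (ℤ._*_ (+ m)) (value k))) (eq k) ⟩
        + m ℤ.* lookup v k ℤ.+ lookup (combℤ L) k                          ≡⟨ lookup-combℤ v m L k ⟨
        lookup (combℤ ((v , m) ∷ L)) k                                     ∎
        where open Den.Unit All-points u

    module Answer (cap : ℕ)
      (small-remainder : ∀ {n} (a : Fin n → ℕ) N .{{_ : NonZero N}} → ∑ℕ a ≡ N → count a ≤ suc d → SmallRemainder a N (suc cap))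
      (w : Fin n → ℕ) (spans : Spans X w) (irreducible : Irreducible X w) where

      extreme : ∀ i → w i ≢ 0 → ¬ Hull X (Others X i) (X i)
      extreme = irreducible⇒extreme X X-inj spans irreducible

      module As = Assembly X X-inj closed cap small-remainder w spans extreme

      answer : ∀ b (μ : Fin n → ℕ) → (∀ k → ⟪ μ , (λ i → X i k) ⟫ ≡ lookup b k) → As.Decomposition μ →
        ∀ B → cap * 2 ^ d ≤ B → SparseDecomposition A c B b
      answer b μ μ≡b D B cap≤B = Lv , Ln , unique , vertices , nonvertices , lookup-≡ value′ ,
        all-entries p outer′ (λ i _ → ℕₚ.≤-trans (small i) cap≤B) ,
        subst (_≤ d * 2 ^ d) (sym (length-entries p inner′)) inner ,
        subst₂ _≤_ (sym (length-entries p outer′)) 2^d*2^d≡ outer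
        where
        open As.Decomposition D
        inner′ outer′ : Fin n → ℕ
        inner′ i = sel (w i) (Λ i)
        outer′ i = unsel (w i) (Λ i)
        Lv Ln : List (ℤVec d × ℕ)
        Lv = entries p inner′
        Ln = entries p outer′
        2^d*2^d≡ : 2 ^ d * 2 ^ d ≡ 2 ^ (2 * d)
        2^d*2^d≡ = trans (sym (ℕₚ.^-distribˡ-+-* 2 d d)) (cong (λ e → 2 ^ (d + e)) (sym (ℕₚ.+-identityʳ d)))
        disjoint : ∀ {x} → x ∈ map proj₁ Lv × x ∈ map proj₁ Ln → ⊥
        disjoint (x∈v , x∈n) with ∈-entries p inner′ x∈v | ∈-entries p outer′ x∈n
        ... | i , fi , x≡pi | j , fj , x≡pj = proj₁ (sel-supp (w i) fi)
          (subst (λ j → w j ≡ 0) (sym (p-injective i j (trans (sym x≡pi) x≡pj))) (proj₁ (unsel-supp (w j) fj)))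
        unique : Unique (map proj₁ (Lv ++ Ln))
        unique = subst Unique (sym (Listₚ.map-++ proj₁ Lv Ln))
          (Uniqueₚ.++⁺ (unique-entries p inner′ p-injective) (unique-entries p outer′ p-injective) disjoint)
        vertices : All (λ e → IsVertexI A c (proj₁ e)) Lv
        vertices = all-entries p inner′ (λ i ne → proj₁ (p-listed i) ,
          λ conv → extreme i (proj₁ (sel-supp (w i) ne)) (convOthers⇒hull i conv))
        nonvertices : All (λ e → InPℤ A c (proj₁ e) × ¬ IsVertexI A c (proj₁ e)) Ln
        nonvertices = all-entries p outer′ (λ i ne → proj₁ (p-listed i) ,
          λ vertex → proj₂ vertex (hull⇒convOthers i (nonvertex i ne)))
        value′ : ∀ k → lookup (combℤ (Lv ++ Ln)) k ≡ lookup b k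
        value′ k = begin
          lookup (combℤ (Lv ++ Ln)) k                          ≡⟨ combℤ-++ Lv Ln k ⟩
          lookup (combℤ Lv) k ℤ.+ lookup (combℤ Ln) k          ≡⟨ cong₂ ℤ._+_ (combℤ-entries p inner′ k) (combℤ-entries p outer′ k) ⟩
          ⟪ inner′ , (λ i → X i k) ⟫ ℤ.+ ⟪ outer′ , (λ i → X i k) ⟫ ≡⟨ Cb.pair-+ inner′ outer′ (λ i → X i k) ⟨
          ⟪ (λ i → inner′ i + outer′ i) , (λ i → X i k) ⟫      ≡⟨ Cb.pair-congˡ {y = λ i → X i k} (λ i → sel+unsel (w i) (Λ i)) ⟩
          ⟪ Λ , (λ i → X i k) ⟫                                ≡⟨ value k ⟩
          ⟪ μ , (λ i → X i k) ⟫                                ≡⟨ μ≡b k ⟩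
          lookup b k                                           ∎
          where open ≡-Reasoning

    sparse : ∀ cap → (∀ {n} (a : Fin n → ℕ) N .{{_ : NonZero N}} → ∑ℕ a ≡ N → count a ≤ suc d → SmallRemainder a N (suc cap)) →
      ∀ B → cap * 2 ^ d ≤ B → ∀ b → InIntCone A c b → SparseDecomposition A c B b
    sparse cap small-remainder B cap≤B b (L , all , L≡b) = build (irreducible-spanning X) (multiplicities L all)
      where
      build : (Σ (Fin n → ℕ) λ w → Spans X w × Irreducible X w) →
        (Σ (Fin n → ℕ) λ μ → ∀ k → ⟪ μ , (λ i → X i k) ⟫ ≡ lookup (combℤ L) k) → SparseDecomposition A c B b
      build (w , spans , irreducible) (μ , μ≡L) =
        answer b μ (λ k → trans (μ≡L k) (cong (λ v → lookup v k) L≡b)) (As.decompose μ) B cap≤B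
        where open Answer cap small-remainder w spans irreducible

  sparse-decomposition : ∀ cap → (∀ {n} (a : Fin n → ℕ) N .{{_ : NonZero N}} → ∑ℕ a ≡ N → count a ≤ suc d → SmallRemainder a N (suc cap)) →
    ∀ B → cap * 2 ^ d ≤ B → ∀ b → InIntCone A c b → SparseDecomposition A c B b
  sparse-decomposition = Points.sparse pt pt-listed pt-injective pt-complete

theorem5 : Σ ℕ λ C → 0 < C ×
    (∀ (d m : ℕ) (A : ℤMat m d) (c : Vec ℕ m) → IsPolytope A c →
    ∀ (b : ℤVec d) → InIntCone A c b →
    Σ (List (ℤVec d × ℕ)) λ Lv → Σ (List (ℤVec d × ℕ)) λ Ln →
    Unique (map proj₁ (Lv ++ Ln))
    × All (λ e → IsVertexI A c (proj₁ e)) Lv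
    × All (λ e → InPℤ A c (proj₁ e) × ¬ IsVertexI A c (proj₁ e)) Ln
    × combℤ (Lv ++ Ln) ≡ b
    × All (λ e → proj₂ e ≤ 2 ^ (2 ^ (C * d))) Ln
    × length Lv ≤ d * 2 ^ d
    × length Ln ≤ 2 ^ (2 * d))
theorem5 = 5 , s≤s z≤n , bound
  where
  bound : ∀ d m (A : ℤMat m d) c → IsPolytope A c → ∀ b → InIntCone A c b → SparseDecomposition A c (2 ^ (2 ^ (5 * d))) b
  -- In dimension 0 the bound is 2 for every constant `C`, below the value 8 of `stages 1 1 1`; the
  -- empty combination represents the only vector.
  bound zero    m A c poly [] b∈ = [] , [] , [] , [] , [] , refl , [] , z≤n , z≤n
  -- In dimension `suc d` a simplex has up to `2 + d` corners including the origin, which is the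
  -- value of `M`.
  bound (suc d) m A c poly b  b∈ = sparse-decomposition A c poly (stages (2 + d) (2 + d) 1)
    (λ a N → Dirichlet.small-remainder a N (2 + d)) (2 ^ (2 ^ (5 * suc d))) (cap-bound (suc d)) b b∈
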